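{- Let $f,g\in\mathcal{S}_d$ be such that $\hat{\mathbb{D}}_{\beta,d}(f,g)$ is finite for some $\beta>0$, and suppose that $S_f(x)\ll x^\alpha$. Then $S_g(x)\ll x^{\max(\alpha,\beta)}$.
   Context: $\mathcal{S}_d$ is the set of "degree $d$" multiplicative functions: those $f$ with $f=f_1*\cdots*f_d$, where each $f_i$ is a completely multiplicative function with $|f_i(n)|\le1$ for all $n$, and $(a*b)(n)=\sum_{dm=n}a(d)b(m)$. $S_f(x):=\sum_{n\le x}f(n)$. $\hat{\mathbb{D}}_{\beta,k}(f,g):=\sum_p\sum_{j=1}^k\frac{|f(p^j)-g(p^j)|}{p^{j\beta}}$ (sum over primes). -}

module Defs where

open import Level using (Level) renaming (suc to lsuc)
open import Algebra.Bundles using (CommutativeRing; RawMonoid; RawRing)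
open import Algebra.Core using (Op₁; Op₂)
import Algebra.Construct.NaturalChoice.Max as NaturalMax
import Algebra.Definitions.RawMonoid as RawMonoidDefs
import Algebra.Properties.Semiring.Exp as SemiringExp
open import Data.Bool.Base using (if_then_else_)
open import Data.Fin.Base using (toℕ)
open import Data.Integer.Base using (ℤ; +_; -[1+_])
open import Data.Nat.Base as ℕ using (ℕ; suc; NonZero)
import Data.Nat.Properties as ℕ
open import Data.Nat.Primality using (prime?)
open import Data.Product.Base using (_×_; _,_; ∃)
open import Data.Rational.Unnormalised.Base using (ℚᵘ; ↥_; ↧ₙ_)
open import Data.Vec.Functional using (Vector; foldr)
open import Relation.Binary.Bundles using (DecTotalOrder)
open import Relation.Binary.Core using (Rel)
open import Relation.Binary.Structures using (IsDecTotalOrder)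
import Relation.Binary.Construct.NonStrictToStrict as ToStrict
open import Relation.Nullary.Decidable using (⌊_⌋)
open import Relation.Nullary.Negation using (¬_)

private
  variable
    ℓ : Level

------------------------------------------------------------------------
-- The real numbers, characterised (up to isomorphism) as the complete
-- ordered field of classical mathematics; hence the decidable order.
-- The operations _⁻¹ and ⋁ are total, but unconstrained at 0# and on
-- sets that are empty or unbounded above, respectively.

record CompleteOrderedField (ℓ : Level) : Set (lsuc ℓ) where
  infix  4 _≤_ _<_
  infix  8 _⁻¹
  infixl 7 _/_

  field
    commutativeRing : CommutativeRing ℓ ℓ

  open CommutativeRing commutativeRing public

  field
    _≤_             : Rel Carrier ℓ
    isDecTotalOrder : IsDecTotalOrder _≈_ _≤_
    _⁻¹             : Op₁ Carrier
    ⋁               : (Carrier → Set ℓ) → Carrier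

  IsUpperBound : (Carrier → Set ℓ) → Carrier → Set ℓ
  IsUpperBound P b = ∀ y → P y → y ≤ b

  IsSupremum : (Carrier → Set ℓ) → Carrier → Set ℓ
  IsSupremum P s = IsUpperBound P s × (∀ b → IsUpperBound P b → s ≤ b)

  field
    1≉0          : 1# ≉ 0#
    ⁻¹-inverseʳ  : ∀ x → x ≉ 0# → x * x ⁻¹ ≈ 1#
    +-monoˡ-≤    : ∀ {x y} z → x ≤ y → x + z ≤ y + z
    *-nonNeg     : ∀ {x y} → 0# ≤ x → 0# ≤ y → 0# ≤ x * y
    ⋁-isSupremum : ∀ P → ∃ P → ∃ (IsUpperBound P) → IsSupremum P (⋁ P)

  decTotalOrder : DecTotalOrder ℓ ℓ ℓ
  decTotalOrder = record { isDecTotalOrder = isDecTotalOrder }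

  _<_ : Rel Carrier ℓ
  _<_ = ToStrict._<_ _≈_ _≤_

  _/_ : Op₂ Carrier
  x / y = x * y ⁻¹

module Sum₁ {c ℓ} (M : RawMonoid c ℓ) where
  open RawMonoid M using (Carrier)

  -- ∑₁ n f is the sum of f k over 1 ≤ k ≤ n.
  ∑₁ : ℕ → (ℕ → Carrier) → Carrier
  ∑₁ n f = RawMonoidDefs.sum M {n} (λ i → f (suc (toℕ i)))

module Reals (R : CompleteOrderedField ℓ) where
  open CompleteOrderedField R public
  open SemiringExp semiring public using (_^_)
  open NaturalMax (DecTotalOrder.totalOrder decTotalOrder) public using (_⊔_)
  open Sum₁ +-rawMonoid public

  infixr 8 _^ᶻ_ _^ʳ_

  ℝ : Set ℓ
  ℝ = Carrier

  fromℕ : ℕ → ℝ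
  fromℕ n = RawMonoidDefs._×_ +-rawMonoid n 1#

  fromℤ : ℤ → ℝ
  fromℤ (+ n)    = fromℕ n
  fromℤ -[1+ n ] = - fromℕ (suc n)

  fromℚᵘ : ℚᵘ → ℝ
  fromℚᵘ q = fromℤ (↥ q) / fromℕ (↧ₙ q)

  sqrt : ℝ → ℝ
  sqrt t = ⋁ (λ y → y * y ≤ t)

  _^ᶻ_ : ℝ → ℤ → ℝ
  a ^ᶻ (+ n)    = a ^ n
  a ^ᶻ -[1+ n ] = (a ⁻¹) ^ suc n

  IsRationalPower : ℝ → ℚᵘ → ℝ → Set ℓ
  IsRationalPower a q y = 0# ≤ y × y ^ (↧ₙ q) ≈ a ^ᶻ (↥ q)

  -- aˣ = sup { a^q ∣ q rational, q ≤ x }, which is the real power for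
  -- bases a ≥ 1; it is applied to no other base.
  _^ʳ_ : ℝ → ℝ → ℝ
  a ^ʳ x = ⋁ (λ y → ∃ λ q → fromℚᵘ q ≤ x × IsRationalPower a q y)

  -- The value of a series of non-negative terms u 1, u 2, …
  IsSumOfSeries : (ℕ → ℝ) → ℝ → Set ℓ
  IsSumOfSeries u = IsSupremum (λ y → ∃ λ N → y ≈ ∑₁ N u)

module Complexes (R : CompleteOrderedField ℓ) where
  open Reals R

  record ℂ : Set ℓ where
    constructor _+i_
    field
      re im : ℝ

  open ℂ public

  rawRing-ℂ : RawRing ℓ ℓ
  rawRing-ℂ = record
    { Carrier = ℂ
    ; _≈_     = λ z w → re z ≈ re w × im z ≈ im w
    ; _+_     = λ z w → (re z + re w) +i (im z + im w)
    ; _*_     = λ z w → (re z * re w - im z * im w) +i (re z * im w + im z * re w)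
    ; -_      = λ z → (- re z) +i (- im z)
    ; 0#      = 0# +i 0#
    ; 1#      = 1# +i 0#
    }

  ∣_∣ : ℂ → ℝ
  ∣ z ∣ = sqrt (re z * re z + im z * im z)

module ArithmeticFunctions (R : CompleteOrderedField ℓ) where
  open Reals R
  open Complexes R using (ℂ; rawRing-ℂ; ∣_∣)

  private
    module ℂʳ = RawRing rawRing-ℂ
    module ∑ℂ = Sum₁ ℂʳ.+-rawMonoid

  infixl 7 _⋆_

  -- Only the values at positive arguments are meaningful.
  ArithmeticFunction : Set ℓ
  ArithmeticFunction = ℕ → ℂ

  _⋆_ : ArithmeticFunction → ArithmeticFunction → ArithmeticFunction
  (a ⋆ b) n = ∑ℂ.∑₁ n λ d → ∑ℂ.∑₁ n λ m →
    if ⌊ d ℕ.* m ℕ.≟ n ⌋ then a d ℂʳ.* b m else ℂʳ.0#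

  ε : ArithmeticFunction
  ε n = if ⌊ n ℕ.≟ 1 ⌋ then ℂʳ.1# else ℂʳ.0#

  record CompletelyMultiplicative (f : ArithmeticFunction) : Set ℓ where
    field
      f1≈1 : f 1 ℂʳ.≈ ℂʳ.1#
      homo : ∀ m n .{{_ : NonZero m}} .{{_ : NonZero n}} →
             f (m ℕ.* n) ℂʳ.≈ f m ℂʳ.* f n

  UnitBounded : ArithmeticFunction → Set ℓ
  UnitBounded f = ∀ n .{{_ : NonZero n}} → ∣ f n ∣ ≤ 1#

  𝒮 : ℕ → ArithmeticFunction → Set ℓ
  𝒮 d f = ∃ λ (F : Vector ArithmeticFunction d) →
    (∀ i → CompletelyMultiplicative (F i) × UnitBounded (F i)) ×
    (∀ n .{{_ : NonZero n}} → f n ℂʳ.≈ foldr _⋆_ ε F n)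

  S : ArithmeticFunction → ℕ → ℂ
  S f N = ∑ℂ.∑₁ N f

  IsFloor : ℝ → ℕ → Set ℓ
  IsFloor x N = fromℕ N ≤ x × x < fromℕ (suc N)

  -- S_f(x) ≪ x^α, for real x ≥ 1.
  S[_]≪x^_ : ArithmeticFunction → ℝ → Set ℓ
  S[ f ]≪x^ α = ∃ λ C → ∀ x N → 1# ≤ x → IsFloor x N →
    ∣ S f N ∣ ≤ C * x ^ʳ α

  primeTerm : (β : ℝ) (k : ℕ) (f g : ArithmeticFunction) → ℕ → ℝ
  primeTerm β k f g p = ∑₁ k λ j →
    ∣ f (p ℕ.^ j) ℂʳ.+ ℂʳ.- g (p ℕ.^ j) ∣ / fromℕ p ^ʳ (fromℕ j * β)

  IsDistance : (β : ℝ) (k : ℕ) (f g : ArithmeticFunction) → ℝ → Set ℓ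
  IsDistance β k f g = IsSumOfSeries λ p →
    if ⌊ prime? p ⌋ then primeTerm β k f g p else 0#

  FiniteDistance : (β : ℝ) (k : ℕ) (f g : ArithmeticFunction) → Set ℓ
  FiniteDistance β k f g = ∃ (IsDistance β k f g)

{-# OPTIONS --safe #-}

-- Let V_p be the operator T ↦ (N ↦ T ⌊N / p⌋). Sieving f = f₁ ⋆ ⋯ ⋆ f_d by the primes up to N
-- shows that ∏_{p ≤ N} ∏ᵢ (1 - fᵢ(p) V_p) turns the summatory function of f into that of ε on
-- [0, N]. So the summatory function of g arises from that of f by exchanging, one prime p at a
-- time, A = ∏ᵢ (1 - fᵢ(p) V_p) for B = ∏ᵢ (1 - gᵢ(p) V_p), that is by solving B U = A T:
-- U = T + (A - B) B⁻¹ T. The polynomial A - B has degree at most d, and A - B = A B (B⁻¹ - A⁻¹)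
-- bounds its coefficients by the differences f(pʲ) - g(pʲ) with j ≤ d. Since V_pʲ scales N^γ,
-- γ = max(α, β), by at most p^(-jβ), an exchange costs a factor 1 + κ u_p in front of N^γ, where
-- u_p is the term of the distance at p; the product of these factors converges.
--
-- Boundedness (even the Archimedean property) is constructively available only under a double
-- negation. This suffices, because the constant in the conclusion can be taken to be a supremum
-- and the defining property of a supremum is stable.

module Submission where

open import Algebra.Bundles using (CommutativeRing; RawRing)
import Algebra.Construct.NaturalChoice.Max as NaturalMax
import Algebra.Construct.NaturalChoice.MaxOp as MaxOp
import Algebra.Properties.AbelianGroup as AbelianGroupProperties
import Algebra.Properties.CommutativeSemigroup as CommutativeSemigroupProperties
import Algebra.Properties.CommutativeSemiring.Exp as Exp
import Algebra.Properties.Ring as RingProperties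
import Algebra.Properties.Semiring.Mult as Mult
import Algebra.Properties.Semiring.Mult.TCOptimised as Multiples
import Algebra.Properties.Semiring.Sum as SemiringSum
import Algebra.Solver.Ring as RingSolver
open import Algebra.Solver.Ring.AlmostCommutativeRing using (_-Raw-AlmostCommutative⟶_; fromCommutativeRing)
open import Data.Bool.Base using (if_then_else_)
open import Data.Fin.Base using (zero; suc; toℕ)
open import Data.Integer.Base as ℤ using (ℤ; +_; -[1+_]; _⊖_)
import Data.Integer.Properties as ℤ
open import Data.List.Base using ([]; _∷_)
open import Data.List.Relation.Unary.All using (_∷_)
open import Data.Maybe.Base using (Maybe; map)
open import Data.Nat.Base as ℕ using (ℕ; zero; suc; NonZero; _%_)
open import Data.Nat.Coprimality using (Coprime; coprime-divisor)
open import Data.Nat.Divisibility using (_∣_; _∤_; _∣?_; divides; quotient≢0; ∣⇒≤; ∣m⇒∣m*n; ∣n⇒∣m*n; ∣1⇒≡1; m∣m*n; n∣m*n; m%n≡0⇒n∣m)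
import Data.Nat.DivMod as ℕ
open import Data.Nat.Primality using (Prime; prime?; prime⇒nonZero; prime⇒nonTrivial; prime⇒irreducible; euclidsLemma; ¬prime[1]; ¬prime[0])
open import Data.Nat.Primality.Factorisation using (factorise)
import Data.Nat.Properties as ℕ
open import Data.Product.Base using (_×_; _,_; ∃; proj₁; proj₂)
open import Data.Rational.Unnormalised.Base as ℚᵘ using (ℚᵘ; mkℚᵘ; ↥_; ↧_; ↧ₙ_; *≤*)
import Data.Rational.Unnormalised.Properties as ℚᵘ
open import Data.Sum.Base using (_⊎_; inj₁; inj₂; [_,_]′)
open import Data.Vec.Functional using (Vector; foldr; head; tail)
open import Defs
open import Function.Base using (_∘_; id)
import Level
open import Relation.Binary.Bundles using (DecTotalOrder)
open import Relation.Binary.PropositionalEquality.Core as ≡ using (_≡_; _≢_)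
import Relation.Binary.PropositionalEquality.Properties as ≡
import Relation.Binary.Reasoning.PartialOrder as PartialOrderReasoning
import Relation.Binary.Reasoning.Setoid as SetoidReasoning
open import Relation.Nullary.Decidable using (Dec; yes; no; ⌊_⌋; dec⇒maybe; decidable-stable)
open import Relation.Nullary.Negation using (¬_; contradiction)

-- Dividing g by f under convolution would bring in all prime powers. Exponents up to d suffice
-- because A and B are polynomials of degree at most d in V_p, so that A B (B⁻¹ - A⁻¹) need only be
-- known up to that degree. The constant κ is uniform in p. With the coefficient of V_pʲ weighted by
-- p^(-jβ), multiplication by 1 - x V_p with |x| ≤ 1 at most doubles the weighted sum of a series
-- without constant term: this gives 2^d for A and 2^d for B. Applying B⁻¹ costs ρ^d, where ρ = 1 /
-- (1 - 2^(-β)) sums the geometric series whose ratio bounds the effect of every V_p on N^γ. It is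
-- finite because β > 0. No limit of operators occurs: V_p lowers each positive argument, so at N
-- the series for B⁻¹ is a finite sum and only the primes up to N act. The price is that all
-- functions must vanish at 0, the fixed point of N ↦ ⌊N / p⌋. On such functions the product of the
-- factors B is injective, and this identifies the exchanged function with the summatory function of
-- g.

-- Ring identities with integer coefficients.

module IntegerSolver {c ℓ} (CR : CommutativeRing c ℓ) where
  open CommutativeRing CR
  open RingProperties ring using (-‿distribˡ-*; -‿distribʳ-*; -0#≈0#; -‿involutive)
  open AbelianGroupProperties +-abelianGroup using (⁻¹-∙-comm)
  open Multiples semiring using (×-homo-+; ×1-homo-*) renaming (_×_ to _·_)
  open import Relation.Binary.Reasoning.Setoid setoid

  private
    -- The optimised multiple makes `⟦ + 1 ⟧` reduce to `1#`, so that `con (+ 1)` in a solved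
    -- identity matches `1#` definitionally.
    ⟦_⟧ : ℤ → Carrier
    ⟦ + n ⟧      = n · 1#
    ⟦ -[1+ n ] ⟧ = - (suc n · 1#)

    ⊖-homo : ∀ m n → ⟦ m ⊖ n ⟧ ≈ m · 1# - n · 1#
    ⊖-homo zero    zero    = sym (-‿inverseʳ _)
    ⊖-homo zero    (suc n) = sym (+-identityˡ _)
    ⊖-homo (suc m) zero    = sym (trans (+-congˡ -0#≈0#) (+-identityʳ _))
    ⊖-homo (suc m) (suc n) = begin
      ⟦ suc m ⊖ suc n ⟧                     ≡⟨ ≡.cong ⟦_⟧ (ℤ.[1+m]⊖[1+n]≡m⊖n m n) ⟩
      ⟦ m ⊖ n ⟧                             ≈⟨ ⊖-homo m n ⟩
      m · 1# - n · 1#                       ≈⟨ +-congʳ (+-identityˡ _) ⟨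
      0# + m · 1# - n · 1#                  ≈⟨ +-congʳ (+-congʳ (-‿inverseʳ 1#)) ⟨
      1# - 1# + m · 1# - n · 1#             ≈⟨ +-congʳ (+-assoc _ _ _) ⟩
      1# + (- 1# + m · 1#) - n · 1#         ≈⟨ +-congʳ (+-congˡ (+-comm _ _)) ⟩
      1# + (m · 1# - 1#) - n · 1#           ≈⟨ +-congʳ (+-assoc _ _ _) ⟨
      1# + m · 1# - 1# - n · 1#             ≈⟨ +-assoc _ _ _ ⟩
      1# + m · 1# + (- 1# - n · 1#)         ≈⟨ +-cong (×-homo-+ 1# 1 m) (trans (-‿cong (×-homo-+ 1# 1 n)) (sym (⁻¹-∙-comm _ _))) ⟨
      suc m · 1# - suc n · 1#               ∎

    +-homo : ∀ i j → ⟦ i ℤ.+ j ⟧ ≈ ⟦ i ⟧ + ⟦ j ⟧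
    +-homo (+ m)      (+ n)      = ×-homo-+ 1# m n
    +-homo (+ m)      -[1+ n ]   = ⊖-homo m (suc n)
    +-homo -[1+ m ]   (+ n)      = trans (⊖-homo n (suc m)) (+-comm _ _)
    +-homo -[1+ m ]   -[1+ n ]   = begin
      - (suc (suc (m ℕ.+ n)) · 1#)      ≡⟨ ≡.cong (λ k → - (suc k · 1#)) (ℕ.+-suc m n) ⟨
      - ((suc m ℕ.+ suc n) · 1#)        ≈⟨ -‿cong (×-homo-+ 1# (suc m) (suc n)) ⟩
      - (suc m · 1# + suc n · 1#)       ≈⟨ ⁻¹-∙-comm _ _ ⟨
      - (suc m · 1#) - suc n · 1#       ∎

    -‿homo : ∀ i → ⟦ ℤ.- i ⟧ ≈ - ⟦ i ⟧
    -‿homo (+ zero)  = sym -0#≈0#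
    -‿homo (+ suc n) = refl
    -‿homo -[1+ n ]  = sym (-‿involutive _)

    +*-homo : ∀ m j → ⟦ + m ℤ.* j ⟧ ≈ m · 1# * ⟦ j ⟧
    +*-homo m (+ n) = trans (reflexive (≡.cong ⟦_⟧ (≡.sym (ℤ.pos-* m n)))) (×1-homo-* m n)
    +*-homo m -[1+ n ] = begin
      ⟦ + m ℤ.* -[1+ n ] ⟧       ≡⟨ ≡.cong ⟦_⟧ (ℤ.neg-distribʳ-* (+ m) (+ suc n)) ⟨
      ⟦ ℤ.- (+ m ℤ.* + suc n) ⟧  ≈⟨ -‿homo (+ m ℤ.* + suc n) ⟩
      - ⟦ + m ℤ.* + suc n ⟧      ≈⟨ -‿cong (+*-homo m (+ suc n)) ⟩
      - (m · 1# * (suc n · 1#))  ≈⟨ -‿distribʳ-* _ _ ⟩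
      m · 1# * ⟦ -[1+ n ] ⟧      ∎

    *-homo : ∀ i j → ⟦ i ℤ.* j ⟧ ≈ ⟦ i ⟧ * ⟦ j ⟧
    *-homo (+ m)    j = +*-homo m j
    *-homo -[1+ m ] j = begin
      ⟦ -[1+ m ] ℤ.* j ⟧       ≡⟨ ≡.cong ⟦_⟧ (ℤ.neg-distribˡ-* (+ suc m) j) ⟨
      ⟦ ℤ.- (+ suc m ℤ.* j) ⟧  ≈⟨ -‿homo (+ suc m ℤ.* j) ⟩
      - ⟦ + suc m ℤ.* j ⟧      ≈⟨ -‿cong (+*-homo (suc m) j) ⟩
      - (suc m · 1# * ⟦ j ⟧)   ≈⟨ -‿distribˡ-* _ _ ⟩
      ⟦ -[1+ m ] ⟧ * ⟦ j ⟧     ∎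

    homomorphism : ℤ.+-*-rawRing -Raw-AlmostCommutative⟶ fromCommutativeRing CR
    homomorphism = record
      { ⟦_⟧    = ⟦_⟧
      ; +-homo = +-homo
      ; *-homo = *-homo
      ; -‿homo = -‿homo
      ; 0-homo = refl
      ; 1-homo = refl
      }

    -- Equality in an abstract ring is not decidable, so coefficients are compared as integers.
    ≟⟦⟧ : ∀ i j → Maybe (⟦ i ⟧ ≈ ⟦ j ⟧)
    ≟⟦⟧ i j = map (λ eq → reflexive (≡.cong ⟦_⟧ eq)) (dec⇒maybe (i ℤ.≟ j))

  open RingSolver ℤ.+-*-rawRing (fromCommutativeRing CR) homomorphism ≟⟦⟧ public
    using (solve; _:=_; _:+_; _:*_; _:-_; :-_; con)

-- Ordered fields, suprema and the Archimedean property.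

module OrderedFieldProperties {ℓ} (R : CompleteOrderedField ℓ) where
  open Reals R
  open DecTotalOrder decTotalOrder public using (poset; _≤?_)
    renaming (refl to ≤-refl; trans to ≤-trans; reflexive to ≤-reflexive; antisym to ≤-antisym; total to ≤-total)
  open RingProperties (CommutativeRing.ring commutativeRing) public using (-0#≈0#; -‿involutive)
  module ≤-Reasoning = PartialOrderReasoning poset
  open IntegerSolver commutativeRing
  open Mult semiring using (×1-homo-*)
  open Exp commutativeSemiring public using (^-congˡ; ^-congʳ; ^-assocʳ; ^-distrib-*)

  private
    variable
      u v x y z : ℝ

  -- Lets an inequality be derived from a witness that exists only under a double negation.
  ≤-stable : ¬ ¬ (x ≤ y) → x ≤ y
  ≤-stable {x} {y} = decidable-stable (x ≤? y)

  ≰⇒≥ : ¬ (x ≤ y) → y ≤ x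
  ≰⇒≥ {x} {y} x≰y = [ (λ x≤y → contradiction x≤y x≰y) , id ]′ (≤-total x y)

  ≰⇒> : ¬ (x ≤ y) → y < x
  ≰⇒> x≰y = ≰⇒≥ x≰y , λ y≈x → x≰y (≤-reflexive (sym y≈x))

  <⇒≱ : x < y → ¬ (y ≤ x)
  <⇒≱ (x≤y , x≉y) y≤x = x≉y (≤-antisym x≤y y≤x)

  <⇒≤ : x < y → x ≤ y
  <⇒≤ = proj₁

  <-≤-trans : x < y → y ≤ z → x < z
  <-≤-trans x<y y≤z = ≤-trans (<⇒≤ x<y) y≤z , λ x≈z → <⇒≱ x<y (≤-trans y≤z (≤-reflexive (sym x≈z)))

  +-mono-≤ : x ≤ y → u ≤ v → x + u ≤ y + v
  +-mono-≤ {x} {y} {u} {v} x≤y u≤v = begin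
    x + u  ≤⟨ +-monoˡ-≤ u x≤y ⟩
    y + u  ≈⟨ +-comm y u ⟩
    u + y  ≤⟨ +-monoˡ-≤ y u≤v ⟩
    v + y  ≈⟨ +-comm v y ⟩
    y + v  ∎
    where open ≤-Reasoning

  x≤x+y : 0# ≤ y → x ≤ x + y
  x≤x+y {y} {x} 0≤y = ≤-trans (≤-reflexive (sym (+-identityʳ x))) (+-mono-≤ ≤-refl 0≤y)

  +-nonNeg : 0# ≤ x → 0# ≤ y → 0# ≤ x + y
  +-nonNeg 0≤x 0≤y = ≤-trans 0≤x (x≤x+y 0≤y)

  ≤-by : 0# ≤ z → x + z ≈ y → x ≤ y
  ≤-by 0≤z eq = ≤-trans (x≤x+y 0≤z) (≤-reflexive eq)

  x≤y⇒0≤y-x : x ≤ y → 0# ≤ y - x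
  x≤y⇒0≤y-x {x} {y} x≤y = ≤-trans (≤-reflexive (sym (-‿inverseʳ x))) (+-monoˡ-≤ (- x) x≤y)

  neg-mono-≤ : x ≤ y → - y ≤ - x
  neg-mono-≤ {x} {y} x≤y = ≤-by (x≤y⇒0≤y-x x≤y) (solve 2 (λ x y → :- y :+ (y :- x) := :- x) refl x y)

  *-monoʳ-≤ : ∀ z → 0# ≤ z → x ≤ y → z * x ≤ z * y
  *-monoʳ-≤ {x} {y} z 0≤z x≤y = ≤-by (*-nonNeg 0≤z (x≤y⇒0≤y-x x≤y))
    (solve 3 (λ x y z → z :* x :+ z :* (y :- x) := z :* y) refl x y z)

  *-monoˡ-≤ : ∀ z → 0# ≤ z → x ≤ y → x * z ≤ y * z
  *-monoˡ-≤ {x} {y} z 0≤z x≤y = ≤-trans (≤-reflexive (*-comm x z)) (≤-trans (*-monoʳ-≤ z 0≤z x≤y) (≤-reflexive (*-comm z y)))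

  *-mono-≤ : 0# ≤ x → 0# ≤ u → x ≤ y → u ≤ v → x * u ≤ y * v
  *-mono-≤ 0≤x 0≤u x≤y u≤v = ≤-trans (*-monoˡ-≤ _ 0≤u x≤y) (*-monoʳ-≤ _ (≤-trans 0≤x x≤y) u≤v)

  x²-nonNeg : ∀ x → 0# ≤ x * x
  x²-nonNeg x with ≤-total 0# x
  ... | inj₁ 0≤x = *-nonNeg 0≤x 0≤x
  ... | inj₂ x≤0 = ≤-trans (*-nonNeg 0≤-x 0≤-x) (≤-reflexive (solve 1 (λ x → (:- x) :* (:- x) := x :* x) refl x))
    where 0≤-x = ≤-trans (≤-reflexive (sym -0#≈0#)) (neg-mono-≤ x≤0)

  0≤1 : 0# ≤ 1#
  0≤1 = ≤-trans (x²-nonNeg 1#) (≤-reflexive (*-identityˡ 1#))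

  0<1 : 0# < 1#
  0<1 = 0≤1 , 1≉0 ∘ sym

  1≤⇒0< : 1# ≤ x → 0# < x
  1≤⇒0< = <-≤-trans 0<1

  ⁻¹-inverseˡ : ∀ x → x ≉ 0# → x ⁻¹ * x ≈ 1#
  ⁻¹-inverseˡ x x≉0 = trans (*-comm _ _) (⁻¹-inverseʳ x x≉0)

  >⇒≉ : 0# < x → x ≉ 0#
  >⇒≉ 0<x x≈0 = proj₂ 0<x (sym x≈0)

  *-pos : 0# < x → 0# < y → 0# < x * y
  *-pos {x} {y} 0<x 0<y = *-nonNeg (<⇒≤ 0<x) (<⇒≤ 0<y) , λ 0≈xy → proj₂ 0<x (begin
    0#               ≈⟨ zeroˡ _ ⟨
    0# * y ⁻¹        ≈⟨ *-congʳ 0≈xy ⟩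
    x * y * y ⁻¹     ≈⟨ *-assoc _ _ _ ⟩
    x * (y * y ⁻¹)   ≈⟨ *-congˡ (⁻¹-inverseʳ y (>⇒≉ 0<y)) ⟩
    x * 1#           ≈⟨ *-identityʳ x ⟩
    x                ∎)
    where open import Relation.Binary.Reasoning.Setoid setoid

  ⁻¹-nonNeg : 0# < x → 0# ≤ x ⁻¹
  ⁻¹-nonNeg {x} 0<x with ≤-total 0# (x ⁻¹)
  ... | inj₁ 0≤x⁻¹ = 0≤x⁻¹
  ... | inj₂ x⁻¹≤0 = contradiction (≤-trans (≤-reflexive (sym (⁻¹-inverseʳ x (>⇒≉ 0<x))))
      (≤-trans (*-monoʳ-≤ x (<⇒≤ 0<x) x⁻¹≤0) (≤-reflexive (zeroʳ x)))) (<⇒≱ 0<1)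

  ⁻¹-pos : 0# < x → 0# < x ⁻¹
  ⁻¹-pos {x} 0<x = ⁻¹-nonNeg 0<x , λ 0≈x⁻¹ → 1≉0
    (trans (sym (⁻¹-inverseʳ x (>⇒≉ 0<x))) (trans (*-congˡ (sym 0≈x⁻¹)) (zeroʳ x)))

  *⁻¹-cancelʳ : 0# < z → x * z * z ⁻¹ ≈ x
  *⁻¹-cancelʳ {z} {x} 0<z = trans (*-assoc _ _ _) (trans (*-congˡ (⁻¹-inverseʳ z (>⇒≉ 0<z))) (*-identityʳ x))

  ⁻¹*-cancelʳ : 0# < z → x * z ⁻¹ * z ≈ x
  ⁻¹*-cancelʳ {z} {x} 0<z = trans (*-assoc _ _ _) (trans (*-congˡ (⁻¹-inverseˡ z (>⇒≉ 0<z))) (*-identityʳ x))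

  *≤⇒≤/ : 0# < z → x * z ≤ y → x ≤ y / z
  *≤⇒≤/ {z} 0<z xz≤y = ≤-trans (≤-reflexive (sym (*⁻¹-cancelʳ 0<z))) (*-monoˡ-≤ (z ⁻¹) (⁻¹-nonNeg 0<z) xz≤y)

  ≤/⇒*≤ : 0# < z → x ≤ y / z → x * z ≤ y
  ≤/⇒*≤ {z} 0<z x≤y/z = ≤-trans (*-monoˡ-≤ z (<⇒≤ 0<z) x≤y/z) (≤-reflexive (⁻¹*-cancelʳ 0<z))

  ≤*⇒/≤ : 0# < z → x ≤ y * z → x / z ≤ y
  ≤*⇒/≤ {z} 0<z x≤yz = ≤-trans (*-monoˡ-≤ (z ⁻¹) (⁻¹-nonNeg 0<z) x≤yz) (≤-reflexive (*⁻¹-cancelʳ 0<z))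

  /≤⇒≤* : 0# < z → x / z ≤ y → x ≤ y * z
  /≤⇒≤* {z} 0<z x/z≤y = ≤-trans (≤-reflexive (sym (⁻¹*-cancelʳ 0<z))) (*-monoˡ-≤ z (<⇒≤ 0<z) x/z≤y)

  *-cancelʳ-≤ : 0# < z → x * z ≤ y * z → x ≤ y
  *-cancelʳ-≤ 0<z xz≤yz = ≤-trans (*≤⇒≤/ 0<z xz≤yz) (≤-reflexive (*⁻¹-cancelʳ 0<z))

  ⁻¹-anti-≤ : 0# < x → x ≤ y → y ⁻¹ ≤ x ⁻¹
  ⁻¹-anti-≤ {x} {y} 0<x x≤y = ≤-trans (*≤⇒≤/ 0<x (begin
    y ⁻¹ * x  ≤⟨ *-monoʳ-≤ _ (⁻¹-nonNeg 0<y) x≤y ⟩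
    y ⁻¹ * y  ≈⟨ ⁻¹-inverseˡ y (>⇒≉ 0<y) ⟩
    1#        ∎)) (≤-reflexive (*-identityˡ _))
    where
    open ≤-Reasoning
    0<y = <-≤-trans 0<x x≤y

  ⁻¹-≤1 : 1# ≤ x → x ⁻¹ ≤ 1#
  ⁻¹-≤1 1≤x = ≤-trans (≤-reflexive (sym (*-identityˡ _)))
    (≤*⇒/≤ (1≤⇒0< 1≤x) (≤-trans 1≤x (≤-reflexive (sym (*-identityˡ _)))))

  fromℕ-* : ∀ m n → fromℕ (m ℕ.* n) ≈ fromℕ m * fromℕ n
  fromℕ-* = ×1-homo-*

  fromℕ-^ : ∀ m n → fromℕ (m ℕ.^ n) ≈ fromℕ m ^ n
  fromℕ-^ m zero    = +-identityʳ 1#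
  fromℕ-^ m (suc n) = trans (fromℕ-* m (m ℕ.^ n)) (*-congˡ (fromℕ-^ m n))

  fromℕ-nonNeg : ∀ n → 0# ≤ fromℕ n
  fromℕ-nonNeg zero    = ≤-refl
  fromℕ-nonNeg (suc n) = +-nonNeg 0≤1 (fromℕ-nonNeg n)

  fromℕ-mono : ∀ {m n} → m ℕ.≤ n → fromℕ m ≤ fromℕ n
  fromℕ-mono {n = n} ℕ.z≤n = fromℕ-nonNeg n
  fromℕ-mono (ℕ.s≤s m≤n) = +-mono-≤ ≤-refl (fromℕ-mono m≤n)

  1≤fromℕ : ∀ n .{{_ : NonZero n}} → 1# ≤ fromℕ n
  1≤fromℕ (suc n) = x≤x+y (fromℕ-nonNeg n)

  fromℕ-pos : ∀ n .{{_ : NonZero n}} → 0# < fromℕ n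
  fromℕ-pos n = 1≤⇒0< (1≤fromℕ n)

  fromℕ-<suc : ∀ n → fromℕ n < fromℕ (suc n)
  fromℕ-<suc n = fromℕ-mono (ℕ.n≤1+n n) , λ eq → 1≉0
    (trans (solve 2 (λ o n → o := o :+ n :- n) refl 1# (fromℕ n)) (trans (+-congʳ (sym eq)) (-‿inverseʳ _)))

  fromℕ-cancel-≤ : ∀ {m n} → fromℕ m ≤ fromℕ n → m ℕ.≤ n
  fromℕ-cancel-≤ {m} {n} p with m ℕ.≤? n
  ... | yes m≤n = m≤n
  ... | no m≰n = contradiction (≤-trans (fromℕ-mono (ℕ.≰⇒> m≰n)) p) (<⇒≱ (fromℕ-<suc n))

  ^-nonNeg : ∀ n → 0# ≤ x → 0# ≤ x ^ n
  ^-nonNeg zero    0≤x = 0≤1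
  ^-nonNeg (suc n) 0≤x = *-nonNeg 0≤x (^-nonNeg n 0≤x)

  ^-pos : ∀ n → 0# < x → 0# < x ^ n
  ^-pos zero    0<x = 0<1
  ^-pos (suc n) 0<x = *-pos 0<x (^-pos n 0<x)

  ^-monoˡ-≤ : ∀ n → 0# ≤ x → x ≤ y → x ^ n ≤ y ^ n
  ^-monoˡ-≤ zero    0≤x x≤y = ≤-refl
  ^-monoˡ-≤ (suc n) 0≤x x≤y = *-mono-≤ 0≤x (^-nonNeg n 0≤x) x≤y (^-monoˡ-≤ n 0≤x x≤y)

  1^n≈1 : ∀ n → 1# ^ n ≈ 1#
  1^n≈1 zero    = refl
  1^n≈1 (suc n) = trans (*-identityˡ _) (1^n≈1 n)

  1≤x^n : ∀ n → 1# ≤ x → 1# ≤ x ^ n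
  1≤x^n n 1≤x = ≤-trans (≤-reflexive (sym (1^n≈1 n))) (^-monoˡ-≤ n 0≤1 1≤x)

  ^-cancelˡ-≤ : ∀ n .{{_ : NonZero n}} → 0# ≤ x → 0# ≤ y → x ^ n ≤ y ^ n → x ≤ y
  ^-cancelˡ-≤ {x} {y} (suc n) 0≤x 0≤y xⁿ≤yⁿ = ≤-stable λ x≰y →
    let 0<x = ≤-trans 0≤y (≰⇒≥ x≰y) , λ 0≈x → x≰y (≤-trans (≤-reflexive (sym 0≈x)) 0≤y)
    in x≰y (*-cancelʳ-≤ (^-pos n 0<x) (begin
      x * x ^ n  ≤⟨ xⁿ≤yⁿ ⟩
      y * y ^ n  ≤⟨ *-monoʳ-≤ y 0≤y (^-monoˡ-≤ n 0≤y (≰⇒≥ x≰y)) ⟩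
      y * x ^ n  ∎))
    where open ≤-Reasoning

  bernoulli : ∀ n → 0# ≤ x → 1# + fromℕ n * x ≤ (1# + x) ^ n
  bernoulli {x} zero    0≤x = ≤-reflexive (trans (+-congˡ (zeroˡ x)) (+-identityʳ 1#))
  bernoulli {x} (suc n) 0≤x = begin
    1# + (1# + fromℕ n) * x                ≤⟨ ≤-by (*-nonNeg (fromℕ-nonNeg n) (x²-nonNeg x))
      (solve 2 (λ x n → con (+ 1) :+ (con (+ 1) :+ n) :* x :+ n :* (x :* x) := (con (+ 1) :+ x) :* (con (+ 1) :+ n :* x)) refl x (fromℕ n)) ⟩
    (1# + x) * (1# + fromℕ n * x)          ≤⟨ *-monoʳ-≤ _ (+-nonNeg 0≤1 0≤x) (bernoulli n 0≤x) ⟩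
    (1# + x) * (1# + x) ^ n                ∎
    where open ≤-Reasoning

  IsSupremum-stable : ∀ {P s} → ¬ ¬ IsSupremum P s → IsSupremum P s
  IsSupremum-stable nn =
    (λ y Py → ≤-stable λ y≰s → nn λ sup → y≰s (proj₁ sup y Py)) ,
    (λ b ub → ≤-stable λ s≰b → nn λ sup → s≰b (proj₂ sup b ub))

  -- Since `⋁` is total, the value is already given and only its property remains to be proved; that
  -- property consists of inequalities and is therefore stable.
  ⋁-isSupremum-¬¬ : ∀ {P} → ¬ ¬ ∃ P → ¬ ¬ ∃ (IsUpperBound P) → IsSupremum P (⋁ P)
  ⋁-isSupremum-¬¬ inhabited bounded = IsSupremum-stable λ ¬sup →
    inhabited λ p → bounded λ b → ¬sup (⋁-isSupremum _ p b)

  -- If no natural number reached `x`, then `x` would bound them all and their supremum `s` would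
  -- exist; but `n + 1 ≤ s` for all `n` makes `s - 1#` an upper bound too.
  archimedean : ∀ x → ¬ ¬ ∃ λ n → x ≤ fromℕ n
  archimedean x unbounded = <⇒≱ 0<1 (begin
    1#               ≈⟨ solve 2 (λ o s → o := s :- (s :- o)) refl 1# s ⟩
    s - (s - 1#)     ≤⟨ +-monoˡ-≤ _ (least (s - 1#) s-1-bound) ⟩
    s - 1# - (s - 1#) ≈⟨ -‿inverseʳ _ ⟩
    0#               ∎)
    where
    open ≤-Reasoning
    P = λ y → ∃ λ n → y ≈ fromℕ n
    s = ⋁ P
    x-bound : IsUpperBound P x
    x-bound y (n , y≈n) = ≤-trans (≤-reflexive y≈n) (≰⇒≥ λ x≤n → unbounded (n , x≤n))
    sup = ⋁-isSupremum P (0# , 0 , refl) (x , x-bound)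
    least = proj₂ sup
    s-1-bound : IsUpperBound P (s - 1#)
    s-1-bound y (n , y≈n) = begin
      y                    ≈⟨ y≈n ⟩
      fromℕ n              ≈⟨ solve 2 (λ o n → n := o :+ n :- o) refl 1# (fromℕ n) ⟩
      fromℕ (suc n) - 1#   ≤⟨ +-monoˡ-≤ _ (proj₁ sup _ (suc n , refl)) ⟩
      s - 1#               ∎

-- Roots, rational powers and real powers of bases at least 1.

module RealPowers {ℓ} (R : CompleteOrderedField ℓ) where
  open Reals R
  open OrderedFieldProperties R
  open IntegerSolver commutativeRing

  private
    variable
      a b x y z : ℝ

    -- Chooses the perturbation used in `root`: at most 1 for the local Lipschitz bound, at most `m`
    -- to keep `s - ε` nonnegative, and with error `ε * K` inside the gap `δ`. The division is by
    -- `K + 1#` because `K` may vanish.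
    small : ∀ {δ m K} → 0# < δ → 0# < m → 0# ≤ K →
            ∃ λ ε → 0# < ε × ε ≤ 1# × ε ≤ m × ε * K ≤ δ
    small {δ} {m} {K} 0<δ 0<m 0≤K = ε , 0<ε , ε≤1 , ε≤m , (begin
      ε * K               ≤⟨ *-monoʳ-≤ ε (<⇒≤ 0<ε) (≤-by 0≤1 refl) ⟩
      ε * (K + 1#)        ≤⟨ *-monoˡ-≤ _ (<⇒≤ 0<K+1) ε≤δ/[K+1] ⟩
      δ / (K + 1#) * (K + 1#) ≈⟨ ⁻¹*-cancelʳ 0<K+1 ⟩
      δ                   ∎)
      where
      open ≤-Reasoning
      min : 0# < x → 0# < y → ∃ λ z → 0# < z × z ≤ x × z ≤ y
      min {x} {y} 0<x 0<y with ≤-total x y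
      ... | inj₁ x≤y = x , 0<x , ≤-refl , x≤y
      ... | inj₂ y≤x = y , 0<y , y≤x , ≤-refl
      0<K+1 = <-≤-trans 0<1 (≤-by 0≤K (+-comm 1# K))
      min₁ = min 0<1 0<m
      min₂ = min (proj₁ (proj₂ min₁)) (*-pos 0<δ (⁻¹-pos 0<K+1))
      ε = proj₁ min₂
      0<ε = proj₁ (proj₂ min₂)
      ε≤min₁ = proj₁ (proj₂ (proj₂ min₂))
      ε≤1 = ≤-trans ε≤min₁ (proj₁ (proj₂ (proj₂ min₁)))
      ε≤m = ≤-trans ε≤min₁ (proj₂ (proj₂ (proj₂ min₁)))
      ε≤δ/[K+1] = proj₂ (proj₂ (proj₂ min₂))

    -- The constant follows the product rule, with `y` and `y + ε` bounded by `s` and `s + 1#`. It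
    -- is uniform in `y` because `root` uses it both at `s` and at `s - ε`, where `ε` is chosen
    -- after `K`.
    ^-locallyLipschitz : ∀ n s → 0# ≤ s → ∃ λ K → 0# ≤ K ×
      (∀ y ε → 0# ≤ y → y ≤ s → 0# ≤ ε → ε ≤ 1# → (y + ε) ^ n ≤ y ^ n + ε * K)
    ^-locallyLipschitz zero    s 0≤s = 0# , ≤-refl , λ y ε _ _ _ _ →
      ≤-reflexive (sym (trans (+-congˡ (zeroʳ ε)) (+-identityʳ 1#)))
    ^-locallyLipschitz (suc n) s 0≤s = s ^ n + (s + 1#) * K , 0≤K′ , λ y ε 0≤y y≤s 0≤ε ε≤1 → begin
      (y + ε) * (y + ε) ^ n                       ≤⟨ *-monoʳ-≤ _ (+-nonNeg 0≤y 0≤ε) (lipschitz y ε 0≤y y≤s 0≤ε ε≤1) ⟩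
      (y + ε) * (y ^ n + ε * K)                   ≈⟨ solve 4 (λ y ε p K → (y :+ ε) :* (p :+ ε :* K) := y :* p :+ ε :* (p :+ (y :+ ε) :* K)) refl y ε (y ^ n) K ⟩
      y * y ^ n + ε * (y ^ n + (y + ε) * K)       ≤⟨ +-mono-≤ ≤-refl (*-monoʳ-≤ ε 0≤ε (+-mono-≤ (^-monoˡ-≤ n 0≤y y≤s) (*-monoˡ-≤ K 0≤K (+-mono-≤ y≤s ε≤1)))) ⟩
      y * y ^ n + ε * (s ^ n + (s + 1#) * K)      ∎
      where
      open ≤-Reasoning
      K = proj₁ (^-locallyLipschitz n s 0≤s)
      0≤K = proj₁ (proj₂ (^-locallyLipschitz n s 0≤s))
      lipschitz = proj₂ (proj₂ (^-locallyLipschitz n s 0≤s))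
      0≤K′ = +-nonNeg (^-nonNeg n 0≤s) (*-nonNeg (+-nonNeg 0≤s 0≤1) 0≤K)

  -- The root is the supremum `s` of all `y ≥ 0` with `y ^ n ≤ t`. If `s ^ n` exceeded `t`, some
  -- `s - ε` would be a smaller upper bound; if it fell short, some `s + ε` would still belong to
  -- the set.
  root : ∀ n .{{_ : NonZero n}} t → 0# ≤ t → ∃ λ s → 0# ≤ s × s ^ n ≈ t
  root n@(suc n-1) t 0≤t = s , 0≤s , ≤-antisym (≤-stable s^n≰t-absurd) (≤-stable t≰s^n-absurd)
    where
    open ≤-Reasoning
    P = λ y → 0# ≤ y × y ^ n ≤ t
    s = ⋁ P
    P-0 : P 0#
    P-0 = ≤-refl , ≤-trans (≤-reflexive (zeroˡ _)) 0≤t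
    P-bound : IsUpperBound P (1# + t)
    P-bound y (0≤y , yⁿ≤t) = ^-cancelˡ-≤ n 0≤y (+-nonNeg 0≤1 0≤t) (begin
      y ^ n                       ≤⟨ yⁿ≤t ⟩
      t                           ≤⟨ ≤-by 0≤1 (+-comm _ _) ⟩
      1# + t                      ≈⟨ *-identityʳ _ ⟨
      (1# + t) * 1#               ≤⟨ *-monoʳ-≤ _ (+-nonNeg 0≤1 0≤t) (1≤x^n n-1 (x≤x+y 0≤t)) ⟩
      (1# + t) ^ n                ∎)
    sup = ⋁-isSupremum P (0# , P-0) (1# + t , P-bound)
    upper = proj₁ sup
    least = proj₂ sup
    0≤s = upper 0# P-0
    K = proj₁ (^-locallyLipschitz n s 0≤s)
    0≤K = proj₁ (proj₂ (^-locallyLipschitz n s 0≤s))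
    lipschitz = proj₂ (proj₂ (^-locallyLipschitz n s 0≤s))

    gap : x < y → 0# < y - x
    gap {x} {y} (x≤y , x≉y) = x≤y⇒0≤y-x x≤y , λ eq → x≉y
      (trans (sym (+-identityʳ x)) (trans (+-congˡ eq) (solve 2 (λ x y → x :+ (y :- x) := y) refl x y)))

    s^n≰t-absurd : ¬ ¬ (s ^ n ≤ t)
    s^n≰t-absurd s^n≰t = <⇒≱ 0<ε (begin
      ε               ≈⟨ solve 2 (λ s ε → ε := s :- (s :- ε)) refl s ε ⟩
      s - (s - ε)     ≤⟨ +-monoˡ-≤ _ (least (s - ε) s-ε-bound) ⟩
      s - ε - (s - ε) ≈⟨ -‿inverseʳ _ ⟩
      0#              ∎)
      where
      0<s : 0# < s
      0<s = 0≤s , λ 0≈s → s^n≰t (begin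
        s ^ n            ≈⟨ *-congʳ (sym 0≈s) ⟩
        0# * s ^ n-1     ≈⟨ zeroˡ _ ⟩
        0#               ≤⟨ 0≤t ⟩
        t                ∎)
      tiny = small (gap (≰⇒> s^n≰t)) 0<s 0≤K
      ε = proj₁ tiny
      0<ε = proj₁ (proj₂ tiny)
      ε≤1 = proj₁ (proj₂ (proj₂ tiny))
      ε≤s = proj₁ (proj₂ (proj₂ (proj₂ tiny)))
      εK≤δ = proj₂ (proj₂ (proj₂ (proj₂ tiny)))
      t≤[s-ε]^n : t ≤ (s - ε) ^ n
      t≤[s-ε]^n = begin
        t                                          ≈⟨ solve 2 (λ t p → t := p :- (p :- t)) refl t (s ^ n) ⟩
        s ^ n - (s ^ n - t)                        ≈⟨ +-congʳ (^-congˡ n (solve 2 (λ s ε → s := s :- ε :+ ε) refl s ε)) ⟩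
        (s - ε + ε) ^ n - (s ^ n - t)              ≤⟨ +-monoˡ-≤ _ (lipschitz (s - ε) ε (x≤y⇒0≤y-x ε≤s) (≤-by (<⇒≤ 0<ε) (solve 2 (λ s ε → s :- ε :+ ε := s) refl s ε)) (<⇒≤ 0<ε) ε≤1) ⟩
        (s - ε) ^ n + ε * K - (s ^ n - t)          ≤⟨ +-monoˡ-≤ _ (+-mono-≤ ≤-refl εK≤δ) ⟩
        (s - ε) ^ n + (s ^ n - t) - (s ^ n - t)    ≈⟨ solve 2 (λ p q → p :+ q :- q := p) refl ((s - ε) ^ n) (s ^ n - t) ⟩
        (s - ε) ^ n                                ∎
      s-ε-bound : IsUpperBound P (s - ε)
      s-ε-bound y (0≤y , yⁿ≤t) = ^-cancelˡ-≤ n 0≤y (x≤y⇒0≤y-x ε≤s) (≤-trans yⁿ≤t t≤[s-ε]^n)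

    t≰s^n-absurd : ¬ ¬ (t ≤ s ^ n)
    t≰s^n-absurd t≰s^n = <⇒≱ 0<ε (begin
      ε               ≈⟨ solve 2 (λ s ε → ε := s :+ ε :- s) refl s ε ⟩
      s + ε - s       ≤⟨ +-monoˡ-≤ _ (upper (s + ε) (+-nonNeg 0≤s (<⇒≤ 0<ε) , [s+ε]^n≤t)) ⟩
      s - s           ≈⟨ -‿inverseʳ _ ⟩
      0#              ∎)
      where
      tiny = small (gap (≰⇒> t≰s^n)) 0<1 0≤K
      ε = proj₁ tiny
      0<ε = proj₁ (proj₂ tiny)
      ε≤1 = proj₁ (proj₂ (proj₂ tiny))
      εK≤δ = proj₂ (proj₂ (proj₂ (proj₂ tiny)))
      [s+ε]^n≤t : (s + ε) ^ n ≤ t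
      [s+ε]^n≤t = begin
        (s + ε) ^ n            ≤⟨ lipschitz s ε 0≤s ≤-refl (<⇒≤ 0<ε) ε≤1 ⟩
        s ^ n + ε * K          ≤⟨ +-mono-≤ ≤-refl εK≤δ ⟩
        s ^ n + (t - s ^ n)    ≈⟨ solve 2 (λ t p → p :+ (t :- p) := t) refl t (s ^ n) ⟩
        t                      ∎

  ⁻¹-unique : 0# < x → x * y ≈ 1# → y ≈ x ⁻¹
  ⁻¹-unique {x} {y} 0<x xy≈1 = begin
    y              ≈⟨ *⁻¹-cancelʳ 0<x ⟨
    y * x * x ⁻¹   ≈⟨ *-congʳ (trans (*-comm y x) xy≈1) ⟩
    1# * x ⁻¹      ≈⟨ *-identityˡ _ ⟩
    x ⁻¹           ∎
    where open import Relation.Binary.Reasoning.Setoid setoid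

  ⁻¹-distrib-* : 0# < x → 0# < y → (x * y) ⁻¹ ≈ x ⁻¹ * y ⁻¹
  ⁻¹-distrib-* {x} {y} 0<x 0<y = sym (⁻¹-unique (*-pos 0<x 0<y) (begin
    x * y * (x ⁻¹ * y ⁻¹)      ≈⟨ solve 4 (λ x y z w → x :* y :* (z :* w) := x :* z :* (y :* w)) refl x y (x ⁻¹) (y ⁻¹) ⟩
    x * x ⁻¹ * (y * y ⁻¹)      ≈⟨ *-cong (⁻¹-inverseʳ x (>⇒≉ 0<x)) (⁻¹-inverseʳ y (>⇒≉ 0<y)) ⟩
    1# * 1#                    ≈⟨ *-identityˡ 1# ⟩
    1#                         ∎))
    where open import Relation.Binary.Reasoning.Setoid setoid

  ⁻¹-distrib-^ : ∀ n → 0# < x → (x ^ n) ⁻¹ ≈ (x ⁻¹) ^ n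
  ⁻¹-distrib-^ {x} n 0<x = sym (⁻¹-unique (^-pos n 0<x) (begin
    x ^ n * (x ⁻¹) ^ n   ≈⟨ ^-distrib-* x (x ⁻¹) n ⟨
    (x * x ⁻¹) ^ n       ≈⟨ ^-congˡ n (⁻¹-inverseʳ x (>⇒≉ 0<x)) ⟩
    1# ^ n               ≈⟨ 1^n≈1 n ⟩
    1#                   ∎))
    where open import Relation.Binary.Reasoning.Setoid setoid

  ^ᶻ-pos : ∀ i → 0# < a → 0# < a ^ᶻ i
  ^ᶻ-pos (+ n)    0<a = ^-pos n 0<a
  ^ᶻ-pos -[1+ n ] 0<a = ^-pos (suc n) (⁻¹-pos 0<a)

  ^ᶻ-distrib-* : ∀ i → 0# < a → 0# < b → (a * b) ^ᶻ i ≈ a ^ᶻ i * b ^ᶻ i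
  ^ᶻ-distrib-* {a} {b} (+ n)    0<a 0<b = ^-distrib-* a b n
  ^ᶻ-distrib-* {a} {b} -[1+ n ] 0<a 0<b =
    trans (^-congˡ (suc n) (⁻¹-distrib-* 0<a 0<b)) (^-distrib-* (a ⁻¹) (b ⁻¹) (suc n))

  ^ᶻ-assocʳ : ∀ a i n .{{_ : NonZero n}} → (a ^ᶻ i) ^ n ≈ a ^ᶻ (i ℤ.* + n)
  ^ᶻ-assocʳ a (+ m)    n       = trans (^-assocʳ a m n) (reflexive (≡.cong (a ^ᶻ_) (ℤ.pos-* m n)))
  ^ᶻ-assocʳ a -[1+ m ] (suc n) = ^-assocʳ (a ⁻¹) (suc m) (suc n)

  ^ᶻ-^-comm : ∀ i n → 0# < a → (a ^ n) ^ᶻ i ≈ (a ^ᶻ i) ^ n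
  ^ᶻ-^-comm {a} i n 0<a = go i
    where
    ^-^-comm : ∀ a m → (a ^ n) ^ m ≈ (a ^ m) ^ n
    ^-^-comm a m = trans (^-assocʳ a n m) (trans (^-congʳ a (ℕ.*-comm n m)) (sym (^-assocʳ a m n)))
    go : ∀ i → (a ^ n) ^ᶻ i ≈ (a ^ᶻ i) ^ n
    go (+ m)    = ^-^-comm a m
    go -[1+ m ] = trans (^-congˡ (suc m) (⁻¹-distrib-^ n 0<a)) (^-^-comm (a ⁻¹) (suc m))

  ^-monoʳ-≤ : ∀ {m n} → 1# ≤ a → m ℕ.≤ n → a ^ m ≤ a ^ n
  ^-monoʳ-≤ {n = n} 1≤a ℕ.z≤n       = 1≤x^n n 1≤a
  ^-monoʳ-≤         1≤a (ℕ.s≤s m≤n) = *-monoʳ-≤ _ (≤-trans 0≤1 1≤a) (^-monoʳ-≤ 1≤a m≤n)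

  x^n≤1 : ∀ n → 0# ≤ x → x ≤ 1# → x ^ n ≤ 1#
  x^n≤1 n 0≤x x≤1 = ≤-trans (^-monoˡ-≤ n 0≤x x≤1) (≤-reflexive (1^n≈1 n))

  ^ᶻ-monoʳ-≤ : ∀ {i j} → 1# ≤ a → i ℤ.≤ j → a ^ᶻ i ≤ a ^ᶻ j
  ^ᶻ-monoʳ-≤ 1≤a (ℤ.+≤+ m≤n) = ^-monoʳ-≤ 1≤a m≤n
  ^ᶻ-monoʳ-≤ {i = -[1+ m ]} {j = + n} 1≤a ℤ.-≤+ =
    ≤-trans (x^n≤1 (suc m) (⁻¹-nonNeg (1≤⇒0< 1≤a)) (⁻¹-≤1 1≤a)) (1≤x^n n 1≤a)
  ^ᶻ-monoʳ-≤ {a} {i = -[1+ m ]} {j = -[1+ n ]} 1≤a (ℤ.-≤- n≤m) = begin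
    (a ⁻¹) ^ suc m   ≈⟨ ⁻¹-distrib-^ (suc m) 0<a ⟨
    (a ^ suc m) ⁻¹   ≤⟨ ⁻¹-anti-≤ (^-pos (suc n) 0<a) (^-monoʳ-≤ 1≤a (ℕ.s≤s n≤m)) ⟩
    (a ^ suc n) ⁻¹   ≈⟨ ⁻¹-distrib-^ (suc n) 0<a ⟩
    (a ⁻¹) ^ suc n   ∎
    where
    open ≤-Reasoning
    0<a = 1≤⇒0< 1≤a

  rationalPower : ∀ q → 0# < a → ∃ (IsRationalPower a q)
  rationalPower {a} q 0<a = root (↧ₙ q) (a ^ᶻ (↥ q)) (<⇒≤ (^ᶻ-pos (↥ q) 0<a))

  -- Raising both sides to the product of the denominators leaves a comparison of integer powers of
  -- `a`, whose exponents are those of the cross-multiplied inequality `p ≤ q`.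
  rationalPower-monoʳ-≤ : ∀ {p q} → 1# ≤ a → p ℚᵘ.≤ q → IsRationalPower a p x → IsRationalPower a q y → x ≤ y
  rationalPower-monoʳ-≤ {a} {x} {y} {p} {q} 1≤a (*≤* p≤q) (0≤x , xᵐ≈) (0≤y , yⁿ≈) =
    ^-cancelˡ-≤ (m ℕ.* n) {{ℕ.m*n≢0 m n}} 0≤x 0≤y (begin
      x ^ (m ℕ.* n)         ≈⟨ ^-assocʳ x m n ⟨
      (x ^ m) ^ n           ≈⟨ ^-congˡ n xᵐ≈ ⟩
      (a ^ᶻ ↥ p) ^ n        ≈⟨ ^ᶻ-assocʳ a (↥ p) n ⟩
      a ^ᶻ (↥ p ℤ.* ↧ q)    ≤⟨ ^ᶻ-monoʳ-≤ 1≤a p≤q ⟩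
      a ^ᶻ (↥ q ℤ.* ↧ p)    ≈⟨ ^ᶻ-assocʳ a (↥ q) m ⟨
      (a ^ᶻ ↥ q) ^ m        ≈⟨ ^-congˡ m yⁿ≈ ⟨
      (y ^ n) ^ m           ≈⟨ ^-assocʳ y n m ⟩
      y ^ (n ℕ.* m)         ≈⟨ ^-congʳ y (ℕ.*-comm n m) ⟩
      y ^ (m ℕ.* n)         ∎)
    where
    open ≤-Reasoning
    m = ↧ₙ p
    n = ↧ₙ q

  rationalPower-* : ∀ q → 0# < a → 0# < b → IsRationalPower a q x → IsRationalPower b q y → IsRationalPower (a * b) q (x * y)
  rationalPower-* {x = x} {y = y} q 0<a 0<b (0≤x , xⁿ≈) (0≤y , yⁿ≈) = *-nonNeg 0≤x 0≤y ,
    trans (^-distrib-* x y (↧ₙ q)) (trans (*-cong xⁿ≈ yⁿ≈) (sym (^ᶻ-distrib-* (↥ q) 0<a 0<b)))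

  rationalBelow : ∀ x → ¬ ¬ ∃ λ q → fromℚᵘ q ≤ x
  rationalBelow x none = archimedean (- x) λ (n , -x≤n) →
    none (mkℚᵘ -[1+ n ] 0 , ≤*⇒/≤ (fromℕ-pos 1) (begin
      - fromℕ (suc n)   ≤⟨ neg-mono-≤ (fromℕ-mono (ℕ.n≤1+n n)) ⟩
      - fromℕ n         ≤⟨ neg-mono-≤ -x≤n ⟩
      - - x             ≈⟨ -‿involutive x ⟩
      x                 ≈⟨ trans (*-congˡ (+-identityʳ 1#)) (*-identityʳ x) ⟨
      x * fromℕ 1       ∎))
    where open ≤-Reasoning

  -- A rational exponent below `x`, and a natural number above it that makes `a ^ n` an upper bound,
  -- both come from the Archimedean property and so only under a double negation.
  ^ʳ-isSupremum : ∀ x → 1# ≤ a → IsSupremum (λ y → ∃ λ q → fromℚᵘ q ≤ x × IsRationalPower a q y) (a ^ʳ x)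
  ^ʳ-isSupremum {a} x 1≤a = ⋁-isSupremum-¬¬
    (λ empty → rationalBelow x λ (q , q≤x) →
      let y , y-power = rationalPower q (1≤⇒0< 1≤a) in empty (y , q , q≤x , y-power))
    (λ unbounded → archimedean x λ (n , x≤n) → unbounded (a ^ n , λ y (q , q≤x , y-power) →
      rationalPower-monoʳ-≤ {p = q} {q = mkℚᵘ (+ n) 0} 1≤a (*≤* (cross n (↥ q) (↧ₙ q) (≤-trans (/≤⇒≤* (fromℕ-pos (↧ₙ q)) q≤x)
        (≤-trans (*-monoˡ-≤ _ (fromℕ-nonNeg (↧ₙ q)) x≤n) (≤-reflexive (sym (fromℕ-* n (↧ₙ q))))))))
        y-power (^-nonNeg n (<⇒≤ (1≤⇒0< 1≤a)) , *-identityʳ _)))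
    where
    cross : ∀ n i d → fromℤ i ≤ fromℕ (n ℕ.* d) → i ℤ.* + 1 ℤ.≤ + n ℤ.* + d
    cross n i d i≤nd rewrite ℤ.*-identityʳ i | ≡.sym (ℤ.pos-* n d) = cancel i i≤nd
      where
      cancel : ∀ i {m} → fromℤ i ≤ fromℕ m → i ℤ.≤ + m
      cancel (+ k)    k≤m = ℤ.+≤+ (fromℕ-cancel-≤ k≤m)
      cancel -[1+ k ] _   = ℤ.-≤+

  rationalPower-pos : ∀ q → 0# < a → IsRationalPower a q y → 0# < y
  rationalPower-pos q 0<a (0≤y , yⁿ≈) = 0≤y , λ 0≈y → proj₂ (^ᶻ-pos (↥ q) 0<a)
    (trans (sym (zeroˡ _)) (trans (*-congʳ 0≈y) yⁿ≈))

  rationalPower≤^ʳ : ∀ {q} → 1# ≤ a → fromℚᵘ q ≤ x → IsRationalPower a q y → y ≤ a ^ʳ x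
  rationalPower≤^ʳ {x = x} {q = q} 1≤a q≤x y-power = proj₁ (^ʳ-isSupremum x 1≤a) _ (q , q≤x , y-power)

  ^ʳ-least : 1# ≤ a → (∀ y q → fromℚᵘ q ≤ x → IsRationalPower a q y → y ≤ b) → a ^ʳ x ≤ b
  ^ʳ-least {x = x} 1≤a bound = proj₂ (^ʳ-isSupremum x 1≤a) _ λ y (q , q≤x , y-power) → bound y q q≤x y-power

  ^ʳ-monoʳ-≤ : 1# ≤ a → x ≤ y → a ^ʳ x ≤ a ^ʳ y
  ^ʳ-monoʳ-≤ 1≤a x≤y = ^ʳ-least 1≤a λ _ q q≤x → rationalPower≤^ʳ {q = q} 1≤a (≤-trans q≤x x≤y)

  1≤^ʳ : 1# ≤ a → 0# ≤ x → 1# ≤ a ^ʳ x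
  1≤^ʳ 1≤a 0≤x = rationalPower≤^ʳ {q = mkℚᵘ (+ 0) 0} 1≤a (≤-trans (≤-reflexive (zeroˡ _)) 0≤x) (0≤1 , *-identityʳ 1#)

  ^ʳ-monoˡ-≤ : 1# ≤ a → a ≤ b → 0# ≤ x → a ^ʳ x ≤ b ^ʳ x
  ^ʳ-monoˡ-≤ {a} {b} {x} 1≤a a≤b 0≤x = ^ʳ-least 1≤a below
    where
    1≤b = ≤-trans 1≤a a≤b
    below : ∀ y q → fromℚᵘ q ≤ x → IsRationalPower a q y → y ≤ b ^ʳ x
    -- A negative exponent reverses the comparison of the bases, but then the power is at most 1,
    -- and `1# ≤ b ^ʳ x` because `x` is nonnegative.
    below y (mkℚᵘ -[1+ k ] d) q≤x y-power = ≤-trans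
      (rationalPower-monoʳ-≤ {p = mkℚᵘ -[1+ k ] d} {q = mkℚᵘ (+ 0) 0} 1≤a (*≤* ℤ.-≤+) y-power (0≤1 , *-identityʳ 1#))
      (1≤^ʳ 1≤b 0≤x)
    below y q@(mkℚᵘ (+ k) d) q≤x (0≤y , yⁿ≈) =
      let z , 0≤z , zⁿ≈ = rationalPower q (1≤⇒0< 1≤b)
      in ≤-trans
        (^-cancelˡ-≤ (suc d) 0≤y 0≤z (≤-trans (≤-reflexive yⁿ≈) (≤-trans (^-monoˡ-≤ k (≤-trans 0≤1 1≤a) a≤b) (≤-reflexive (sym zⁿ≈)))))
        (rationalPower≤^ʳ {q = q} 1≤b q≤x (0≤z , zⁿ≈))

  -- Some rational power lies below and is positive. Its existence is known only under a double
  -- negation, which is enough because both halves of `<` are stable.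
  ^ʳ-pos : ∀ x → 1# ≤ a → 0# < a ^ʳ x
  ^ʳ-pos {a} x 1≤a = ≤-stable (λ ¬p → positive (¬p ∘ proj₁)) , λ 0≈ → positive λ 0< → proj₂ 0< 0≈
    where
    positive : ¬ ¬ (0# < a ^ʳ x)
    positive ¬0< = rationalBelow x λ (q , q≤x) →
      let y , y-power = rationalPower q (1≤⇒0< 1≤a)
      in ¬0< (<-≤-trans (rationalPower-pos q (1≤⇒0< 1≤a) y-power) (rationalPower≤^ʳ {q = q} 1≤a q≤x y-power))

  -- The two rational powers are brought to their larger exponent.
  ^ʳ-*-≤ : 1# ≤ a → 1# ≤ b → a ^ʳ x * b ^ʳ x ≤ (a * b) ^ʳ x
  ^ʳ-*-≤ {a} {b} {x} 1≤a 1≤b =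
    ≤/⇒*≤ 0<b^x (^ʳ-least 1≤a λ y p p≤x y-power → *≤⇒≤/ 0<b^x
      (≤-trans (≤-reflexive (*-comm _ _)) (≤/⇒*≤ (rationalPower-pos p 0<a y-power) (^ʳ-least 1≤b λ z q q≤x z-power →
        *≤⇒≤/ (rationalPower-pos p 0<a y-power) (≤-trans (≤-reflexive (*-comm _ _)) (product y z p q p≤x q≤x y-power z-power (ℚᵘ.≤-total p q)))))))
    where
    0<a = 1≤⇒0< 1≤a
    0<b = 1≤⇒0< 1≤b
    0<b^x = ^ʳ-pos x 1≤b
    1≤ab = ≤-trans (≤-reflexive (sym (*-identityˡ 1#))) (*-mono-≤ 0≤1 0≤1 1≤a 1≤b)
    product : ∀ y z p q → fromℚᵘ p ≤ x → fromℚᵘ q ≤ x → IsRationalPower a p y → IsRationalPower b q z →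
              p ℚᵘ.≤ q ⊎ q ℚᵘ.≤ p → y * z ≤ (a * b) ^ʳ x
    product y z p q p≤x q≤x y-power z-power (inj₁ p≤q) =
      let w , w-power = rationalPower q 0<a
      in ≤-trans (*-monoˡ-≤ z (proj₁ z-power) (rationalPower-monoʳ-≤ {p = p} {q = q} 1≤a p≤q y-power w-power))
           (rationalPower≤^ʳ {q = q} 1≤ab q≤x (rationalPower-* q 0<a 0<b w-power z-power))
    product y z p q p≤x q≤x y-power z-power (inj₂ q≤p) =
      let w , w-power = rationalPower p 0<b
      in ≤-trans (*-monoʳ-≤ y (proj₁ y-power) (rationalPower-monoʳ-≤ {p = q} {q = p} 1≤b q≤p z-power w-power))
           (rationalPower≤^ʳ {q = p} 1≤ab p≤x (rationalPower-* p 0<a 0<b y-power w-power))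

  -- The same number `y` serves on both sides: as a power of `a` with exponent q it is a power of
  -- `a ^ j` with exponent q / j, and q ≤ j x gives q / j ≤ x.
  ^ʳ-^-≤ : ∀ j .{{_ : NonZero j}} → 1# ≤ a → a ^ʳ (fromℕ j * x) ≤ (a ^ j) ^ʳ x
  ^ʳ-^-≤ {a} {x} (suc j) 1≤a = ^ʳ-least 1≤a below
    where
    open ≤-Reasoning
    0<a = 1≤⇒0< 1≤a
    below : ∀ y q → fromℚᵘ q ≤ fromℕ (suc j) * x → IsRationalPower a q y → y ≤ (a ^ suc j) ^ʳ x
    below y (mkℚᵘ i d) i/d≤jx (0≤y , yⁿ≈) =
      -- `mkℚᵘ` takes the predecessor of the denominator, and `suc (j + d * suc j)` computes to
      -- `suc d * suc j`.
      rationalPower≤^ʳ {q = mkℚᵘ i (j ℕ.+ d ℕ.* suc j)} (1≤x^n (suc j) 1≤a)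
        (≤*⇒/≤ (fromℕ-pos (suc d ℕ.* suc j)) (begin
          fromℤ i                               ≤⟨ /≤⇒≤* (fromℕ-pos (suc d)) i/d≤jx ⟩
          fromℕ (suc j) * x * fromℕ (suc d)     ≈⟨ solve 3 (λ j x d → j :* x :* d := x :* (d :* j)) refl (fromℕ (suc j)) x (fromℕ (suc d)) ⟩
          x * (fromℕ (suc d) * fromℕ (suc j))   ≈⟨ *-congˡ (fromℕ-* (suc d) (suc j)) ⟨
          x * fromℕ (suc d ℕ.* suc j)           ∎))
        (0≤y , trans (sym (^-assocʳ y (suc d) (suc j))) (trans (^-congˡ (suc j) yⁿ≈) (sym (^ᶻ-^-comm i (suc j) 0<a))))

  -- Suppose the power were 1 and choose n with 1 / (n + 1) ≤ x. The root `y` of `a` of order n + 1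
  -- would then be at most 1, and so would `a = y ^ (n + 1)`. This gives 2^β > 1, on which the
  -- geometric series depends.
  1<^ʳ : 1# < a → 0# < x → 1# < a ^ʳ x
  1<^ʳ {a} {x} 1<a 0<x = 1≤^ʳ (<⇒≤ 1<a) (<⇒≤ 0<x) , λ 1≈a^x → archimedean (x ⁻¹) λ (n , 1/x≤n) →
    let y , 0≤y , yⁿ≈a = rationalPower (mkℚᵘ (+ 1) n) (1≤⇒0< (<⇒≤ 1<a))
        1/[1+n]≤x = ≤*⇒/≤ (fromℕ-pos (suc n)) (begin
          fromℕ 1            ≈⟨ +-identityʳ 1# ⟩
          1#                 ≈⟨ ⁻¹-inverseʳ x (>⇒≉ 0<x) ⟨
          x * x ⁻¹           ≤⟨ *-monoʳ-≤ x (<⇒≤ 0<x) (≤-trans 1/x≤n (fromℕ-mono (ℕ.n≤1+n n))) ⟩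
          x * fromℕ (suc n)  ∎)
        y≤1 = ≤-trans (rationalPower≤^ʳ {q = mkℚᵘ (+ 1) n} (<⇒≤ 1<a) 1/[1+n]≤x (0≤y , yⁿ≈a)) (≤-reflexive (sym 1≈a^x))
    in <⇒≱ 1<a (begin
      a            ≈⟨ *-identityʳ a ⟨
      a * 1#       ≈⟨ yⁿ≈a ⟨
      y ^ suc n    ≤⟨ x^n≤1 (suc n) 0≤y y≤1 ⟩
      1#           ∎)
    where open ≤-Reasoning

-- Divisibility by primes and integer quotients.

-- Together with `/-suc-∤` this is the induction step of `∑₁-dilate`: the quotient by `p` jumps
-- exactly at the multiples of `p`.
/-suc-∣ : ∀ p n .{{_ : NonZero p}} → p ∣ suc n → suc n ℕ./ p ≡ suc (n ℕ./ p)
/-suc-∣ p@(suc p-1) n (divides (suc q) eq) rewrite eq = ≡.trans (ℕ.m*n/n≡m (suc q) p) (≡.cong suc (≡.sym (begin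
  n ℕ./ p                     ≡⟨ ≡.cong (ℕ._/ p) (ℕ.suc-injective eq) ⟩
  (p-1 ℕ.+ q ℕ.* p) ℕ./ p     ≡⟨ ℕ.+-distrib-/-∣ʳ p-1 (n∣m*n q) ⟩
  p-1 ℕ./ p ℕ.+ q ℕ.* p ℕ./ p ≡⟨ ≡.cong₂ ℕ._+_ (ℕ.m<n⇒m/n≡0 (ℕ.n<1+n p-1)) (ℕ.m*n/n≡m q p) ⟩
  q                           ∎)))
  where open ≡.≡-Reasoning

/-suc-∤ : ∀ p n .{{_ : NonZero p}} → p ∤ suc n → suc n ℕ./ p ≡ n ℕ./ p
/-suc-∤ p n p∤1+n with suc n % p in r-eq
... | zero  = contradiction (m%n≡0⇒n∣m (suc n) p r-eq) p∤1+n
... | suc r = ≡.sym (begin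
  n ℕ./ p                       ≡⟨ ≡.cong (ℕ._/ p) (ℕ.suc-injective (≡.trans (ℕ.m≡m%n+[m/n]*n (suc n) p) (≡.cong (ℕ._+ q ℕ.* p) r-eq))) ⟩
  (r ℕ.+ q ℕ.* p) ℕ./ p         ≡⟨ ℕ.+-distrib-/-∣ʳ r (n∣m*n q) ⟩
  r ℕ./ p ℕ.+ q ℕ.* p ℕ./ p     ≡⟨ ≡.cong₂ ℕ._+_ (ℕ.m<n⇒m/n≡0 r<p) (ℕ.m*n/n≡m q p) ⟩
  q                             ∎)
  where
  open ≡.≡-Reasoning
  q = suc n ℕ./ p
  r<p : r ℕ.< p
  r<p = ℕ.<-trans (ℕ.n<1+n r) (≡.subst (ℕ._< p) r-eq (ℕ.m%n<n (suc n) p))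

-- If `p` does not divide `d`, the two are coprime, so one factor `p` can be cancelled from the
-- power; the descent ends at `d ∣ 1`.
divisor-of-prime-power : ∀ {p d} j → Prime p → d ∣ p ℕ.^ j → d ≢ 1 → p ∣ d
divisor-of-prime-power zero    _  d∣1  d≢1 = contradiction (∣1⇒≡1 d∣1) d≢1
divisor-of-prime-power {p} {d} (suc j) pp d∣pʲ⁺¹ d≢1 with p ∣? d
... | yes p∣d = p∣d
... | no p∤d = divisor-of-prime-power j pp (coprime-divisor {d} {p} coprime d∣pʲ⁺¹) d≢1
  where
  coprime : Coprime d p
  coprime (e∣d , e∣p) = [ id , (λ { ≡.refl → contradiction e∣d p∤d }) ]′ (prime⇒irreducible pp e∣p)

prime-factor : ∀ n → n ≢ 1 → .{{_ : NonZero n}} → ∃ λ p → Prime p × p ∣ n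
prime-factor n n≢1 with factorise n
... | record { factors = [] ; isFactorisation = eq } = contradiction eq n≢1
... | record { factors = p ∷ ps ; isFactorisation = eq ; factorsPrime = pp ∷ _ } = p , pp , ≡.subst (p ∣_) (≡.sym eq) (m∣m*n _)

-- Conditional terms and finite sums.

if-yes : ∀ {a p} {A : Set a} {P : Set p} (P? : Dec P) {x y : A} → P → (if ⌊ P? ⌋ then x else y) ≡ x
if-yes (yes _) _ = ≡.refl
if-yes (no ¬p) p = contradiction p ¬p

if-no : ∀ {a p} {A : Set a} {P : Set p} (P? : Dec P) {x y : A} → ¬ P → (if ⌊ P? ⌋ then x else y) ≡ y
if-no (yes p) ¬p = contradiction p ¬p
if-no (no _)  _  = ≡.refl

module FiniteSums {c ℓ} (K : CommutativeRing c ℓ) where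
  open CommutativeRing K hiding (zero)
  open SemiringSum semiring using (∑-comm; ∑-distrib-+; *-distribˡ-sum)
  open Sum₁ +-rawMonoid public

  ∑₁-cong : ∀ n f g → (∀ k .{{_ : NonZero k}} → k ℕ.≤ n → f k ≈ g k) → ∑₁ n f ≈ ∑₁ n g
  ∑₁-cong zero    f g f≈g = refl
  ∑₁-cong (suc n) f g f≈g = +-cong (f≈g 1 (ℕ.s≤s ℕ.z≤n)) (∑₁-cong n (f ∘ suc) (g ∘ suc) λ k k≤n → f≈g (suc k) (ℕ.s≤s k≤n))

  ∑₁-zero : ∀ n f → (∀ k .{{_ : NonZero k}} → k ℕ.≤ n → f k ≈ 0#) → ∑₁ n f ≈ 0#
  ∑₁-zero zero    f f≈0 = refl
  ∑₁-zero (suc n) f f≈0 = trans (+-cong (f≈0 1 (ℕ.s≤s ℕ.z≤n)) (∑₁-zero n (f ∘ suc) λ k k≤n → f≈0 (suc k) (ℕ.s≤s k≤n))) (+-identityˡ 0#)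

  ∑₁-suc : ∀ n f → ∑₁ (suc n) f ≈ ∑₁ n f + f (suc n)
  ∑₁-suc zero    f = +-comm _ _
  ∑₁-suc (suc n) f = trans (+-congˡ (∑₁-suc n (f ∘ suc))) (sym (+-assoc _ _ _))

  ∑₁-+ : ∀ n f g → ∑₁ n (λ k → f k + g k) ≈ ∑₁ n f + ∑₁ n g
  ∑₁-+ n f g = ∑-distrib-+ {n} _ _

  ∑₁-* : ∀ n x f → ∑₁ n (λ k → x * f k) ≈ x * ∑₁ n f
  ∑₁-* n x f = sym (*-distribˡ-sum {n} x _)

  ∑₁-comm : ∀ m n (h : ℕ → ℕ → Carrier) → ∑₁ m (λ i → ∑₁ n (h i)) ≈ ∑₁ n (λ j → ∑₁ m (λ i → h i j))
  ∑₁-comm m n h = ∑-comm {m} {n} (λ i j → h (suc (toℕ i)) (suc (toℕ j)))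

  ∑₁-truncate : ∀ {m n} f → m ℕ.≤ n → (∀ k → m ℕ.< k → f k ≈ 0#) → ∑₁ n f ≈ ∑₁ m f
  ∑₁-truncate {n = n} f ℕ.z≤n       f≈0 = ∑₁-zero n f λ k _ → f≈0 k (ℕ.>-nonZero⁻¹ k)
  ∑₁-truncate         f (ℕ.s≤s m≤n) f≈0 = +-congˡ (∑₁-truncate (f ∘ suc) m≤n λ k m<k → f≈0 (suc k) (ℕ.s≤s m<k))

-- Dirichlet convolution, dilations and products of linear factors in an operator.

module DirichletConvolution {c ℓ} (K : CommutativeRing c ℓ) where
  open CommutativeRing K hiding (zero)
  open IntegerSolver K
  open RingProperties ring using (-0#≈0#)
  open CommutativeSemigroupProperties *-commutativeSemigroup using (x∙yz≈y∙xz)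
  open FiniteSums K
  module ≈-Reasoning = SetoidReasoning setoid

  infix  4 _≐_
  infixl 7 _⋆_

  Function : Set c
  Function = ℕ → Carrier

  Operator : Set c
  Operator = Function → Function

  _≐_ : Function → Function → Set ℓ
  a ≐ b = ∀ n → a n ≈ b n

  record IsLinear (L : Operator) : Set (c Level.⊔ ℓ) where
    field
      cong   : ∀ {a b} → a ≐ b → L a ≐ L b
      +-homo : ∀ a b → L (λ n → a n + b n) ≐ λ n → L a n + L b n
      *-homo : ∀ x a → L (λ n → x * a n) ≐ λ n → x * L a n

  -- The operators 1 - x σ and ∏ᵢ (1 - xᵢ σ).
  Δ : Operator → Carrier → Operator
  Δ σ x a n = a n - x * σ a n

  Δs : ∀ {d} → Operator → Vector Carrier d → Operator
  Δs σ xs a = foldr (Δ σ) a xs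

  module _ {σ : Operator} (σ-linear : IsLinear σ) where
    private module σ = IsLinear σ-linear

    Δ-cong : ∀ {x y a b} → x ≈ y → a ≐ b → Δ σ x a ≐ Δ σ y b
    Δ-cong x≈y a≐b n = +-cong (a≐b n) (-‿cong (*-cong x≈y (σ.cong a≐b n)))

    Δ-linear : ∀ x → IsLinear (Δ σ x)
    Δ-linear x = record
      { cong   = Δ-cong refl
      ; +-homo = λ a b n → trans (+-congˡ (-‿cong (*-congˡ (σ.+-homo a b n))))
          (solve 5 (λ x a b c d → a :+ b :- x :* (c :+ d) := (a :- x :* c) :+ (b :- x :* d)) refl x (a n) (b n) (σ a n) (σ b n))
      ; *-homo = λ y a n → trans (+-congˡ (-‿cong (*-congˡ (σ.*-homo y a n))))
          (solve 4 (λ x y a b → y :* a :- x :* (y :* b) := y :* (a :- x :* b)) refl x y (a n) (σ a n))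
      }

    Δs-linear : ∀ {d} (xs : Vector Carrier d) → IsLinear (Δs σ xs)
    Δs-linear {zero}  xs = record { cong = id ; +-homo = λ _ _ _ → refl ; *-homo = λ _ _ _ → refl }
    Δs-linear {suc d} xs = record
      { cong   = Δ₀.cong ∘ Δ₁.cong
      ; +-homo = λ a b n → trans (Δ₀.cong (Δ₁.+-homo a b) n) (Δ₀.+-homo _ _ n)
      ; *-homo = λ x a n → trans (Δ₀.cong (Δ₁.*-homo x a) n) (Δ₀.*-homo x _ n)
      }
      where
      module Δ₀ = IsLinear (Δ-linear (head xs))
      module Δ₁ = IsLinear (Δs-linear (tail xs))

  module _ {L σ τ : Operator} (L-linear : IsLinear L) (τ-linear : IsLinear τ)
           (Lσ≐τL : ∀ a → L (σ a) ≐ τ (L a)) where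
    private module L = IsLinear L-linear

    Δ-intertwine : ∀ x a → L (Δ σ x a) ≐ Δ τ x (L a)
    Δ-intertwine x a n = begin
      -- `IsLinear` speaks of sums and scalar multiples only, so the difference is rewritten with
      -- the scalar `- 1#`.
      L (λ k → a k - x * σ a k) n               ≈⟨ L.cong (λ k → +-congˡ (sym (-1* (x * σ a k)))) n ⟩
      L (λ k → a k + (- 1#) * (x * σ a k)) n    ≈⟨ L.+-homo a _ n ⟩
      L a n + L (λ k → (- 1#) * (x * σ a k)) n  ≈⟨ +-congˡ (L.*-homo (- 1#) _ n) ⟩
      L a n + (- 1#) * L (λ k → x * σ a k) n    ≈⟨ +-congˡ (-1* _) ⟩
      L a n - L (λ k → x * σ a k) n             ≈⟨ +-congˡ (-‿cong (trans (L.*-homo x _ n) (*-congˡ (Lσ≐τL a n)))) ⟩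
      L a n - x * τ (L a) n                     ∎
      where
      open ≈-Reasoning
      -1* : ∀ y → (- 1#) * y ≈ - y
      -1* y = solve 1 (λ y → (:- con (ℤ.+ 1)) :* y := :- y) refl y

    -- The common transport principle: `L` will be convolution with a fixed function, summation,
    -- restriction to the powers of a prime, or another product of operators.
    Δs-intertwine : ∀ {d} (xs : Vector Carrier d) a → L (Δs σ xs a) ≐ Δs τ xs (L a)
    Δs-intertwine {zero}  xs a n = refl
    Δs-intertwine {suc d} xs a n = trans (Δ-intertwine (head xs) _ n)
      (Δ-cong τ-linear refl (Δs-intertwine (tail xs) a) n)

  -- Two transports: `τ` commutes with `Δs σ xs`, and hence `Δs σ xs` commutes with `Δs τ ys`.
  Δs-comm : ∀ {σ τ d e} → IsLinear σ → IsLinear τ → (∀ a → σ (τ a) ≐ τ (σ a)) →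
            (xs : Vector Carrier d) (ys : Vector Carrier e) (a : Function) →
            Δs σ xs (Δs τ ys a) ≐ Δs τ ys (Δs σ xs a)
  Δs-comm σ-linear τ-linear στ≐τσ xs ys =
    Δs-intertwine (Δs-linear σ-linear xs) τ-linear
      (λ a n → sym (Δs-intertwine τ-linear σ-linear (λ b m → sym (στ≐τσ b m)) xs a n)) ys

  -- Multiplication of Dirichlet series by p⁻ˢ.
  dilate : (p : ℕ) .{{_ : NonZero p}} → Operator
  dilate p a n = if ⌊ p ∣? n ⌋ then a (n ℕ./ p) else 0#

  dilate-* : ∀ p .{{_ : NonZero p}} a m → dilate p a (m ℕ.* p) ≡ a m
  dilate-* p a m = ≡.trans (if-yes (p ∣? (m ℕ.* p)) (n∣m*n m)) (≡.cong a (ℕ.m*n/n≡m m p))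

  dilate-∤ : ∀ p .{{_ : NonZero p}} a {n} → p ∤ n → dilate p a n ≡ 0#
  dilate-∤ p a {n} = if-no (p ∣? n)

  dilate-linear : ∀ p .{{_ : NonZero p}} → IsLinear (dilate p)
  dilate-linear p = record
    { cong   = λ a≐b n → if-cong n (a≐b _)
    ; +-homo = λ a b n → if-+ n
    ; *-homo = λ x a n → if-* n
    }
    where
    if-cong : ∀ n {x y} → x ≈ y → (if ⌊ p ∣? n ⌋ then x else 0#) ≈ (if ⌊ p ∣? n ⌋ then y else 0#)
    if-cong n x≈y with p ∣? n
    ... | yes _ = x≈y
    ... | no  _ = refl
    if-+ : ∀ n {x y} → (if ⌊ p ∣? n ⌋ then x + y else 0#) ≈ (if ⌊ p ∣? n ⌋ then x else 0#) + (if ⌊ p ∣? n ⌋ then y else 0#)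
    if-+ n with p ∣? n
    ... | yes _ = refl
    ... | no  _ = sym (+-identityʳ 0#)
    if-* : ∀ n {x y} → (if ⌊ p ∣? n ⌋ then x * y else 0#) ≈ x * (if ⌊ p ∣? n ⌋ then y else 0#)
    if-* n with p ∣? n
    ... | yes _ = refl
    ... | no  _ = sym (zeroʳ _)

  -- This carries the dilation by `p` to the operator V_p on summatory functions.
  ∑₁-dilate : ∀ p .{{_ : NonZero p}} N a → ∑₁ N (dilate p a) ≈ ∑₁ (N ℕ./ p) a
  ∑₁-dilate p zero    a = reflexive (≡.cong (λ M → ∑₁ M a) (≡.sym (ℕ.0/n≡0 p)))
  ∑₁-dilate p (suc N) a with p ∣? suc N
  ... | yes p∣1+N = begin
    ∑₁ (suc N) (dilate p a)                 ≈⟨ ∑₁-suc N (dilate p a) ⟩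
    ∑₁ N (dilate p a) + dilate p a (suc N)  ≈⟨ +-cong (∑₁-dilate p N a) (reflexive (≡.trans (if-yes (p ∣? suc N) p∣1+N) (≡.cong a (/-suc-∣ p N p∣1+N)))) ⟩
    ∑₁ (N ℕ./ p) a + a (suc (N ℕ./ p))      ≈⟨ ∑₁-suc (N ℕ./ p) a ⟨
    ∑₁ (suc (N ℕ./ p)) a                    ≡⟨ ≡.cong (λ M → ∑₁ M a) (/-suc-∣ p N p∣1+N) ⟨
    ∑₁ (suc N ℕ./ p) a                      ∎
    where open ≈-Reasoning
  ... | no p∤1+N = begin
    ∑₁ (suc N) (dilate p a)                 ≈⟨ ∑₁-suc N (dilate p a) ⟩
    ∑₁ N (dilate p a) + dilate p a (suc N)  ≈⟨ +-cong (∑₁-dilate p N a) (reflexive (dilate-∤ p a p∤1+N)) ⟩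
    ∑₁ (N ℕ./ p) a + 0#                     ≈⟨ +-identityʳ _ ⟩
    ∑₁ (N ℕ./ p) a                          ≡⟨ ≡.cong (λ M → ∑₁ M a) (/-suc-∤ p N p∤1+N) ⟨
    ∑₁ (suc N ℕ./ p) a                      ∎
    where open ≈-Reasoning

  private
    term : Function → Function → ℕ → ℕ → ℕ → Carrier
    term a b n d m = if ⌊ d ℕ.* m ℕ.≟ n ⌋ then a d * b m else 0#

    row : ℕ → Function → Function → ℕ → ℕ → Carrier
    row N a b n d = ∑₁ N (term a b n d)

  -- Over the complex numbers this unfolds to the convolution in the statement, so results about it
  -- apply there without conversion.
  _⋆_ : Function → Function → Function
  (a ⋆ b) n = ∑₁ n (row n a b n)

  ε : Function
  ε n = if ⌊ n ℕ.≟ 1 ⌋ then 1# else 0#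

  private
    if-⇔ : ∀ {p q} {P : Set p} {Q : Set q} (P? : Dec P) (Q? : Dec Q) {x y} →
           (P → Q) → (Q → P) → (P → x ≈ y) → (if ⌊ P? ⌋ then x else 0#) ≈ (if ⌊ Q? ⌋ then y else 0#)
    if-⇔ (yes p) (yes _)  _   _   x≈y = x≈y p
    if-⇔ (no _)  (no _)   _   _   _   = refl
    if-⇔ (yes p) (no ¬q)  p→q _   _   = contradiction (p→q p) ¬q
    if-⇔ (no ¬p) (yes q)  _   q→p _   = contradiction (q→p q) ¬p

    if-zero : ∀ {p} {P : Set p} (P? : Dec P) {x} → (P → x ≈ 0#) → (if ⌊ P? ⌋ then x else 0#) ≈ 0#
    if-zero (yes p) x≈0 = x≈0 p
    if-zero (no _)  _   = refl

    if-+ : ∀ {p} {P : Set p} (P? : Dec P) {x y} →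
           (if ⌊ P? ⌋ then x + y else 0#) ≈ (if ⌊ P? ⌋ then x else 0#) + (if ⌊ P? ⌋ then y else 0#)
    if-+ (yes _) = refl
    if-+ (no _)  = sym (+-identityʳ 0#)

    if-* : ∀ {p} {P : Set p} (P? : Dec P) {x y} →
           (if ⌊ P? ⌋ then x * y else 0#) ≈ x * (if ⌊ P? ⌋ then y else 0#)
    if-* (yes _) = refl
    if-* (no _)  = sym (zeroʳ _)

  ⋆-cong : ∀ a a′ b b′ n → (∀ k .{{_ : NonZero k}} → k ℕ.≤ n → a k ≈ a′ k) →
           (∀ k .{{_ : NonZero k}} → k ℕ.≤ n → b k ≈ b′ k) → (a ⋆ b) n ≈ (a′ ⋆ b′) n
  ⋆-cong a a′ b b′ n a≈a′ b≈b′ = ∑₁-cong n (row n a b n) (row n a′ b′ n) λ d d≤n →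
    ∑₁-cong n (term a b n d) (term a′ b′ n d) λ m m≤n →
      if-⇔ (d ℕ.* m ℕ.≟ n) (d ℕ.* m ℕ.≟ n) id id λ _ → *-cong (a≈a′ d d≤n) (b≈b′ m m≤n)

  ⋆-comm : ∀ a b → a ⋆ b ≐ b ⋆ a
  ⋆-comm a b n = trans (∑₁-comm n n (term a b n)) (∑₁-cong n (λ m → ∑₁ n λ d → term a b n d m) (row n b a n) λ m _ →
    ∑₁-cong n (λ d → term a b n d m) (term b a n m) λ d _ →
      if-⇔ (d ℕ.* m ℕ.≟ n) (m ℕ.* d ℕ.≟ n) (≡.trans (ℕ.*-comm m d)) (≡.trans (ℕ.*-comm d m)) λ _ → *-comm _ _)

  ⋆-linearʳ : ∀ a → IsLinear (a ⋆_)
  ⋆-linearʳ a = record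
    { cong   = λ {b} {b′} b≐b′ n → ⋆-cong a a b b′ n (λ _ _ → refl) (λ k _ → b≐b′ k)
    ; +-homo = λ b b′ n → let b+b′ = λ k → b k + b′ k in trans
        (∑₁-cong n (row n a b+b′ n) (λ d → row n a b n d + row n a b′ n d) λ d _ → trans
          (∑₁-cong n (term a b+b′ n d) (λ m → term a b n d m + term a b′ n d m) λ m _ →
            trans (if-⇔ (d ℕ.* m ℕ.≟ n) (d ℕ.* m ℕ.≟ n) id id λ _ → distribˡ _ _ _) (if-+ (d ℕ.* m ℕ.≟ n)))
          (∑₁-+ n (term a b n d) (term a b′ n d)))
        (∑₁-+ n (row n a b n) (row n a b′ n))
    ; *-homo = λ x b n → let xb = λ k → x * b k in trans
        (∑₁-cong n (row n a xb n) (λ d → x * row n a b n d) λ d _ → trans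
          (∑₁-cong n (term a xb n d) (λ m → x * term a b n d m) λ m _ → trans
            (if-⇔ (d ℕ.* m ℕ.≟ n) (d ℕ.* m ℕ.≟ n) id id λ _ → x∙yz≈y∙xz (a d) x (b m))
            (if-* (d ℕ.* m ℕ.≟ n)))
          (∑₁-* n x (term a b n d)))
        (∑₁-* n x (row n a b n))
    }

  ⋆-linearˡ : ∀ b → IsLinear (_⋆ b)
  ⋆-linearˡ b = record
    { cong   = λ {a} {a′} a≐a′ n → ⋆-cong a a′ b b n (λ k _ → a≐a′ k) (λ _ _ → refl)
    ; +-homo = λ a a′ n → trans (⋆-comm (λ k → a k + a′ k) b n) (trans (b⋆.+-homo a a′ n) (+-cong (⋆-comm b a n) (⋆-comm b a′ n)))
    ; *-homo = λ x a n → trans (⋆-comm (λ k → x * a k) b n) (trans (b⋆.*-homo x a n) (*-congˡ (⋆-comm b a n)))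
    }
    where module b⋆ = IsLinear (⋆-linearʳ b)

  -- Only rows `d = e * p` survive on the left, and `e * p * m` equals `q * p` exactly when `e * m`
  -- equals `q`. The rows, as a function of `d`, thus form a dilation themselves, and `∑₁-dilate`
  -- sums them.
  dilate-⋆ : ∀ p .{{_ : NonZero p}} a b → dilate p a ⋆ b ≐ dilate p (a ⋆ b)
  dilate-⋆ p a b n with p ∣? n
  ... | no p∤n = ∑₁-zero n (row n (dilate p a) b n) λ d _ → ∑₁-zero n (term (dilate p a) b n d) λ m _ →
    if-zero (d ℕ.* m ℕ.≟ n) λ dm≡n →
      trans (*-congʳ (reflexive (dilate-∤ p a {d} λ p∣d → p∤n (≡.subst (p ∣_) dm≡n (∣m⇒∣m*n m p∣d))))) (zeroˡ (b m))
  ... | yes (divides q ≡.refl) = begin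
    -- `row n′ a b q` lets `m` run up to `n′` but compares products with `q`; its surplus terms
    -- vanish and are cut off two steps below.
    ∑₁ n′ (row n′ (dilate p a) b n′)    ≈⟨ ∑₁-cong n′ (row n′ (dilate p a) b n′) (dilate p (row n′ a b q)) (λ d _ → dilate-row d) ⟩
    ∑₁ n′ (dilate p (row n′ a b q))     ≈⟨ ∑₁-dilate p n′ (row n′ a b q) ⟩
    ∑₁ (n′ ℕ./ p) (row n′ a b q)        ≡⟨ ≡.cong (λ M → ∑₁ M (row n′ a b q)) n′/p≡q ⟩
    ∑₁ q (row n′ a b q)                 ≈⟨ ∑₁-cong q (row n′ a b q) (row q a b q) (λ d _ → ∑₁-truncate (term a b q d) (ℕ.m≤m*n q p) λ m q<m →
        reflexive (if-no (d ℕ.* m ℕ.≟ q) λ dm≡q → ℕ.<⇒≱ q<m (ℕ.≤-trans (ℕ.m≤n*m m d) (ℕ.≤-reflexive dm≡q)))) ⟩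
    (a ⋆ b) q                           ≡⟨ ≡.cong (a ⋆ b) n′/p≡q ⟨
    (a ⋆ b) (n′ ℕ./ p)                  ∎
    where
    open ≈-Reasoning
    n′ = q ℕ.* p
    n′/p≡q = ℕ.m*n/n≡m q p
    dilate-row : ∀ d → row n′ (dilate p a) b n′ d ≈ dilate p (row n′ a b q) d
    dilate-row d = split (p ∣? d)
      where
      split : ∀ {d} → Dec (p ∣ d) → row n′ (dilate p a) b n′ d ≈ dilate p (row n′ a b q) d
      split {d} (no p∤d) = begin
        row n′ (dilate p a) b n′ d             ≈⟨ ∑₁-zero n′ (term (dilate p a) b n′ d) (λ m _ → if-zero (d ℕ.* m ℕ.≟ n′) λ _ →
                                                    trans (*-congʳ (reflexive (dilate-∤ p a p∤d))) (zeroˡ (b m))) ⟩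
        0#                                     ≡⟨ dilate-∤ p (row n′ a b q) p∤d ⟨
        dilate p (row n′ a b q) d              ∎
      split (yes (divides e ≡.refl)) = begin
        row n′ (dilate p a) b n′ (e ℕ.* p)     ≈⟨ ∑₁-cong n′ (term (dilate p a) b n′ (e ℕ.* p)) (term a b q e) (λ m _ →
                                                    if-⇔ (e ℕ.* p ℕ.* m ℕ.≟ n′) (e ℕ.* m ℕ.≟ q)
                                                      (λ eq → ℕ.*-cancelʳ-≡ (e ℕ.* m) q p (≡.trans (≡.sym (swap m)) eq))
                                                      (λ eq → ≡.trans (swap m) (≡.cong (ℕ._* p) eq))
                                                      (λ _ → *-congʳ (reflexive (dilate-* p a e)))) ⟩
        row n′ a b q e                         ≡⟨ dilate-* p (row n′ a b q) e ⟨
        dilate p (row n′ a b q) (e ℕ.* p)      ∎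
        where
        swap : ∀ m → e ℕ.* p ℕ.* m ≡ e ℕ.* m ℕ.* p
        swap m = ≡.trans (ℕ.*-assoc e p m) (≡.trans (≡.cong (e ℕ.*_) (ℕ.*-comm p m)) (≡.sym (ℕ.*-assoc e m p)))

  ⋆-dilate : ∀ p .{{_ : NonZero p}} a b → a ⋆ dilate p b ≐ dilate p (a ⋆ b)
  ⋆-dilate p a b n = trans (⋆-comm a (dilate p b) n) (trans (dilate-⋆ p b a n) (IsLinear.cong (dilate-linear p) {b ⋆ a} {a ⋆ b} (⋆-comm b a) n))

  -- A dilation may be applied to either factor of a convolution, so the factors 1 - xᵢ σ can be
  -- handed out one to each `as i`.
  Δs-foldr-⋆ : ∀ p .{{_ : NonZero p}} {d} (xs : Vector Carrier d) (as : Vector Function d) →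
               Δs (dilate p) xs (foldr _⋆_ ε as) ≐ foldr _⋆_ ε λ i → Δ (dilate p) (xs i) (as i)
  Δs-foldr-⋆ p {zero}  xs as n = refl
  Δs-foldr-⋆ p {suc d} xs as n = begin
    Δ σ x (Δs σ xs′ (a ⋆ b)) n               ≈⟨ IsLinear.cong (Δ-linear σ-linear x) {Δs σ xs′ (a ⋆ b)} {a ⋆ Δs σ xs′ b}
                                                  (λ m → sym (Δs-intertwine {a ⋆_} {σ} {σ} (⋆-linearʳ a) σ-linear (⋆-dilate p a) xs′ b m)) n ⟩
    Δ σ x (a ⋆ Δs σ xs′ b) n                 ≈⟨ Δ-intertwine {_⋆ Δs σ xs′ b} {σ} {σ} (⋆-linearˡ (Δs σ xs′ b)) σ-linear (λ a′ → dilate-⋆ p a′ (Δs σ xs′ b)) x a n ⟨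
    (Δ σ x a ⋆ Δs σ xs′ b) n                 ≈⟨ IsLinear.cong (⋆-linearʳ (Δ σ x a)) {Δs σ xs′ b} {foldr _⋆_ ε (λ i → Δ σ (xs′ i) (as′ i))} (Δs-foldr-⋆ p xs′ as′) n ⟩
    (Δ σ x a ⋆ foldr _⋆_ ε (λ i → Δ σ (xs′ i) (as′ i))) n ∎
    where
    open ≈-Reasoning
    σ = dilate p
    σ-linear = dilate-linear p
    x = head xs
    a = head as
    xs′ = tail xs
    as′ = tail as
    b = foldr _⋆_ ε as′

  -- Only divisors of `n` enter the value at `n`. Agreement with `ε` is required just there, because
  -- a sieved function looks like `ε` only in a bounded range.
  ⋆-unitˡ : ∀ a b n .{{_ : NonZero n}} → a 1 ≈ 1# → (∀ d → d ∣ n → d ≢ 1 → a d ≈ 0#) → (a ⋆ b) n ≈ b n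
  ⋆-unitˡ a b n@(suc n-1) a₁≈1 a≈0 = begin
    (a ⋆ b) n      ≈⟨ +-cong row-1 (∑₁-zero n-1 (row n a b n ∘ suc) λ d _ → ∑₁-zero n (term a b n (suc d)) λ m _ →
                        if-zero (suc d ℕ.* m ℕ.≟ n) λ dm≡n →
                          trans (*-congʳ (a≈0 (suc d) (divides m (≡.trans (≡.sym dm≡n) (ℕ.*-comm (suc d) m))) (1+d≢1 d))) (zeroˡ (b m))) ⟩
    b n + 0#       ≈⟨ +-identityʳ _ ⟩
    b n            ∎
    where
    open ≈-Reasoning
    1+d≢1 : ∀ d .{{_ : NonZero d}} → suc d ≢ 1
    1+d≢1 (suc d) ()
    row-1 : row n a b n 1 ≈ b n
    row-1 = begin
      ∑₁ n (term a b n 1)                    ≈⟨ ∑₁-suc n-1 (term a b n 1) ⟩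
      ∑₁ n-1 (term a b n 1) + term a b n 1 n ≈⟨ +-cong
          (∑₁-zero n-1 (term a b n 1) λ m m<n → reflexive (if-no (1 ℕ.* m ℕ.≟ n) λ m≡n → ℕ.<⇒≢ (ℕ.s≤s m<n) (≡.trans (≡.sym (ℕ.*-identityˡ m)) m≡n)))
          (reflexive (if-yes (1 ℕ.* n ℕ.≟ n) (ℕ.*-identityˡ n))) ⟩
      0# + a 1 * b n     ≈⟨ +-identityˡ _ ⟩
      a 1 * b n          ≈⟨ *-congʳ a₁≈1 ⟩
      1# * b n           ≈⟨ *-identityˡ _ ⟩
      b n                ∎

  foldr-⋆-unit : ∀ {d} (as : Vector Function d) n .{{_ : NonZero n}} → (∀ i → as i 1 ≈ 1#) →
                 (∀ i k → k ∣ n → k ≢ 1 → as i k ≈ 0#) → foldr _⋆_ ε as n ≈ ε n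
  foldr-⋆-unit {zero}  as n a₁≈1 a≈0 = refl
  foldr-⋆-unit {suc d} as n a₁≈1 a≈0 = trans (⋆-unitˡ (head as) (foldr _⋆_ ε (tail as)) n (a₁≈1 zero) (a≈0 zero))
    (foldr-⋆-unit (tail as) n (λ i → a₁≈1 (suc i)) (λ i → a≈0 (suc i)))

  Δ-dilate-1 : ∀ p .{{_ : NonZero p}} x a → p ≢ 1 → Δ (dilate p) x a 1 ≈ a 1
  Δ-dilate-1 p x a p≢1 = begin
    a 1 - x * dilate p a 1   ≈⟨ +-congˡ (-‿cong (trans (*-congˡ (reflexive (dilate-∤ p a {1} (p≢1 ∘ ∣1⇒≡1)))) (zeroʳ x))) ⟩
    a 1 - 0#                 ≈⟨ trans (+-congˡ -0#≈0#) (+-identityʳ _) ⟩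
    a 1                      ∎
    where open ≈-Reasoning

  Δ-dilate-∤ : ∀ p .{{_ : NonZero p}} x a {n} → p ∤ n → Δ (dilate p) x a n ≈ a n
  Δ-dilate-∤ p x a {n} p∤n = begin
    a n - x * dilate p a n   ≈⟨ +-congˡ (-‿cong (trans (*-congˡ (reflexive (dilate-∤ p a p∤n))) (zeroʳ x))) ⟩
    a n - 0#                 ≈⟨ trans (+-congˡ -0#≈0#) (+-identityʳ _) ⟩
    a n                      ∎
    where open ≈-Reasoning

  -- Multiplicativity is asked at `p` alone: a partially sieved function keeps it for the primes not
  -- yet sieved.
  Δ-dilate-∣ : ∀ p .{{_ : NonZero p}} x a {n} .{{_ : NonZero n}} → (∀ m .{{_ : NonZero m}} → a (p ℕ.* m) ≈ x * a m) →
               p ∣ n → Δ (dilate p) x a n ≈ 0#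
  Δ-dilate-∣ p x a mult p∣n@(divides m ≡.refl) = begin
    a (m ℕ.* p) - x * dilate p a (m ℕ.* p)  ≡⟨ ≡.cong₂ (λ y z → a y - x * z) (ℕ.*-comm m p) (dilate-* p a m) ⟩
    a (p ℕ.* m) - x * a m                   ≈⟨ +-congʳ (mult m {{quotient≢0 p∣n}}) ⟩
    x * a m - x * a m                       ≈⟨ -‿inverseʳ _ ⟩
    0#                                      ∎
    where open ≈-Reasoning

-- Sieving by primes and Euler factors.

prime⇒≢1 : ∀ {p} → Prime p → p ≢ 1
prime⇒≢1 pp ≡.refl = ¬prime[1] pp

prime-∣-prime : ∀ {p q} → Prime p → Prime q → p ∣ q → p ≡ q
prime-∣-prime pp pq p∣q = [ (λ p≡1 → contradiction p≡1 (prime⇒≢1 pp)) , id ]′ (prime⇒irreducible pq p∣q)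

divisor≢0 : ∀ {m n} .{{_ : NonZero n}} → m ∣ n → NonZero m
divisor≢0 {m} (divides q ≡.refl) = ℕ.m*n≢0⇒n≢0 q

module EulerFactors {c ℓ} (K : CommutativeRing c ℓ) where
  open CommutativeRing K hiding (zero)
  open FiniteSums K
  open DirichletConvolution K
  open RingProperties ring using (-0#≈0#)

  onPrimes : ((p : ℕ) .{{_ : NonZero p}} → Operator) → ℕ → Operator
  onPrimes L zero    a = a
  onPrimes L (suc P) a = if ⌊ prime? (suc P) ⌋ then L (suc P) (onPrimes L P a) else onPrimes L P a

  onPrimes-intertwine : ∀ {M : Operator} {L L′} → IsLinear M → (∀ p .{{_ : NonZero p}} → IsLinear (L′ p)) →
    (∀ p .{{_ : NonZero p}} → Prime p → ∀ a → M (L p a) ≐ L′ p (M a)) → ∀ P a → M (onPrimes L P a) ≐ onPrimes L′ P (M a)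
  onPrimes-intertwine M-linear L′-linear ML≐L′M zero    a n = refl
  onPrimes-intertwine {M} {L} M-linear L′-linear ML≐L′M (suc P) a n with prime? (suc P)
  ... | yes pp = trans (ML≐L′M (suc P) pp (onPrimes L P a) n) (IsLinear.cong (L′-linear (suc P)) (onPrimes-intertwine M-linear L′-linear ML≐L′M P a) n)
  ... | no  _  = onPrimes-intertwine M-linear L′-linear ML≐L′M P a n

  onPrimes-cong : ∀ {L} → (∀ p .{{_ : NonZero p}} → IsLinear (L p)) → ∀ P {a b} → a ≐ b → onPrimes L P a ≐ onPrimes L P b
  onPrimes-cong L-linear zero    a≐b = a≐b
  onPrimes-cong L-linear (suc P) a≐b with prime? (suc P)
  ... | yes _ = IsLinear.cong (L-linear (suc P)) (onPrimes-cong L-linear P a≐b)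
  ... | no  _ = onPrimes-cong L-linear P a≐b

  record IsCompletelyMultiplicative (f : Function) : Set ℓ where
    field
      f1≈1 : f 1 ≈ 1#
      homo : ∀ m n .{{_ : NonZero m}} .{{_ : NonZero n}} → f (m ℕ.* n) ≈ f m * f n

  -- The restriction of f to the integers without prime factors up to P.
  sieve : Function → ℕ → Function
  sieve f P = onPrimes (λ p → Δ (dilate p) (f p)) P f

  module _ {f : Function} (f-multiplicative : IsCompletelyMultiplicative f) where
    open IsCompletelyMultiplicative f-multiplicative

    sieve-1 : ∀ P → sieve f P 1 ≈ 1#
    sieve-1 zero    = f1≈1
    sieve-1 (suc P) with prime? (suc P)
    ... | yes pp = trans (Δ-dilate-1 (suc P) (f (suc P)) (sieve f P) (prime⇒≢1 pp)) (sieve-1 P)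
    ... | no  _  = sieve-1 P

    -- The invariant that keeps the sieve running. In a step by the prime `p < q`, both sides vanish
    -- if `p ∣ n`; otherwise `p ∤ q * n` and the step changes neither value.
    sieve-* : ∀ P {q} → Prime q → P ℕ.< q → ∀ n .{{_ : NonZero n}} → sieve f P (q ℕ.* n) ≈ f q * sieve f P n
    sieve-* zero    {q} pq P<q n = homo q n {{prime⇒nonZero pq}}
    sieve-* (suc P) {q} pq P<q n with prime? (suc P)
    ... | no  _  = sieve-* P pq (ℕ.<-trans (ℕ.n<1+n P) P<q) n
    ... | yes pp = split (suc P ∣? n)
      where
      open ≈-Reasoning
      p = suc P
      instance
        q≢0 = prime⇒nonZero pq
        qn≢0 = ℕ.m*n≢0 q n
      p-step = sieve-* P pp (ℕ.n<1+n P)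
      split : Dec (p ∣ n) → Δ (dilate p) (f p) (sieve f P) (q ℕ.* n) ≈ f q * Δ (dilate p) (f p) (sieve f P) n
      split (yes p∣n) = trans (Δ-dilate-∣ p (f p) (sieve f P) p-step (∣n⇒∣m*n q p∣n))
        (sym (trans (*-congˡ (Δ-dilate-∣ p (f p) (sieve f P) p-step p∣n)) (zeroʳ _)))
      split (no p∤n) = begin
        Δ (dilate p) (f p) (sieve f P) (q ℕ.* n)     ≈⟨ Δ-dilate-∤ p (f p) (sieve f P) p∤qn ⟩
        sieve f P (q ℕ.* n)                          ≈⟨ sieve-* P pq (ℕ.<-trans (ℕ.n<1+n P) P<q) n ⟩
        f q * sieve f P n                            ≈⟨ *-congˡ (Δ-dilate-∤ p (f p) (sieve f P) p∤n) ⟨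
        f q * Δ (dilate p) (f p) (sieve f P) n       ∎
        where
        p∤qn : p ∤ q ℕ.* n
        p∤qn p∣qn = [ (λ p∣q → ℕ.<⇒≢ P<q (prime-∣-prime pp pq p∣q)) , p∤n ]′ (euclidsLemma q n pp p∣qn)

    -- The last step already kills the multiples of its own prime. If that prime does not divide
    -- `n`, it differs from `q`, so `q` was sieved earlier and the step leaves the value alone.
    sieve-∣ : ∀ P {q n} .{{_ : NonZero n}} → Prime q → q ℕ.≤ P → q ∣ n → sieve f P n ≈ 0#
    sieve-∣ zero    pq ℕ.z≤n q∣n = contradiction pq ¬prime[0]
    sieve-∣ (suc P) {q} {n} pq q≤1+P q∣n with prime? (suc P)
    ... | no ¬pp = sieve-∣ P pq (ℕ.≤-pred (ℕ.≤∧≢⇒< q≤1+P λ { ≡.refl → ¬pp pq })) q∣n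
    ... | yes pp = split (suc P ∣? n)
      where
      p = suc P
      split : Dec (p ∣ n) → Δ (dilate p) (f p) (sieve f P) n ≈ 0#
      split (yes p∣n) = Δ-dilate-∣ p (f p) (sieve f P) (sieve-* P pp (ℕ.n<1+n P)) p∣n
      split (no p∤n)  = trans (Δ-dilate-∤ p (f p) (sieve f P) p∤n)
        (sieve-∣ P pq (ℕ.≤-pred (ℕ.≤∧≢⇒< q≤1+P λ { ≡.refl → p∤n q∣n })) q∣n)

  summatory : Operator
  summatory a N = ∑₁ N a

  summatory-linear : IsLinear summatory
  summatory-linear = record
    { cong   = λ {a} {b} a≐b N → ∑₁-cong N a b λ n _ → a≐b n
    ; +-homo = λ a b N → ∑₁-+ N a b
    ; *-homo = λ x a N → ∑₁-* N x a
    }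

  contract : (p : ℕ) .{{_ : NonZero p}} → Operator
  contract p T N = T (N ℕ./ p)

  contract-linear : ∀ p .{{_ : NonZero p}} → IsLinear (contract p)
  contract-linear p = record { cong = λ S≐T N → S≐T (N ℕ./ p) ; +-homo = λ _ _ _ → refl ; *-homo = λ _ _ _ → refl }

  contract-comm : ∀ p q .{{_ : NonZero p}} .{{_ : NonZero q}} T → contract p (contract q T) ≐ contract q (contract p T)
  contract-comm p q T N = reflexive (≡.cong T (≡.trans (ℕ.m/n/o≡m/[n*o] N p q)
    (≡.trans (ℕ./-congʳ (ℕ.*-comm p q)) (≡.sym (ℕ.m/n/o≡m/[n*o] N q p)))))
    where
    instance
      pq≢0 = ℕ.m*n≢0 p q
      qp≢0 = ℕ.m*n≢0 q p

  -- Functions of an exponent are read as formal power series: `shift` multiplies by the variable X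
  -- and `δ` is the series 1, so that `Δs shift xs δ` is the polynomial ∏ᵢ (1 - xᵢ X).
  shift : Operator
  shift u zero    = 0#
  shift u (suc j) = u j

  shift-linear : IsLinear shift
  shift-linear = record
    { cong   = λ { u≐v zero → refl ; u≐v (suc j) → u≐v j }
    ; +-homo = λ { u v zero → sym (+-identityʳ 0#) ; u v (suc j) → refl }
    ; *-homo = λ { x u zero → sym (zeroʳ x) ; x u (suc j) → refl }
    }

  δ : Function
  δ zero    = 1#
  δ (suc _) = 0#

  restrict : ℕ → Operator
  restrict p a j = a (p ℕ.^ j)

  restrict-linear : ∀ p → IsLinear (restrict p)
  restrict-linear p = record { cong = λ a≐b j → a≐b (p ℕ.^ j) ; +-homo = λ _ _ _ → refl ; *-homo = λ _ _ _ → refl }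

  restrict-dilate : ∀ {p} .{{_ : NonZero p}} → Prime p → ∀ a → restrict p (dilate p a) ≐ shift (restrict p a)
  restrict-dilate {p} pp a zero    = reflexive (dilate-∤ p a (prime⇒≢1 pp ∘ ∣1⇒≡1))
  restrict-dilate {p} pp a (suc j) = reflexive (≡.trans (≡.cong (dilate p a) (ℕ.*-comm p (p ℕ.^ j))) (dilate-* p a (p ℕ.^ j)))

  module _ {d} (F : Vector Function d) (F-multiplicative : ∀ i → IsCompletelyMultiplicative (F i)) where

    private
      f : Function
      f = foldr _⋆_ ε F

      values : ℕ → Vector Carrier d
      values p i = F i p

      onPrimes-foldr : ∀ P → onPrimes (λ p → Δs (dilate p) (values p)) P f ≐ foldr _⋆_ ε λ i → sieve (F i) P
      onPrimes-foldr zero    n = refl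
      onPrimes-foldr (suc P) n with prime? (suc P)
      ... | yes _ = trans (IsLinear.cong (Δs-linear (dilate-linear (suc P)) (values (suc P))) (onPrimes-foldr P) n)
                      (Δs-foldr-⋆ (suc P) (values (suc P)) (λ i → sieve (F i) P) n)
      ... | no  _ = onPrimes-foldr P n

    -- A divisor other than 1 of some `n ≤ N` has a prime factor at most `P`, so every sieved `F i`
    -- agrees with `ε` on the divisors of `n`, and their convolution agrees with `ε` at `n`.
    summatory-onPrimes : ∀ {N P} → N ℕ.≤ P → onPrimes (λ p → Δs (contract p) (values p)) P (summatory f) N ≈ summatory ε N
    summatory-onPrimes {N} {P} N≤P = begin
      onPrimes (λ p → Δs (contract p) (values p)) P (summatory f) N
        ≈⟨ onPrimes-intertwine {summatory} {λ p → Δs (dilate p) (values p)} {λ p → Δs (contract p) (values p)} summatory-linear (λ p → Δs-linear (contract-linear p) (values p))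
             (λ p _ → Δs-intertwine {summatory} {dilate p} {contract p} summatory-linear (contract-linear p) (λ a M → ∑₁-dilate p M a) (values p)) P f N ⟨
      ∑₁ N (onPrimes (λ p → Δs (dilate p) (values p)) P f)
        ≈⟨ ∑₁-cong N (onPrimes (λ p → Δs (dilate p) (values p)) P f) ε (λ n n≤N → trans (onPrimes-foldr P n)
             (foldr-⋆-unit (λ i → sieve (F i) P) n (λ i → sieve-1 (F-multiplicative i) P) (vanishing (ℕ.≤-trans n≤N N≤P)))) ⟩
      summatory ε N   ∎
      where
      open ≈-Reasoning
      vanishing : ∀ {n} .{{_ : NonZero n}} → n ℕ.≤ P → ∀ i k → k ∣ n → k ≢ 1 → sieve (F i) P k ≈ 0#
      vanishing {n} n≤P i k k∣n k≢1 = sieve-∣ (F-multiplicative i) P pq (ℕ.≤-trans (∣⇒≤ q∣k) (ℕ.≤-trans (∣⇒≤ k∣n) n≤P)) q∣k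
        where
        instance k≢0 = divisor≢0 k∣n
        factor = prime-factor k k≢1
        pq = proj₁ (proj₂ factor)
        q∣k = proj₂ (proj₂ factor)

    -- The Euler product at `p`: the values at the powers of `p` are the coefficients of the inverse
    -- of ∏ᵢ (1 - Fᵢ(p) X). Through this the differences of such values control the difference of
    -- the polynomials.
    Δs-restrict : ∀ {p} .{{_ : NonZero p}} → Prime p → Δs shift (values p) (restrict p f) ≐ δ
    Δs-restrict {p} pp j = begin
      Δs shift (values p) (restrict p f) j         ≈⟨ Δs-intertwine {restrict p} {dilate p} {shift} (restrict-linear p) shift-linear (restrict-dilate pp) (values p) f j ⟨
      Δs (dilate p) (values p) f (p ℕ.^ j)         ≈⟨ Δs-foldr-⋆ p (values p) F (p ℕ.^ j) ⟩
      foldr _⋆_ ε (λ i → Δ (dilate p) (F i p) (F i)) (p ℕ.^ j)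
                                                   ≈⟨ foldr-⋆-unit (λ i → Δ (dilate p) (F i p) (F i)) (p ℕ.^ j)
                                                        (λ i → trans (Δ-dilate-1 p (F i p) (F i) (prime⇒≢1 pp)) (f1≈1 i)) vanishing ⟩
      ε (p ℕ.^ j)                                  ≈⟨ ε-prime-power j ⟩
      δ j                                          ∎
      where
      open ≈-Reasoning
      open module F i = IsCompletelyMultiplicative (F-multiplicative i)
      instance pʲ≢0 = ℕ.m^n≢0 p j
      vanishing : ∀ i k → k ∣ p ℕ.^ j → k ≢ 1 → Δ (dilate p) (F i p) (F i) k ≈ 0#
      vanishing i k k∣pʲ k≢1 = Δ-dilate-∣ p (F i p) (F i) {{divisor≢0 k∣pʲ}} (λ m → homo i p m) (divisor-of-prime-power j pp k∣pʲ k≢1)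
      ε-prime-power : ∀ j → ε (p ℕ.^ j) ≈ δ j
      ε-prime-power zero    = refl
      ε-prime-power (suc j) = reflexive (if-no (p ℕ.^ suc j ℕ.≟ 1) λ pʲ⁺¹≡1 → prime⇒≢1 pp (ℕ.m*n≡1⇒m≡1 p (p ℕ.^ j) pʲ⁺¹≡1))

-- Norm bounds and the exchange of one Euler factor.

module OrderedSums {ℓ} (R : CompleteOrderedField ℓ) where
  open Reals R hiding (zero)
  open OrderedFieldProperties R

  ∑₁-mono : ∀ n f g → (∀ k .{{_ : NonZero k}} → k ℕ.≤ n → f k ≤ g k) → ∑₁ n f ≤ ∑₁ n g
  ∑₁-mono zero    f g f≤g = ≤-refl
  ∑₁-mono (suc n) f g f≤g = +-mono-≤ (f≤g 1 (ℕ.s≤s ℕ.z≤n)) (∑₁-mono n (f ∘ suc) (g ∘ suc) λ k k≤n → f≤g (suc k) (ℕ.s≤s k≤n))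

  ∑₁-nonNeg : ∀ n f → (∀ k .{{_ : NonZero k}} → 0# ≤ f k) → 0# ≤ ∑₁ n f
  ∑₁-nonNeg zero    f 0≤f = ≤-refl
  ∑₁-nonNeg (suc n) f 0≤f = +-nonNeg (0≤f 1) (∑₁-nonNeg n (f ∘ suc) λ k → 0≤f (suc k))

module Normed {ℓ c} (R : CompleteOrderedField ℓ) (K : CommutativeRing c ℓ) where
  open Reals R hiding (zero)
  private module K = CommutativeRing K

  record IsNorm (∣_∣ : K.Carrier → ℝ) : Set (c Level.⊔ ℓ) where
    field
      ∣∣-cong   : ∀ {x y} → x K.≈ y → ∣ x ∣ ≈ ∣ y ∣
      ∣∣-nonNeg : ∀ x → 0# ≤ ∣ x ∣
      ∣0∣≈0     : ∣ K.0# ∣ ≈ 0#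
      ∣-x∣≈∣x∣  : ∀ x → ∣ K.- x ∣ ≈ ∣ x ∣
      triangle  : ∀ x y → ∣ x K.+ y ∣ ≤ ∣ x ∣ + ∣ y ∣
      submult   : ∀ x y → ∣ x K.* y ∣ ≤ ∣ x ∣ * ∣ y ∣

  module NormedOperators {∣_∣ : K.Carrier → ℝ} (isNorm : IsNorm ∣_∣) where
    open IsNorm isNorm
    open OrderedFieldProperties R
    open OrderedSums R
    open IntegerSolver commutativeRing
    private
      module KS = IntegerSolver K
      module ∑K = FiniteSums K
      module ∑ℝ = FiniteSums commutativeRing
    open DirichletConvolution K using (Function; Operator; _≐_; Δ; Δs; IsLinear; Δ-cong; Δ-linear; Δs-linear; Δs-comm)
    open EulerFactors K using (contract; contract-linear; contract-comm; shift; shift-linear; δ)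

    ∣∑₁∣≤ : ∀ n f → ∣ ∑K.∑₁ n f ∣ ≤ ∑₁ n λ k → ∣ f k ∣
    ∣∑₁∣≤ zero    f = ≤-reflexive ∣0∣≈0
    ∣∑₁∣≤ (suc n) f = ≤-trans (triangle _ _) (+-mono-≤ ≤-refl (∣∑₁∣≤ n (f ∘ suc)))

    ∣x-y∣≤ : ∀ x y → ∣ x K.- y ∣ ≤ ∣ x ∣ + ∣ y ∣
    ∣x-y∣≤ x y = ≤-trans (triangle _ _) (+-mono-≤ ≤-refl (≤-reflexive (∣-x∣≈∣x∣ y)))

    unit-submult : ∀ {x} y → ∣ x ∣ ≤ 1# → ∣ x K.* y ∣ ≤ ∣ y ∣
    unit-submult {x} y ∣x∣≤1 = ≤-trans (submult x y) (≤-trans (*-monoˡ-≤ _ (∣∣-nonNeg y) ∣x∣≤1) (≤-reflexive (*-identityˡ _)))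

    -- The value Σ_{j≤d} uⱼ Vʲ T of a polynomial in an operator V, where h j = Vʲ T.
    pairing : ℕ → Function → Function → K.Carrier
    pairing d u h = u 0 K.* h 0 K.+ ∑K.∑₁ d λ j → u j K.* h j

    -- The hypothesis on `u` removes the term of index `suc d` that enters when the degree bound is
    -- raised.
    pairing-shift : ∀ d x u h → u (suc d) K.≈ K.0# →
      pairing (suc d) (Δ shift x u) h K.≈ pairing d u h K.- x K.* pairing d u (h ∘ suc)
    pairing-shift d x u h u≈0 = begin
      (u 0 K.- x K.* K.0#) K.* h 0 K.+ ∑K.∑₁ (suc d) (λ j → Δ shift x u j K.* h j)
        ≈⟨ K.+-cong (KS.solve 3 (λ x u h → (u KS.:- x KS.:* KS.con (+ 0)) KS.:* h KS.:= u KS.:* h) K.refl x (u 0) (h 0))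
            (K.trans (∑K.∑₁-cong (suc d) (λ j → Δ shift x u j K.* h j) (λ j → uh j K.+ (K.- x) K.* (shift u j K.* h j)) λ j _ →
                KS.solve 4 (λ x u u′ h → (u KS.:- x KS.:* u′) KS.:* h KS.:= u KS.:* h KS.:+ (KS.:- x) KS.:* (u′ KS.:* h)) K.refl x (u j) (shift u j) (h j))
            (K.trans (∑K.∑₁-+ (suc d) uh (λ j → (K.- x) K.* (shift u j K.* h j)))
              (K.+-cong (∑K.∑₁-suc d uh) (∑K.∑₁-* (suc d) (K.- x) (λ j → shift u j K.* h j))))) ⟩
      uh 0 K.+ ((∑K.∑₁ d uh K.+ u (suc d) K.* h (suc d)) K.+ (K.- x) K.* pairing d u (h ∘ suc))
        ≈⟨ K.+-congˡ (K.+-congʳ (K.+-congˡ (K.*-congʳ u≈0))) ⟩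
      uh 0 K.+ ((∑K.∑₁ d uh K.+ K.0# K.* h (suc d)) K.+ (K.- x) K.* pairing d u (h ∘ suc))
        ≈⟨ KS.solve 5 (λ a b c x p → a KS.:+ ((b KS.:+ KS.con (+ 0) KS.:* c) KS.:+ (KS.:- x) KS.:* p) KS.:= (a KS.:+ b) KS.:- x KS.:* p) K.refl
             (uh 0) (∑K.∑₁ d uh) (h (suc d)) x (pairing d u (h ∘ suc)) ⟩
      pairing d u h K.- x K.* pairing d u (h ∘ suc)   ∎
      where
      open import Relation.Binary.Reasoning.Setoid K.setoid
      uh = λ j → u j K.* h j

    Δs-degree : ∀ {d} (xs : Vector K.Carrier d) j → d ℕ.< j → Δs shift xs δ j K.≈ K.0#
    Δs-degree {zero}  xs (suc j) _ = K.refl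
    Δs-degree {suc d} xs (suc j) (ℕ.s≤s d<j) = K.trans
      (K.+-cong (Δs-degree (tail xs) (suc j) (ℕ.m<n⇒m<1+n d<j)) (K.-‿cong (K.*-congˡ (Δs-degree (tail xs) j d<j))))
      (KS.solve 1 (λ x → KS.con (+ 0) KS.:- x KS.:* KS.con (+ 0) KS.:= KS.con (+ 0)) K.refl (head xs))

    module _ (p : ℕ) .{{p≢0 : NonZero p}} where
      private
        V = contract p
        V-linear = contract-linear p
        orbit : Function → ℕ → Function
        orbit T N j = T (ℕ._/_ N (p ℕ.^ j) {{ℕ.m^n≢0 p j}})

      -- Expands the product of operators as an exact polynomial of degree at most `d` in V_p, which
      -- is what confines the comparison to the exponents `j ≤ d`.
      Δs-contract : ∀ {d} (xs : Vector K.Carrier d) T N → Δs V xs T N K.≈ pairing d (Δs shift xs δ) (orbit T N)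
      Δs-contract {zero}  xs T N = K.sym (K.trans (K.+-identityʳ _) (K.trans (K.*-identityˡ _) (K.reflexive (≡.cong T (ℕ.n/1≡n N)))))
      Δs-contract {suc d} xs T N = begin
        Δ V x (Δs V xs′ T) N                                                ≈⟨ Δ-cong V-linear K.refl (Δs-contract xs′ T) N ⟩
        pairing d u (orbit T N) K.- x K.* pairing d u (orbit T (N ℕ./ p))   ≈⟨ K.+-congˡ (K.-‿cong (K.*-congˡ (K.+-cong (K.*-congˡ (orbit-suc 0))
                                                                                  (∑K.∑₁-cong d (λ j → u j K.* orbit T (N ℕ./ p) j) (λ j → u j K.* orbit T N (suc j)) λ j _ → K.*-congˡ (orbit-suc j))))) ⟩
        pairing d u (orbit T N) K.- x K.* pairing d u (orbit T N ∘ suc)     ≈⟨ pairing-shift d x u (orbit T N) (Δs-degree xs′ (suc d) (ℕ.n<1+n d)) ⟨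
        pairing (suc d) (Δ shift x u) (orbit T N)                           ∎
        where
        open import Relation.Binary.Reasoning.Setoid K.setoid
        x = head xs
        xs′ = tail xs
        u = Δs shift xs′ δ
        orbit-suc : ∀ j → orbit T (N ℕ./ p) j K.≈ orbit T N (suc j)
        orbit-suc j = K.reflexive (≡.cong T (ℕ.m/n/o≡m/[n*o] N p (p ℕ.^ j) {{p≢0}} {{ℕ.m^n≢0 p j}} {{ℕ.m^n≢0 p (suc j)}}))

    Δs-shift-0 : ∀ {n} (xs : Vector K.Carrier n) u → Δs shift xs u 0 K.≈ u 0
    Δs-shift-0 {zero}  xs u = K.refl
    Δs-shift-0 {suc n} xs u = K.trans (KS.solve 2 (λ u x → u KS.:- x KS.:* KS.con (+ 0) KS.:= u) K.refl (Δs shift (tail xs) u 0) (head xs)) (Δs-shift-0 (tail xs) u)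

    -- A weighted ℓ¹ norm without the index 0: it is applied to differences of series with the same
    -- constant term.
    weightedSum : (ℕ → ℝ) → ℕ → Function → ℝ
    weightedSum ω d u = ∑₁ d λ j → ∣ u j ∣ * ω j

    weightedSum-cong : ∀ ω d {u v} → u ≐ v → weightedSum ω d u ≈ weightedSum ω d v
    weightedSum-cong ω d {u} {v} u≐v = ∑ℝ.∑₁-cong d (λ j → ∣ u j ∣ * ω j) (λ j → ∣ v j ∣ * ω j) λ j _ → *-congʳ (∣∣-cong (u≐v j))

    module _ (ω : ℕ → ℝ) (ω-nonNeg : ∀ j → 0# ≤ ω j) (ω-anti : ∀ j → ω (suc j) ≤ ω j) (d : ℕ) where
      private
        ∥_∥ : Function → ℝ
        ∥_∥ = weightedSum ω d

      -- Each coefficient moves to a smaller weight, the last one leaves the range, and the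
      -- vanishing constant term contributes nothing at index 1.
      weightedSum-shift : ∀ u → u 0 K.≈ K.0# → ∥ shift u ∥ ≤ ∥ u ∥
      weightedSum-shift u u0≈0 = go d
        where
        open ≤-Reasoning
        term : ℕ → ℝ
        term j = ∣ u j ∣ * ω j
        go : ∀ n → ∑₁ n (λ j → ∣ shift u j ∣ * ω j) ≤ ∑₁ n term
        go zero    = ≤-refl
        go (suc n) = begin
          ∣ u 0 ∣ * ω 1 + ∑₁ n (λ j → ∣ u j ∣ * ω (suc j))   ≤⟨ +-mono-≤ (≤-reflexive (trans (*-congʳ (trans (∣∣-cong u0≈0) ∣0∣≈0)) (zeroˡ _)))
                                                                 (∑₁-mono n (λ j → ∣ u j ∣ * ω (suc j)) term λ j _ → *-monoʳ-≤ _ (∣∣-nonNeg (u j)) (ω-anti j)) ⟩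
          0# + ∑₁ n term                                     ≈⟨ +-comm _ _ ⟩
          ∑₁ n term + 0#                                     ≤⟨ +-mono-≤ ≤-refl (*-nonNeg (∣∣-nonNeg _) (ω-nonNeg _)) ⟩
          ∑₁ n term + term (suc n)                           ≈⟨ ∑ℝ.∑₁-suc n term ⟨
          ∑₁ (suc n) term                                    ∎

      weightedSum-Δ : ∀ x u → ∣ x ∣ ≤ 1# → u 0 K.≈ K.0# → ∥ Δ shift x u ∥ ≤ (1# + 1#) * ∥ u ∥
      weightedSum-Δ x u ∣x∣≤1 u0≈0 = begin
        ∥ Δ shift x u ∥                                    ≤⟨ ∑₁-mono d (λ j → ∣ Δ shift x u j ∣ * ω j) (λ j → ∣ u j ∣ * ω j + ∣ shift u j ∣ * ω j) (λ j _ →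
            ≤-trans (*-monoˡ-≤ (ω j) (ω-nonNeg j) (≤-trans (∣x-y∣≤ (u j) _) (+-mono-≤ ≤-refl (unit-submult (shift u j) ∣x∣≤1)))) (≤-reflexive (distribʳ _ _ _))) ⟩
        ∑₁ d (λ j → ∣ u j ∣ * ω j + ∣ shift u j ∣ * ω j)             ≈⟨ ∑ℝ.∑₁-+ d (λ j → ∣ u j ∣ * ω j) (λ j → ∣ shift u j ∣ * ω j) ⟩
        ∥ u ∥ + ∥ shift u ∥                        ≤⟨ +-mono-≤ ≤-refl (weightedSum-shift u u0≈0) ⟩
        ∥ u ∥ + ∥ u ∥                                ≈⟨ solve 1 (λ w → w :+ w := (con (+ 1) :+ con (+ 1)) :* w) refl ∥ u ∥ ⟩
        (1# + 1#) * ∥ u ∥                                    ∎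
        where open ≤-Reasoning

      weightedSum-Δs : ∀ {n} (xs : Vector K.Carrier n) u → (∀ i → ∣ xs i ∣ ≤ 1#) → u 0 K.≈ K.0# →
                       ∥ Δs shift xs u ∥ ≤ (1# + 1#) ^ n * ∥ u ∥
      weightedSum-Δs {zero}  xs u ∣xs∣≤1 u0≈0 = ≤-reflexive (sym (*-identityˡ _))
      weightedSum-Δs {suc n} xs u ∣xs∣≤1 u0≈0 = begin
        ∥ Δ shift (head xs) (Δs shift (tail xs) u) ∥ ≤⟨ weightedSum-Δ (head xs) (Δs shift (tail xs) u) (∣xs∣≤1 zero) (K.trans (Δs-shift-0 (tail xs) u) u0≈0) ⟩
        (1# + 1#) * ∥ Δs shift (tail xs) u ∥           ≤⟨ *-monoʳ-≤ _ (+-nonNeg 0≤1 0≤1) (weightedSum-Δs (tail xs) u (∣xs∣≤1 ∘ suc) u0≈0) ⟩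
        (1# + 1#) * ((1# + 1#) ^ n * ∥ u ∥)              ≈⟨ *-assoc _ _ _ ⟨
        (1# + 1#) ^ suc n * ∥ u ∥                        ∎
        where open ≤-Reasoning

    -- The two powers of 2 bound multiplication by the polynomials A and B, where each linear factor
    -- at most doubles the norm; `ρ ^ d` bounds the inverse of B.
    κ : ℝ → ℕ → ℝ
    κ ρ d = (1# + 1#) ^ d * (1# + 1#) ^ d * ρ ^ d

    κ-nonNeg : ∀ {ρ} d → 0# ≤ ρ → 0# ≤ κ ρ d
    κ-nonNeg d 0≤ρ = *-nonNeg (*-nonNeg (^-nonNeg d (+-nonNeg 0≤1 0≤1)) (^-nonNeg d (+-nonNeg 0≤1 0≤1))) (^-nonNeg d 0≤ρ)

    module _ (v : ℕ → ℝ) (v-nonNeg : ∀ N → 0# ≤ v N) where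

      -- `T 0` has to vanish because 0 is fixed by division by `p`, while every other argument
      -- eventually falls to 0; this makes Neumann series finite. The condition is separate from the
      -- bound since `IsNorm` does not include definiteness.
      record Bounded (C : ℝ) (T : Function) : Set ℓ where
        constructor bounded
        field
          T0≈0  : T 0 K.≈ K.0#
          bound : ∀ N → ∣ T N ∣ ≤ C * v N

      module _ (w ρ : ℝ) (1≤ρ : 1# ≤ ρ) (1+ρw≤ρ : 1# + ρ * w ≤ ρ) where

        module _ (p : ℕ) .{{p≢0 : NonZero p}} (pp : Prime p) (v-contract : ∀ N → v (N ℕ./ p) ≤ w * v N) where
          private
            V = contract p
            V-linear = contract-linear p

            0/p≡0 : 0 ℕ./ p ≡ 0
            0/p≡0 = ℕ.0/n≡0 p

            N/p≤k : ∀ {N k} → N ℕ.≤ suc k → N ℕ./ p ℕ.≤ k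
            N/p≤k {zero}  _     = ≡.subst (ℕ._≤ _) (≡.sym 0/p≡0) ℕ.z≤n
            N/p≤k {suc N} N≤1+k = ℕ.≤-pred (ℕ.≤-trans (ℕ.m/n<m (suc N) p {{_}} {{_}} (ℕ.nonTrivial⇒n>1 p {{prime⇒nonTrivial pp}})) N≤1+k)

            -- The partial sums Σ_{j≤k} xʲ Vʲ T of the Neumann series, constant for k ≥ N.
            neumann : K.Carrier → Function → ℕ → Function
            neumann x T zero    = T
            neumann x T (suc k) = λ N → T N K.+ x K.* neumann x T k (N ℕ./ p)

            0+x0≈0 : ∀ x → K.0# K.+ x K.* K.0# K.≈ K.0#
            0+x0≈0 x = KS.solve 1 (λ x → KS.con (+ 0) KS.:+ x KS.:* KS.con (+ 0) KS.:= KS.con (+ 0)) K.refl x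

          -- The inequality `1# + ρ * w ≤ ρ` is the fixed-point form of the geometric bound Σ wᵏ ≤
          -- ρ, so the estimate of the partial sums is a plain induction.
          Δ-inverse : ∀ {C T} x → 0# ≤ C → ∣ x ∣ ≤ 1# → Bounded C T → ∃ λ W → Bounded (C * ρ) W × Δ V x W ≐ T
          Δ-inverse {C} {T} x 0≤C ∣x∣≤1 (bounded T0≈0 T-bound) = W , bounded T0≈0 (λ N → W-bound N N) , ΔW≐T
            where
            W : Function
            -- Division by `p` lowers a positive argument by at least 1, so at `N` the partial sum
            -- with index `N` is already the full series.
            W N = neumann x T N N

            neumann-suc : ∀ k N → N ℕ.≤ k → neumann x T (suc k) N K.≈ neumann x T k N
            neumann-suc zero    zero ℕ.z≤n = begin
              T 0 K.+ x K.* T (0 ℕ./ p)   ≡⟨ ≡.cong (λ M → T 0 K.+ x K.* T M) 0/p≡0 ⟩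
              T 0 K.+ x K.* T 0           ≈⟨ K.+-cong T0≈0 (K.*-congˡ T0≈0) ⟩
              K.0# K.+ x K.* K.0#         ≈⟨ 0+x0≈0 x ⟩
              K.0#                        ≈⟨ T0≈0 ⟨
              T 0                         ∎
              where open import Relation.Binary.Reasoning.Setoid K.setoid
            neumann-suc (suc k) N N≤1+k = K.+-congˡ (K.*-congˡ (neumann-suc k (N ℕ./ p) (N/p≤k N≤1+k)))

            neumann-≥ : ∀ {k N} → N ℕ.≤′ k → neumann x T k N K.≈ W N
            neumann-≥ ℕ.≤′-refl                = K.refl
            neumann-≥ (ℕ.≤′-step {k} N≤′k) = K.trans (neumann-suc k _ (ℕ.≤′⇒≤ N≤′k)) (neumann-≥ N≤′k)

            ΔW≐T : Δ V x W ≐ T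
            ΔW≐T N = begin
              W N K.- x K.* W (N ℕ./ p)                              ≈⟨ K.+-congʳ (neumann-suc N N ℕ.≤-refl) ⟨
              T N K.+ x K.* neumann x T N (N ℕ./ p) K.- x K.* W (N ℕ./ p)
                ≈⟨ K.+-congʳ (K.+-congˡ (K.*-congˡ (neumann-≥ (ℕ.≤⇒≤′ (ℕ.m/n≤m N p))))) ⟩
              T N K.+ x K.* W (N ℕ./ p) K.- x K.* W (N ℕ./ p)        ≈⟨ KS.solve 2 (λ t y → t KS.:+ y KS.:- y KS.:= t) K.refl (T N) (x K.* W (N ℕ./ p)) ⟩
              T N                                                    ∎
              where open import Relation.Binary.Reasoning.Setoid K.setoid

            W-bound : ∀ k N → ∣ neumann x T k N ∣ ≤ C * ρ * v N
            W-bound zero    N = begin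
              ∣ T N ∣         ≤⟨ T-bound N ⟩
              C * v N         ≤⟨ *-monoˡ-≤ _ (v-nonNeg N) (≤-trans (≤-reflexive (sym (*-identityʳ C))) (*-monoʳ-≤ C 0≤C 1≤ρ)) ⟩
              C * ρ * v N     ∎
              where open ≤-Reasoning
            W-bound (suc k) N = begin
              ∣ T N K.+ x K.* neumann x T k (N ℕ./ p) ∣      ≤⟨ triangle _ _ ⟩
              ∣ T N ∣ + ∣ x K.* neumann x T k (N ℕ./ p) ∣    ≤⟨ +-mono-≤ (T-bound N) (≤-trans (unit-submult _ ∣x∣≤1) (W-bound k (N ℕ./ p))) ⟩
              C * v N + C * ρ * v (N ℕ./ p)                  ≤⟨ +-mono-≤ ≤-refl (*-monoʳ-≤ _ (*-nonNeg 0≤C 0≤ρ) (v-contract N)) ⟩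
              C * v N + C * ρ * (w * v N)                    ≈⟨ solve 4 (λ c v r w → c :* v :+ c :* r :* (w :* v) := c :* (con (+ 1) :+ r :* w) :* v) refl C (v N) ρ w ⟩
              C * (1# + ρ * w) * v N                         ≤⟨ *-monoˡ-≤ _ (v-nonNeg N) (*-monoʳ-≤ C 0≤C 1+ρw≤ρ) ⟩
              C * ρ * v N                                    ∎
              where
              open ≤-Reasoning
              0≤ρ = ≤-trans 0≤1 1≤ρ

          Δs-inverse : ∀ {d C T} (xs : Vector K.Carrier d) → 0# ≤ C → (∀ i → ∣ xs i ∣ ≤ 1#) → Bounded C T →
                       ∃ λ W → Bounded (C * ρ ^ d) W × Δs V xs W ≐ T
          Δs-inverse {zero}  {C} {T} xs 0≤C ∣xs∣≤1 (bounded T0≈0 T-bound) =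
            T , bounded T0≈0 (λ N → ≤-trans (T-bound N) (*-monoˡ-≤ _ (v-nonNeg N) (≤-reflexive (sym (*-identityʳ C))))) , λ _ → K.refl
          Δs-inverse {suc d} {C} {T} xs 0≤C ∣xs∣≤1 T-bounded =
            let W₁ , W₁-bounded , ΔW₁≐T = Δ-inverse (head xs) 0≤C (∣xs∣≤1 zero) T-bounded
                W , bounded W0≈0 W-bound , ΔsW≐W₁ = Δs-inverse (tail xs) (*-nonNeg 0≤C (≤-trans 0≤1 1≤ρ)) (∣xs∣≤1 ∘ suc) W₁-bounded
            in W , bounded W0≈0 (λ N → ≤-trans (W-bound N) (*-monoˡ-≤ _ (v-nonNeg N) (≤-reflexive (*-assoc _ _ _)))) ,
               λ N → K.trans (IsLinear.cong (Δ-linear V-linear (head xs)) {Δs V (tail xs) W} {W₁} ΔsW≐W₁ N) (ΔW₁≐T N)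

          module _ (ω : ℕ → ℝ) (ω-nonNeg : ∀ j → 0# ≤ ω j) (ω-anti : ∀ j → ω (suc j) ≤ ω j)
                   (v-orbit : ∀ j .{{_ : NonZero j}} N → v (ℕ._/_ N (p ℕ.^ j) {{ℕ.m^n≢0 p j}}) ≤ ω j * v N) where

            -- With A = ∏ᵢ (1 - xᵢ V), B = ∏ᵢ (1 - yᵢ V) and W = B⁻¹ T the solution is
            -- U = A W = T + (A - B) W, and A - B = A B (G - F) for F = A⁻¹, G = B⁻¹.
            exchange : ∀ {d C T} (xs ys : Vector K.Carrier d) (F G : Function) → 0# ≤ C →
              (∀ i → ∣ xs i ∣ ≤ 1#) → (∀ i → ∣ ys i ∣ ≤ 1#) →
              Δs shift xs F ≐ δ → Δs shift ys G ≐ δ → F 0 K.≈ G 0 → Bounded C T →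
              ∃ λ U → Bounded (C * (1# + κ ρ d * weightedSum ω d (λ j → F j K.- G j))) U × Δs V ys U ≐ Δs V xs T
            exchange {d} {C} {T} xs ys F G 0≤C ∣xs∣≤1 ∣ys∣≤1 AF≐δ BG≐δ F0≈G0 T-bounded@(bounded T0≈0 T-bound) =
              U , bounded U0≈0 U-bound , BU≐AT
              where
              ∥_∥ : Function → ℝ
              ∥_∥ = weightedSum ω d
              inverse = Δs-inverse ys 0≤C ∣ys∣≤1 T-bounded
              W = proj₁ inverse
              W0≈0 = Bounded.T0≈0 (proj₁ (proj₂ inverse))
              W-bound = Bounded.bound (proj₁ (proj₂ inverse))
              BW≐T = proj₂ (proj₂ inverse)
              U = Δs V xs W
              A = Δs shift xs δ
              B = Δs shift ys δ
              A-B = λ j → A j K.- B j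

              BU≐AT : Δs V ys U ≐ Δs V xs T
              BU≐AT N = K.trans (Δs-comm {V} {V} V-linear V-linear (λ _ _ → K.refl) ys xs W N)
                (IsLinear.cong (Δs-linear V-linear xs) {Δs V ys W} {T} BW≐T N)

              A-B≐ABE : A-B ≐ Δs shift xs (Δs shift ys λ j → G j K.- F j)
              A-B≐ABE j = begin
                A j K.- B j                                                     ≈⟨ K.+-cong (AL.cong {Δs shift ys G} BG≐δ j) (K.-‿cong (BL.cong {Δs shift xs F} AF≐δ j)) ⟨
                Δs shift xs (Δs shift ys G) j K.- Δs shift ys (Δs shift xs F) j ≈⟨ K.+-congˡ (K.-‿cong (Δs-comm shift-linear shift-linear (λ _ _ → K.refl) ys xs F j)) ⟩
                Δs shift xs (Δs shift ys G) j K.- Δs shift xs (Δs shift ys F) j ≈⟨ minus-homo (Δs-linear shift-linear xs) (Δs shift ys G) (Δs shift ys F) j ⟨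
                Δs shift xs (λ k → Δs shift ys G k K.- Δs shift ys F k) j       ≈⟨ AL.cong {Δs shift ys (λ k → G k K.- F k)} (minus-homo (Δs-linear shift-linear ys) G F) j ⟨
                Δs shift xs (Δs shift ys λ k → G k K.- F k) j                   ∎
                where
                open import Relation.Binary.Reasoning.Setoid K.setoid
                module AL = IsLinear (Δs-linear shift-linear xs)
                module BL = IsLinear (Δs-linear shift-linear ys)
                minus-homo : ∀ {L} → IsLinear L → ∀ a b → L (λ k → a k K.- b k) ≐ λ k → L a k K.- L b k
                minus-homo {L} L-linear a b k = begin
                  L (λ k → a k K.- b k) k                    ≈⟨ L.cong (λ k → K.+-congˡ (-1* (b k))) k ⟩
                  L (λ k → a k K.+ (K.- K.1#) K.* b k) k     ≈⟨ L.+-homo a _ k ⟩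
                  L a k K.+ L (λ k → (K.- K.1#) K.* b k) k   ≈⟨ K.+-congˡ (L.*-homo (K.- K.1#) b k) ⟩
                  L a k K.+ (K.- K.1#) K.* L b k             ≈⟨ K.+-congˡ (-1* (L b k)) ⟨
                  L a k K.- L b k                            ∎
                  where
                  module L = IsLinear L-linear
                  -1* : ∀ y → K.- y K.≈ (K.- K.1#) K.* y
                  -1* y = KS.solve 1 (λ y → KS.:- y KS.:= (KS.:- KS.con (+ 1)) KS.:* y) K.refl y

              G0-F0≈0 : G 0 K.- F 0 K.≈ K.0#
              G0-F0≈0 = K.trans (K.+-congˡ (K.-‿cong F0≈G0)) (K.-‿inverseʳ _)

              A-B0≈0 : A-B 0 K.≈ K.0#
              A-B0≈0 = K.trans (K.+-cong (Δs-shift-0 xs δ) (K.-‿cong (Δs-shift-0 ys δ))) (K.-‿inverseʳ _)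

              ∥A-B∥≤ : ∥ A-B ∥ ≤ (1# + 1#) ^ d * (1# + 1#) ^ d * ∥ (λ j → F j K.- G j) ∥
              ∥A-B∥≤ = begin
                ∥ A-B ∥                                                       ≈⟨ weightedSum-cong ω d {A-B} A-B≐ABE ⟩
                ∥ Δs shift xs (Δs shift ys G-F) ∥                             ≤⟨ weightedSum-Δs ω ω-nonNeg ω-anti d xs _ ∣xs∣≤1 (K.trans (Δs-shift-0 ys G-F) G0-F0≈0) ⟩
                (1# + 1#) ^ d * ∥ Δs shift ys G-F ∥                           ≤⟨ *-monoʳ-≤ _ (^-nonNeg d (+-nonNeg 0≤1 0≤1)) (weightedSum-Δs ω ω-nonNeg ω-anti d ys G-F ∣ys∣≤1 G0-F0≈0) ⟩
                (1# + 1#) ^ d * ((1# + 1#) ^ d * ∥ G-F ∥)                     ≈⟨ *-assoc _ _ _ ⟨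
                (1# + 1#) ^ d * (1# + 1#) ^ d * ∥ G-F ∥                       ≈⟨ *-congˡ (∑ℝ.∑₁-cong d (λ j → ∣ G-F j ∣ * ω j) (λ j → ∣ F j K.- G j ∣ * ω j) λ j _ →
                                                                                  *-congʳ (trans (∣∣-cong (KS.solve 2 (λ g f → g KS.:- f KS.:= KS.:- (f KS.:- g)) K.refl (G j) (F j))) (∣-x∣≈∣x∣ _))) ⟩
                (1# + 1#) ^ d * (1# + 1#) ^ d * ∥ (λ j → F j K.- G j) ∥       ∎
                where
                open ≤-Reasoning
                G-F = λ j → G j K.- F j

              D : ℕ → ℝ
              D N = C * ρ ^ d * v N

              -- Writing A = B + (A - B), the part of B gives back `B W = T`, and A - B has no
              -- constant term because both polynomials start with 1.
              U≈ : ∀ N → U N K.≈ T N K.+ ∑K.∑₁ d (λ j → A-B j K.* W (ℕ._/_ N (p ℕ.^ j) {{ℕ.m^n≢0 p j}}))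
              U≈ N = begin
                U N                                                             ≈⟨ Δs-contract p xs W N ⟩
                pairing d A h                                                   ≈⟨ split ⟩
                pairing d B h K.+ pairing d A-B h                               ≈⟨ K.+-congʳ (Δs-contract p ys W N) ⟨
                Δs V ys W N K.+ pairing d A-B h                                 ≈⟨ K.+-cong (BW≐T N) (K.trans (K.+-congʳ (K.trans (K.*-congʳ A-B0≈0) (K.zeroˡ _))) (K.+-identityˡ _)) ⟩
                T N K.+ ∑K.∑₁ d (λ j → A-B j K.* h j)                           ∎
                where
                open import Relation.Binary.Reasoning.Setoid K.setoid
                h = λ j → W (ℕ._/_ N (p ℕ.^ j) {{ℕ.m^n≢0 p j}})
                a≈b+[a-b] : ∀ j → A j K.* h j K.≈ B j K.* h j K.+ A-B j K.* h j
                a≈b+[a-b] j = KS.solve 3 (λ a b h → a KS.:* h KS.:= b KS.:* h KS.:+ (a KS.:- b) KS.:* h) K.refl (A j) (B j) (h j)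
                split : pairing d A h K.≈ pairing d B h K.+ pairing d A-B h
                split = begin
                  A 0 K.* h 0 K.+ ∑K.∑₁ d (λ j → A j K.* h j)
                    ≈⟨ K.+-cong (a≈b+[a-b] 0) (K.trans (∑K.∑₁-cong d (λ j → A j K.* h j) (λ j → B j K.* h j K.+ A-B j K.* h j) λ j _ → a≈b+[a-b] j)
                         (∑K.∑₁-+ d (λ j → B j K.* h j) (λ j → A-B j K.* h j))) ⟩
                  (B 0 K.* h 0 K.+ A-B 0 K.* h 0) K.+ (∑K.∑₁ d (λ j → B j K.* h j) K.+ ∑K.∑₁ d (λ j → A-B j K.* h j))
                    ≈⟨ KS.solve 4 (λ a b c d → (a KS.:+ b) KS.:+ (c KS.:+ d) KS.:= (a KS.:+ c) KS.:+ (b KS.:+ d)) K.refl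
                         (B 0 K.* h 0) (A-B 0 K.* h 0) (∑K.∑₁ d (λ j → B j K.* h j)) (∑K.∑₁ d (λ j → A-B j K.* h j)) ⟩
                  pairing d B h K.+ pairing d A-B h ∎

              U-bound : ∀ N → ∣ U N ∣ ≤ C * (1# + κ ρ d * ∥ (λ j → F j K.- G j) ∥) * v N
              U-bound N = begin
                ∣ U N ∣                                                  ≈⟨ ∣∣-cong (U≈ N) ⟩
                ∣ T N K.+ ∑K.∑₁ d (λ j → A-B j K.* h j) ∣                ≤⟨ triangle _ _ ⟩
                ∣ T N ∣ + ∣ ∑K.∑₁ d (λ j → A-B j K.* h j) ∣              ≤⟨ +-mono-≤ (T-bound N) (∣∑₁∣≤ d (λ j → A-B j K.* h j)) ⟩
                C * v N + ∑₁ d (λ j → ∣ A-B j K.* h j ∣)                 ≤⟨ +-mono-≤ ≤-refl (∑₁-mono d (λ j → ∣ A-B j K.* h j ∣) (λ j → D N * (∣ A-B j ∣ * ω j)) λ j _ → term≤ j) ⟩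
                C * v N + ∑₁ d (λ j → D N * (∣ A-B j ∣ * ω j))           ≈⟨ +-congˡ (∑ℝ.∑₁-* d (D N) (λ j → ∣ A-B j ∣ * ω j)) ⟩
                C * v N + D N * ∥ A-B ∥                                  ≤⟨ +-mono-≤ ≤-refl (*-monoʳ-≤ _ 0≤D ∥A-B∥≤) ⟩
                C * v N + D N * ((1# + 1#) ^ d * (1# + 1#) ^ d * E)      ≈⟨ solve 6 (λ c v r t s e → c :* v :+ c :* r :* v :* (t :* s :* e) := c :* (con (+ 1) :+ t :* s :* r :* e) :* v) refl
                                                                              C (v N) (ρ ^ d) ((1# + 1#) ^ d) ((1# + 1#) ^ d) E ⟩
                C * (1# + κ ρ d * E) * v N                                 ∎
                where
                open ≤-Reasoning
                E = ∥ (λ j → F j K.- G j) ∥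
                h = λ j → W (ℕ._/_ N (p ℕ.^ j) {{ℕ.m^n≢0 p j}})
                0≤Cρ^d = *-nonNeg 0≤C (^-nonNeg d (≤-trans 0≤1 1≤ρ))
                0≤D = *-nonNeg 0≤Cρ^d (v-nonNeg N)
                term≤ : ∀ j .{{_ : NonZero j}} → ∣ A-B j K.* h j ∣ ≤ D N * (∣ A-B j ∣ * ω j)
                term≤ j = begin
                  ∣ A-B j K.* h j ∣                                      ≤⟨ submult _ _ ⟩
                  ∣ A-B j ∣ * ∣ h j ∣                                    ≤⟨ *-monoʳ-≤ _ (∣∣-nonNeg _) (≤-trans (W-bound _) (*-monoʳ-≤ _ 0≤Cρ^d (v-orbit j N))) ⟩
                  ∣ A-B j ∣ * (C * ρ ^ d * (ω j * v N))                  ≈⟨ solve 4 (λ a c o v → a :* (c :* (o :* v)) := c :* v :* (a :* o)) refl ∣ A-B j ∣ (C * ρ ^ d) (ω j) (v N) ⟩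
                  D N * (∣ A-B j ∣ * ω j)                                ∎

              U0≈0 : U 0 K.≈ K.0#
              U0≈0 = K.trans (U≈ 0) (K.trans (K.+-cong T0≈0 (∑K.∑₁-zero d (λ j → A-B j K.* W (ℕ._/_ 0 (p ℕ.^ j) {{ℕ.m^n≢0 p j}})) λ j _ →
                K.trans (K.*-congˡ (K.trans (K.reflexive (≡.cong W (ℕ.0/n≡0 (p ℕ.^ j) {{ℕ.m^n≢0 p j}}))) W0≈0)) (K.zeroʳ _))) (K.+-identityˡ _))

-- Bounded products from bounded sums.

module InfiniteProducts {ℓ} (R : CompleteOrderedField ℓ) where
  open Reals R hiding (zero)
  open OrderedFieldProperties R
  open OrderedSums R
  open FiniteSums commutativeRing using (∑₁-suc; ∑₁-*; ∑₁-cong)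
  open IntegerSolver commutativeRing
  open ≤-Reasoning

  ∏[1+_] : (ℕ → ℝ) → ℕ → ℝ
  ∏[1+ s ] zero    = 1#
  ∏[1+ s ] (suc N) = ∏[1+ s ] N * (1# + s (suc N))

  module _ {s : ℕ → ℝ} (s-nonNeg : ∀ n → 0# ≤ s n) where

    ∏-nonNeg : ∀ N → 0# ≤ ∏[1+ s ] N
    ∏-nonNeg zero    = 0≤1
    ∏-nonNeg (suc N) = *-nonNeg (∏-nonNeg N) (+-nonNeg 0≤1 (s-nonNeg (suc N)))

    -- An elementary substitute for comparison with the exponential, useful while the sum stays
    -- below 1. With σ the sum so far and t the new term, the step is (1 + t) (1 - σ - t) ≤ 1 - σ.
    ∏*[1-∑]≤1 : ∀ N → ∏[1+ s ] N * (1# - ∑₁ N s) ≤ 1#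
    ∏*[1-∑]≤1 zero    = ≤-reflexive (solve 0 (con (+ 1) :* (con (+ 1) :- con (+ 0)) := con (+ 1)) refl)
    ∏*[1-∑]≤1 (suc N) = begin
      ∏ * (1# + t) * (1# - ∑₁ (suc N) s)           ≈⟨ *-congˡ (+-congˡ (-‿cong (∑₁-suc N s))) ⟩
      ∏ * (1# + t) * (1# - (σ + t))                ≤⟨ ≤-by (*-nonNeg (∏-nonNeg N) (+-nonNeg (*-nonNeg (∑₁-nonNeg N s λ n → s-nonNeg n) (s-nonNeg (suc N))) (x²-nonNeg t)))
                                                       (solve 3 (λ p t σ → p :* (con (+ 1) :+ t) :* (con (+ 1) :- (σ :+ t)) :+ p :* (σ :* t :+ t :* t) := p :* (con (+ 1) :- σ)) refl ∏ t σ) ⟩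
      ∏ * (1# - σ)                                 ≤⟨ ∏*[1-∑]≤1 N ⟩
      1#                                           ∎
      where
      ∏ = ∏[1+ s ] N
      σ = ∑₁ N s
      t = s (suc N)

  -- Bernoulli's inequality replaces s by s / m, whose sum is at most 1 / 2 for large m.
  ∏-bounded : ∀ {s} b → (∀ n → 0# ≤ s n) → (∀ N → ∑₁ N s ≤ b) → ¬ ¬ ∃ λ E → 0# ≤ E × ∀ N → ∏[1+ s ] N ≤ E
  ∏-bounded {s} b s-nonNeg ∑s≤b unbounded = archimedean (b + b) λ (k , 2b≤k) →
    unbounded (scaled-bound (suc k) (≤-trans 2b≤k (fromℕ-mono (ℕ.n≤1+n k))))
    where
    scaled-bound : ∀ m .{{_ : NonZero m}} → b + b ≤ fromℕ m → ∃ λ E → 0# ≤ E × ∀ N → ∏[1+ s ] N ≤ E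
    -- The product for `t = s / m` is at most 2, and its `m`th power dominates the product for `s`.
    scaled-bound m 2b≤m = (1# + 1#) ^ m , ^-nonNeg m (+-nonNeg 0≤1 0≤1) ,
      λ N → ≤-trans (∏s≤∏t^m N) (^-monoˡ-≤ m (∏-nonNeg t-nonNeg N) (∏t≤2 N))
      where
      t : ℕ → ℝ
      t n = s n / fromℕ m
      0<m = fromℕ-pos m
      mt≈s : ∀ n → fromℕ m * t n ≈ s n
      mt≈s n = trans (*-comm _ _) (⁻¹*-cancelʳ 0<m)
      t-nonNeg : ∀ n → 0# ≤ t n
      t-nonNeg n = *-nonNeg (s-nonNeg n) (⁻¹-nonNeg 0<m)
      m∑t≈∑s : ∀ N → fromℕ m * ∑₁ N t ≈ ∑₁ N s
      m∑t≈∑s N = trans (sym (∑₁-* N (fromℕ m) t)) (∑₁-cong N (λ n → fromℕ m * t n) s λ n _ → mt≈s n)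
      ∑t+∑t≤1 : ∀ N → ∑₁ N t + ∑₁ N t ≤ 1#
      ∑t+∑t≤1 N = *-cancelʳ-≤ 0<m (begin
        (∑₁ N t + ∑₁ N t) * fromℕ m           ≈⟨ solve 2 (λ σ m → (σ :+ σ) :* m := m :* σ :+ m :* σ) refl (∑₁ N t) (fromℕ m) ⟩
        fromℕ m * ∑₁ N t + fromℕ m * ∑₁ N t   ≈⟨ +-cong (m∑t≈∑s N) (m∑t≈∑s N) ⟩
        ∑₁ N s + ∑₁ N s                       ≤⟨ +-mono-≤ (∑s≤b N) (∑s≤b N) ⟩
        b + b                                 ≤⟨ 2b≤m ⟩
        fromℕ m                               ≈⟨ *-identityˡ _ ⟨
        1# * fromℕ m                          ∎)
      ∏t≤2 : ∀ N → ∏[1+ t ] N ≤ 1# + 1#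
      ∏t≤2 N = begin
        -- As 2 σ ≤ 1, the product is at most 2 (1 - σ) times itself, and each of the two copies is
        -- at most 1.
        ∏t                              ≤⟨ ≤-by (*-nonNeg (∏-nonNeg t-nonNeg N) (x≤y⇒0≤y-x (∑t+∑t≤1 N)))
                                             (solve 2 (λ p σ → p :+ p :* (con (+ 1) :- (σ :+ σ)) := p :* (con (+ 1) :- σ) :+ p :* (con (+ 1) :- σ)) refl ∏t σ) ⟩
        ∏t * (1# - σ) + ∏t * (1# - σ)   ≤⟨ +-mono-≤ (∏*[1-∑]≤1 t-nonNeg N) (∏*[1-∑]≤1 t-nonNeg N) ⟩
        1# + 1#                         ∎
        where
        ∏t = ∏[1+ t ] N
        σ = ∑₁ N t
      1+s≤[1+t]^m : ∀ n → 1# + s n ≤ (1# + t n) ^ m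
      1+s≤[1+t]^m n = ≤-trans (≤-reflexive (+-congˡ (sym (mt≈s n)))) (bernoulli m (t-nonNeg n))
      ∏s≤∏t^m : ∀ N → ∏[1+ s ] N ≤ ∏[1+ t ] N ^ m
      ∏s≤∏t^m zero    = ≤-reflexive (sym (1^n≈1 m))
      ∏s≤∏t^m (suc N) = begin
        ∏[1+ s ] N * (1# + s (suc N))            ≤⟨ *-mono-≤ (∏-nonNeg s-nonNeg N) (+-nonNeg 0≤1 (s-nonNeg (suc N))) (∏s≤∏t^m N) (1+s≤[1+t]^m (suc N)) ⟩
        ∏[1+ t ] N ^ m * (1# + t (suc N)) ^ m    ≈⟨ ^-distrib-* _ _ m ⟨
        (∏[1+ t ] N * (1# + t (suc N))) ^ m      ∎

-- Injectivity of the products of operators.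

module Injectivity {c ℓ} (K : CommutativeRing c ℓ) where
  open CommutativeRing K hiding (zero)
  open IntegerSolver K
  open DirichletConvolution K
  open EulerFactors K

  Vanishing : Function → Set ℓ
  Vanishing T = T 0 ≈ 0#

  -- Vanishing at 0 is imposed because for `x = 1#` the operator 1 - x V_p forgets the value at 0.
  -- Agreement is confined to arguments up to `N` because the sieve identity holds only in such a
  -- range.
  record IsInjective (L : Operator) : Set (c Level.⊔ ℓ) where
    field
      vanishing : ∀ {T} → Vanishing T → Vanishing (L T)
      injective : ∀ {N S T} → Vanishing S → Vanishing T →
                  (∀ M → M ℕ.≤ N → L S M ≈ L T M) → ∀ M → M ℕ.≤ N → S M ≈ T M

  id-injective : IsInjective id
  id-injective = record { vanishing = id ; injective = λ _ _ → id }

  ∘-injective : ∀ {L M} → IsInjective L → IsInjective M → IsInjective (L ∘ M)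
  ∘-injective L-inj M-inj = record
    { vanishing = L.vanishing ∘ M.vanishing
    ; injective = λ S0≈0 T0≈0 → M.injective S0≈0 T0≈0 ∘ L.injective (M.vanishing S0≈0) (M.vanishing T0≈0)
    }
    where
    module L = IsInjective L-inj
    module M = IsInjective M-inj

  -- The value at M is recovered from that of the image at M and the value at the smaller argument
  -- ⌊M / p⌋; `go` bounds this descent by an extra argument.
  Δ-injective : ∀ {p} .{{_ : NonZero p}} → Prime p → ∀ x → IsInjective (Δ (contract p) x)
  Δ-injective {p} pp x = record
    { vanishing = λ {T} T0≈0 → trans (+-cong T0≈0 (-‿cong (*-congˡ (trans (reflexive (≡.cong T (ℕ.0/n≡0 p))) T0≈0))))
        (solve 1 (λ x → con (+ 0) :- x :* con (+ 0) := con (+ 0)) refl x)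
    ; injective = λ {N} {S} {T} S0≈0 T0≈0 LS≈LT M M≤N → go S0≈0 T0≈0 LS≈LT M M M≤N ℕ.≤-refl
    }
    where
    open ≈-Reasoning
    go : ∀ {N S T} → Vanishing S → Vanishing T → (∀ M → M ℕ.≤ N → Δ (contract p) x S M ≈ Δ (contract p) x T M) →
         ∀ k M → M ℕ.≤ N → M ℕ.≤ k → S M ≈ T M
    go S0≈0 T0≈0 LS≈LT k       zero    _   _   = trans S0≈0 (sym T0≈0)
    go {N} {S} {T} S0≈0 T0≈0 LS≈LT (suc k) M@(suc M-1) M≤N M≤1+k = begin
      S M                                   ≈⟨ solve 2 (λ s y → s := s :- y :+ y) refl (S M) (x * S (M ℕ./ p)) ⟩
      Δ (contract p) x S M + x * S (M ℕ./ p) ≈⟨ +-cong (LS≈LT M M≤N) (*-congˡ (go {N} {S} {T} S0≈0 T0≈0 LS≈LT k (M ℕ./ p)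
                                                  (ℕ.≤-trans (ℕ.m/n≤m M p) M≤N) (ℕ.≤-pred (ℕ.≤-trans M/p<M M≤1+k)))) ⟩
      Δ (contract p) x T M + x * T (M ℕ./ p) ≈⟨ solve 2 (λ s y → s := s :- y :+ y) refl (T M) (x * T (M ℕ./ p)) ⟨
      T M                                   ∎
      where M/p<M = ℕ.m/n<m M p {{_}} {{_}} (ℕ.nonTrivial⇒n>1 p {{prime⇒nonTrivial pp}})

  Δs-injective : ∀ {p} .{{_ : NonZero p}} → Prime p → ∀ {d} (xs : Vector Carrier d) → IsInjective (Δs (contract p) xs)
  Δs-injective pp {zero}  xs = id-injective
  Δs-injective {p} pp {suc d} xs = ∘-injective {Δ (contract p) (head xs)} (Δ-injective pp (head xs)) (Δs-injective pp (tail xs))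

  onPrimes-injective : ∀ {L} → (∀ p .{{_ : NonZero p}} → Prime p → IsInjective (L p)) → ∀ P → IsInjective (onPrimes L P)
  onPrimes-injective L-inj zero    = id-injective
  onPrimes-injective {L} L-inj (suc P) with prime? (suc P)
  ... | yes pp = ∘-injective {L (suc P)} (L-inj (suc P) pp) (onPrimes-injective L-inj P)
  ... | no  _  = onPrimes-injective L-inj P

-- Exchanging all Euler factors up to a bound.

module Comparison {ℓ c} (R : CompleteOrderedField ℓ) (K : CommutativeRing c ℓ)
  {∣_∣ : CommutativeRing.Carrier K → CompleteOrderedField.Carrier R} (isNorm : Normed.IsNorm R K ∣_∣) where
  open Reals R hiding (zero)
  private module K = CommutativeRing K
  open Normed.IsNorm isNorm using (∣∣-cong; ∣∣-nonNeg)
  open Normed.NormedOperators R K isNorm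
  open OrderedFieldProperties R
  open OrderedSums R
  open InfiniteProducts R
  open IntegerSolver commutativeRing
  open FiniteSums commutativeRing using (∑₁-*)
  open DirichletConvolution K
  open EulerFactors K
  open Injectivity K

  -- The weights `ω p j` stand for the reciprocals of p^(jβ), and the two functions are taken as the
  -- convolution products themselves instead of functions equal to them at positive arguments.
  distanceTerm : ∀ {d} → (ℕ → ℕ → ℝ) → Vector Function d → Vector Function d → ℕ → ℝ
  distanceTerm {d} ω F G p =
    if ⌊ prime? p ⌋ then ∑₁ d (λ j → ∣ foldr _⋆_ ε F (p ℕ.^ j) K.- foldr _⋆_ ε G (p ℕ.^ j) ∣ * ω p j) else 0#

  distanceTerm-nonNeg : ∀ {d} ω (F G : Vector Function d) → (∀ {p} → Prime p → ∀ j → 0# ≤ ω p j) → ∀ p → 0# ≤ distanceTerm ω F G p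
  distanceTerm-nonNeg {d} ω F G ω-nonNeg p with prime? p
  ... | yes pp = ∑₁-nonNeg d (λ j → ∣ foldr _⋆_ ε F (p ℕ.^ j) K.- foldr _⋆_ ε G (p ℕ.^ j) ∣ * ω p j) λ j → *-nonNeg (∣∣-nonNeg _) (ω-nonNeg pp j)
  ... | no  _  = ≤-refl

  module _ (v : ℕ → ℝ) (v-nonNeg : ∀ N → 0# ≤ v N) (w ρ : ℝ) (1≤ρ : 1# ≤ ρ) (1+ρw≤ρ : 1# + ρ * w ≤ ρ)
           (v-contract : ∀ p .{{_ : NonZero p}} → Prime p → ∀ N → v (N ℕ./ p) ≤ w * v N)
           (ω : ℕ → ℕ → ℝ) (ω-nonNeg : ∀ {p} → Prime p → ∀ j → 0# ≤ ω p j)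
           (ω-anti : ∀ {p} → Prime p → ∀ j → ω p (suc j) ≤ ω p j)
           (v-orbit : ∀ p .{{_ : NonZero p}} → Prime p → ∀ j .{{_ : NonZero j}} N → v (ℕ._/_ N (p ℕ.^ j) {{ℕ.m^n≢0 p j}}) ≤ ω p j * v N)
           {d} (F G : Vector Function d)
           (F-multiplicative : ∀ i → IsCompletelyMultiplicative (F i))
           (G-multiplicative : ∀ i → IsCompletelyMultiplicative (G i))
           (F-unit : ∀ i n .{{_ : NonZero n}} → ∣ F i n ∣ ≤ 1#)
           (G-unit : ∀ i n .{{_ : NonZero n}} → ∣ G i n ∣ ≤ 1#) where
    private
      f = foldr _⋆_ ε F
      g = foldr _⋆_ ε G

      𝓐 𝓑 : (p : ℕ) .{{_ : NonZero p}} → Operator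
      𝓐 p = Δs (contract p) λ i → F i p
      𝓑 p = Δs (contract p) λ i → G i p

      𝓐-linear : ∀ p .{{_ : NonZero p}} → IsLinear (𝓐 p)
      𝓐-linear p = Δs-linear (contract-linear p) λ i → F i p

      𝓑-linear : ∀ p .{{_ : NonZero p}} → IsLinear (𝓑 p)
      𝓑-linear p = Δs-linear (contract-linear p) λ i → G i p

    private
      κ* : ℕ → ℝ
      κ* p = κ ρ d * distanceTerm ω F G p

      κ*-nonNeg : ∀ p → 0# ≤ κ* p
      κ*-nonNeg p = *-nonNeg (κ-nonNeg d (≤-trans 0≤1 1≤ρ)) (distanceTerm-nonNeg ω F G ω-nonNeg p)

      restrict-0 : ∀ p → Prime p → restrict p f 0 K.≈ restrict p g 0
      restrict-0 p pp = K.trans (f1≈1 F F-multiplicative) (K.sym (f1≈1 G G-multiplicative))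
        where
        f1≈1 : (H : Vector Function d) (H-multiplicative : ∀ i → IsCompletelyMultiplicative (H i)) → foldr _⋆_ ε H 1 K.≈ ε 1
        f1≈1 H H-multiplicative = foldr-⋆-unit H 1 (λ i → IsCompletelyMultiplicative.f1≈1 (H-multiplicative i))
          λ i k k∣1 k≢1 → contradiction (∣1⇒≡1 k∣1) k≢1

    module _ {C : ℝ} (0≤C : 0# ≤ C) (f-bounded : ∀ N → ∣ summatory f N ∣ ≤ C * v N) where

      -- All V_p commute. Hence the new factor of `𝓑` can be moved inside the earlier ones, traded
      -- there for the factor of `𝓐` by `exchange`, and the latter moved out again.
      exchange-upTo : ∀ P → ∃ λ U → Bounded v v-nonNeg (C * ∏[1+ κ* ] P) U × onPrimes 𝓑 P U ≐ onPrimes 𝓐 P (summatory f)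
      exchange-upTo zero    = summatory f , bounded K.refl (λ N → ≤-trans (f-bounded N) (*-monoˡ-≤ _ (v-nonNeg N) (≤-reflexive (sym (*-identityʳ C))))) , λ _ → K.refl
      exchange-upTo (suc P) with prime? (suc P)
      -- A composite index has distance term 0, so the product only gains the factor 1 + κ 0.
      ... | no _ =
        let U , bounded U0≈0 U-bound , 𝓑U≐𝓐f = exchange-upTo P
        in U , bounded U0≈0 (λ N → ≤-trans (U-bound N) (*-monoˡ-≤ _ (v-nonNeg N) (≤-reflexive
             (solve 3 (λ c p k → c :* p := c :* (p :* (con (+ 1) :+ k :* con (+ 0)))) refl C (∏[1+ κ* ] P) _)))) , 𝓑U≐𝓐f
      ... | yes pp =
        let p = suc P
            U , U-bounded , 𝓑U≐𝓐f = exchange-upTo P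
            U′ , bounded U′0≈0 U′-bound , 𝓑U′≐𝓐U = exchange v v-nonNeg w ρ 1≤ρ 1+ρw≤ρ p pp (v-contract p pp)
              (ω p) (ω-nonNeg pp) (ω-anti pp) (v-orbit p pp)
              (λ i → F i p) (λ i → G i p) (restrict p f) (restrict p g) (*-nonNeg 0≤C (∏-nonNeg κ*-nonNeg P)) (λ i → F-unit i p) (λ i → G-unit i p)
              (Δs-restrict F F-multiplicative pp) (Δs-restrict G G-multiplicative pp) (restrict-0 p pp) U-bounded
        in U′ , bounded U′0≈0 (λ N → ≤-trans (U′-bound N) (*-monoˡ-≤ _ (v-nonNeg N) (≤-reflexive (*-assoc _ _ _)))) , λ N → begin
          𝓑 p (onPrimes 𝓑 P U′) N                ≈⟨ onPrimes-intertwine {𝓑 p} {𝓑} {𝓑} (𝓑-linear p) 𝓑-linear (λ q _ a → commute p q (λ i → G i p) (λ i → G i q) a) P U′ N ⟩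
          onPrimes 𝓑 P (𝓑 p U′) N                ≈⟨ onPrimes-cong {𝓑} 𝓑-linear P {𝓑 p U′} {𝓐 p U} 𝓑U′≐𝓐U N ⟩
          onPrimes 𝓑 P (𝓐 p U) N                 ≈⟨ onPrimes-intertwine {𝓐 p} {𝓑} {𝓑} (𝓐-linear p) 𝓑-linear (λ q _ a → commute p q (λ i → F i p) (λ i → G i q) a) P U N ⟨
          𝓐 p (onPrimes 𝓑 P U) N                 ≈⟨ IsLinear.cong (𝓐-linear p) {onPrimes 𝓑 P U} {onPrimes 𝓐 P (summatory f)} 𝓑U≐𝓐f N ⟩
          𝓐 p (onPrimes 𝓐 P (summatory f)) N     ∎
        where
        open import Relation.Binary.Reasoning.Setoid K.setoid
        commute : ∀ p q .{{_ : NonZero p}} .{{_ : NonZero q}} (xs ys : Vector K.Carrier d) a →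
                  Δs (contract p) xs (Δs (contract q) ys a) ≐ Δs (contract q) ys (Δs (contract p) xs a)
        commute p q = Δs-comm {contract p} {contract q} (contract-linear p) (contract-linear q) (contract-comm p q)

      -- After the exchange up to `N`, the products over `𝓑` take `U` and the summatory function of
      -- `g` to functions that both agree with the summatory function of `ε` up to `N`. The function
      -- `U` depends on `N` and is evaluated only there.
      summatory-bound : ∀ N → ∣ summatory g N ∣ ≤ C * ∏[1+ κ* ] N * v N
      summatory-bound N =
        let U , bounded U0≈0 U-bound , 𝓑U≐𝓐f = exchange-upTo N
            𝓑U≈𝓑g = λ M M≤N → K.trans (𝓑U≐𝓐f M) (K.trans (summatory-onPrimes F F-multiplicative M≤N) (K.sym (summatory-onPrimes G G-multiplicative M≤N)))
            U≈g = IsInjective.injective (onPrimes-injective {𝓑} (λ p pp → Δs-injective pp (λ i → G i p)) N) {N} {U} {summatory g} U0≈0 K.refl 𝓑U≈𝓑g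
        in ≤-trans (≤-reflexive (∣∣-cong (K.sym (U≈g N ℕ.≤-refl)))) (U-bound N)

      summatory-bounded : ∀ {b} → (∀ N → ∑₁ N (distanceTerm ω F G) ≤ b) → ¬ ¬ ∃ λ E → 0# ≤ E × ∀ N → ∣ summatory g N ∣ ≤ E * v N
      summatory-bounded {b} ∑≤b unbounded = ∏-bounded (κd * b) κ*-nonNeg
        (λ N → ≤-trans (≤-reflexive (∑₁-* N κd (distanceTerm ω F G))) (*-monoʳ-≤ κd 0≤κd (∑≤b N))) λ (E , 0≤E , ∏≤E) →
        unbounded (C * E , *-nonNeg 0≤C 0≤E , λ N → ≤-trans (summatory-bound N) (*-monoˡ-≤ _ (v-nonNeg N) (*-monoʳ-≤ C 0≤C (∏≤E N))))
        where
        κd = κ ρ d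
        0≤κd = κ-nonNeg d (≤-trans 0≤1 1≤ρ)

-- The complex numbers as a normed commutative ring.

module Modulus {ℓ} (R : CompleteOrderedField ℓ) where
  open Reals R hiding (zero)
  open Complexes R
  open OrderedFieldProperties R
  open RealPowers R
  open IntegerSolver commutativeRing
  private module ℂʳ = RawRing rawRing-ℂ

  commutativeRing-ℂ : CommutativeRing ℓ ℓ
  commutativeRing-ℂ = record
    { Carrier = ℂ
    ; _≈_     = ℂʳ._≈_
    ; _+_     = ℂʳ._+_
    ; _*_     = ℂʳ._*_
    ; -_      = ℂʳ.-_
    ; 0#      = ℂʳ.0#
    ; 1#      = ℂʳ.1#
    ; isCommutativeRing = record
      { isRing = record
        { +-isAbelianGroup = record
          { isGroup = record
            { isMonoid = record
              { isSemigroup = record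
                { isMagma = record
                  { isEquivalence = record
                    { refl  = refl , refl
                    ; sym   = λ (p , q) → sym p , sym q
                    ; trans = λ (p , q) (p′ , q′) → trans p p′ , trans q q′
                    }
                  ; ∙-cong = λ (p , q) (p′ , q′) → +-cong p p′ , +-cong q q′
                  }
                ; assoc = λ x y z → +-assoc _ _ _ , +-assoc _ _ _
                }
              ; identity = (λ x → +-identityˡ _ , +-identityˡ _) , (λ x → +-identityʳ _ , +-identityʳ _)
              }
            ; inverse = (λ x → -‿inverseˡ _ , -‿inverseˡ _) , (λ x → -‿inverseʳ _ , -‿inverseʳ _)
            ; ⁻¹-cong = λ (p , q) → -‿cong p , -‿cong q
            }
          ; comm = λ x y → +-comm _ _ , +-comm _ _
          }
        ; *-cong = λ (p , q) (p′ , q′) → +-cong (*-cong p p′) (-‿cong (*-cong q q′)) , +-cong (*-cong p q′) (*-cong q p′)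
        ; *-assoc = λ (a +i b) (c +i d) (e +i f) →
            solve 6 (λ a b c d e f → (a :* c :- b :* d) :* e :- (a :* d :+ b :* c) :* f := a :* (c :* e :- d :* f) :- b :* (c :* f :+ d :* e)) refl a b c d e f ,
            solve 6 (λ a b c d e f → (a :* c :- b :* d) :* f :+ (a :* d :+ b :* c) :* e := a :* (c :* f :+ d :* e) :+ b :* (c :* e :- d :* f)) refl a b c d e f
        ; *-identity =
            (λ (a +i b) → solve 2 (λ a b → con (+ 1) :* a :- con (+ 0) :* b := a) refl a b ,
                          solve 2 (λ a b → con (+ 1) :* b :+ con (+ 0) :* a := b) refl a b) ,
            (λ (a +i b) → solve 2 (λ a b → a :* con (+ 1) :- b :* con (+ 0) := a) refl a b ,
                          solve 2 (λ a b → a :* con (+ 0) :+ b :* con (+ 1) := b) refl a b)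
        ; distrib =
            (λ (a +i b) (c +i d) (e +i f) →
              solve 6 (λ a b c d e f → a :* (c :+ e) :- b :* (d :+ f) := (a :* c :- b :* d) :+ (a :* e :- b :* f)) refl a b c d e f ,
              solve 6 (λ a b c d e f → a :* (d :+ f) :+ b :* (c :+ e) := (a :* d :+ b :* c) :+ (a :* f :+ b :* e)) refl a b c d e f) ,
            (λ (a +i b) (c +i d) (e +i f) →
              solve 6 (λ a b c d e f → (c :+ e) :* a :- (d :+ f) :* b := (c :* a :- d :* b) :+ (e :* a :- f :* b)) refl a b c d e f ,
              solve 6 (λ a b c d e f → (c :+ e) :* b :+ (d :+ f) :* a := (c :* b :+ d :* a) :+ (e :* b :+ f :* a)) refl a b c d e f)
        }
      ; *-comm = λ (a +i b) (c +i d) →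
          solve 4 (λ a b c d → a :* c :- b :* d := c :* a :- d :* b) refl a b c d ,
          solve 4 (λ a b c d → a :* d :+ b :* c := c :* b :+ d :* a) refl a b c d
      }
    }

  x²≤y²⇒x≤y : ∀ {x y} → 0# ≤ y → x * x ≤ y * y → x ≤ y
  x²≤y²⇒x≤y {x} {y} 0≤y x²≤y² with ≤-total 0# x
  ... | inj₂ x≤0 = ≤-trans x≤0 0≤y
  ... | inj₁ 0≤x = ^-cancelˡ-≤ 2 0≤x 0≤y
    (≤-trans (≤-reflexive (*-congˡ (*-identityʳ x))) (≤-trans x²≤y² (≤-reflexive (*-congˡ (sym (*-identityʳ y))))))

  -- The supremum defining `sqrt` is attained at the square root constructed by `root`, which is
  -- both a member of the set and an upper bound.
  sqrt-nonNeg-sq : ∀ {t} → 0# ≤ t → 0# ≤ sqrt t × sqrt t * sqrt t ≈ t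
  sqrt-nonNeg-sq {t} 0≤t = ≤-trans 0≤r (≤-reflexive r≈sqrt) , trans (*-cong (sym r≈sqrt) (sym r≈sqrt)) r²≈t
    where
    r = proj₁ (root 2 t 0≤t)
    0≤r = proj₁ (proj₂ (root 2 t 0≤t))
    r²≈t = trans (*-congˡ (sym (*-identityʳ r))) (proj₂ (proj₂ (root 2 t 0≤t)))
    upper : ∀ y → y * y ≤ t → y ≤ r
    upper y y²≤t = x²≤y²⇒x≤y 0≤r (≤-trans y²≤t (≤-reflexive (sym r²≈t)))
    sup = ⋁-isSupremum (λ y → y * y ≤ t) (r , ≤-reflexive r²≈t) (r , upper)
    r≈sqrt : r ≈ sqrt t
    r≈sqrt = ≤-antisym (proj₁ sup r (≤-reflexive r²≈t)) (proj₂ sup r upper)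

  normSq : ℂ → ℝ
  normSq z = re z * re z + im z * im z

  normSq-nonNeg : ∀ z → 0# ≤ normSq z
  normSq-nonNeg z = +-nonNeg (x²-nonNeg (re z)) (x²-nonNeg (im z))

  ∣∣-nonNeg : ∀ z → 0# ≤ ∣ z ∣
  ∣∣-nonNeg z = proj₁ (sqrt-nonNeg-sq (normSq-nonNeg z))

  ∣∣² : ∀ z → ∣ z ∣ * ∣ z ∣ ≈ normSq z
  ∣∣² z = proj₂ (sqrt-nonNeg-sq (normSq-nonNeg z))

  ∣∣≤ : ∀ {z b} → 0# ≤ b → normSq z ≤ b * b → ∣ z ∣ ≤ b
  ∣∣≤ {z} 0≤b z²≤b² = x²≤y²⇒x≤y 0≤b (≤-trans (≤-reflexive (∣∣² z)) z²≤b²)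

  ∣∣-cong-normSq : ∀ {z w} → normSq z ≈ normSq w → ∣ z ∣ ≈ ∣ w ∣
  ∣∣-cong-normSq {z} {w} eq = ≤-antisym
    (∣∣≤ {z} (∣∣-nonNeg w) (≤-reflexive (trans eq (sym (∣∣² w)))))
    (∣∣≤ {w} (∣∣-nonNeg z) (≤-reflexive (trans (sym eq) (sym (∣∣² z)))))

  -- The Cauchy-Schwarz inequality, by Lagrange's identity: the defect of the squares is (a d - b
  -- c)².
  re-inner≤ : ∀ z w → re z * re w + im z * im w ≤ ∣ z ∣ * ∣ w ∣
  re-inner≤ z@(a +i b) w@(c +i d) = x²≤y²⇒x≤y (*-nonNeg (∣∣-nonNeg z) (∣∣-nonNeg w)) (begin
    (a * c + b * d) * (a * c + b * d)          ≤⟨ ≤-by (x²-nonNeg (a * d - b * c))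
      (solve 4 (λ a b c d → (a :* c :+ b :* d) :* (a :* c :+ b :* d) :+ (a :* d :- b :* c) :* (a :* d :- b :* c) := (a :* a :+ b :* b) :* (c :* c :+ d :* d)) refl a b c d) ⟩
    normSq z * normSq w                        ≈⟨ *-cong (∣∣² z) (∣∣² w) ⟨
    ∣ z ∣ * ∣ z ∣ * (∣ w ∣ * ∣ w ∣)            ≈⟨ solve 2 (λ x y → x :* x :* (y :* y) := x :* y :* (x :* y)) refl ∣ z ∣ ∣ w ∣ ⟩
    ∣ z ∣ * ∣ w ∣ * (∣ z ∣ * ∣ w ∣)            ∎)
    where open ≤-Reasoning

  ∣∣-isNorm : Normed.IsNorm R commutativeRing-ℂ ∣_∣
  ∣∣-isNorm = record
    { ∣∣-cong   = λ {z} {w} (p , q) → ∣∣-cong-normSq {z} {w} (+-cong (*-cong p p) (*-cong q q))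
    ; ∣∣-nonNeg = ∣∣-nonNeg
    ; ∣0∣≈0     = ≤-antisym (∣∣≤ {0# +i 0#} ≤-refl (≤-reflexive (solve 0 (con (+ 0) :* con (+ 0) :+ con (+ 0) :* con (+ 0) := con (+ 0) :* con (+ 0)) refl))) (∣∣-nonNeg _)
    ; ∣-x∣≈∣x∣  = λ z → ∣∣-cong-normSq {ℂʳ.- z} {z} (solve 2 (λ a b → (:- a) :* (:- a) :+ (:- b) :* (:- b) := a :* a :+ b :* b) refl (re z) (im z))
    ; triangle  = λ z w → ∣∣≤ {z ℂʳ.+ w} (+-nonNeg (∣∣-nonNeg z) (∣∣-nonNeg w)) (triangle² z w)
    ; submult   = λ z w → ∣∣≤ {z ℂʳ.* w} (*-nonNeg (∣∣-nonNeg z) (∣∣-nonNeg w)) (≤-reflexive (mult² z w))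
    }
    where
    triangle² : ∀ z w → normSq (z ℂʳ.+ w) ≤ (∣ z ∣ + ∣ w ∣) * (∣ z ∣ + ∣ w ∣)
    triangle² z@(a +i b) w@(c +i d) = begin
      normSq (z ℂʳ.+ w)                                     ≈⟨ solve 4 (λ a b c d → (a :+ c) :* (a :+ c) :+ (b :+ d) :* (b :+ d) :=
                                                                (a :* a :+ b :* b) :+ (c :* c :+ d :* d) :+ ((a :* c :+ b :* d) :+ (a :* c :+ b :* d))) refl a b c d ⟩
      normSq z + normSq w + (a * c + b * d + (a * c + b * d))
        ≤⟨ +-mono-≤ (≤-reflexive (+-cong (sym (∣∣² z)) (sym (∣∣² w)))) (+-mono-≤ (re-inner≤ z w) (re-inner≤ z w)) ⟩
      ∣ z ∣ * ∣ z ∣ + ∣ w ∣ * ∣ w ∣ + (∣ z ∣ * ∣ w ∣ + ∣ z ∣ * ∣ w ∣)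
        ≈⟨ solve 2 (λ x y → x :* x :+ y :* y :+ (x :* y :+ x :* y) := (x :+ y) :* (x :+ y)) refl ∣ z ∣ ∣ w ∣ ⟩
      (∣ z ∣ + ∣ w ∣) * (∣ z ∣ + ∣ w ∣)                    ∎
      where open ≤-Reasoning
    mult² : ∀ z w → normSq (z ℂʳ.* w) ≈ ∣ z ∣ * ∣ w ∣ * (∣ z ∣ * ∣ w ∣)
    mult² z@(a +i b) w@(c +i d) = begin
      normSq (z ℂʳ.* w)                          ≈⟨ solve 4 (λ a b c d → (a :* c :- b :* d) :* (a :* c :- b :* d) :+ (a :* d :+ b :* c) :* (a :* d :+ b :* c) :=
                                                     (a :* a :+ b :* b) :* (c :* c :+ d :* d)) refl a b c d ⟩
      normSq z * normSq w                       ≈⟨ *-cong (∣∣² z) (∣∣² w) ⟨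
      ∣ z ∣ * ∣ z ∣ * (∣ w ∣ * ∣ w ∣)           ≈⟨ solve 2 (λ x y → x :* x :* (y :* y) := x :* y :* (x :* y)) refl ∣ z ∣ ∣ w ∣ ⟩
      ∣ z ∣ * ∣ w ∣ * (∣ z ∣ * ∣ w ∣)           ∎
      where open import Relation.Binary.Reasoning.Setoid setoid

-- The weight N^γ under division of its argument.

module Weight {ℓ} (R : CompleteOrderedField ℓ) where
  open Reals R hiding (zero)
  open OrderedFieldProperties R
  open RealPowers R
  open IntegerSolver commutativeRing

  module _ {γ : ℝ} (0<γ : 0# < γ) where

    -- N ↦ N ^ʳ γ, with value 0 at 0, where ^ʳ is unconstrained.
    weight : ℕ → ℝ
    weight zero      = 0#
    weight N@(suc _) = fromℕ N ^ʳ γ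

    weight-nonNeg : ∀ N → 0# ≤ weight N
    weight-nonNeg zero      = ≤-refl
    weight-nonNeg N@(suc _) = <⇒≤ (^ʳ-pos γ (1≤fromℕ N))

    -- With M = ⌊N / q⌋, M^γ q^γ ≤ (M q)^γ ≤ N^γ. A smaller `b` may replace q^γ: it will be 2^β,
    -- uniformly in the prime, and p^(jβ) for q = pʲ.
    weight-/ : ∀ q .{{_ : NonZero q}} {b} → 0# < b → b ≤ fromℕ q ^ʳ γ → ∀ N → weight (N ℕ./ q) ≤ b ⁻¹ * weight N
    weight-/ q {b} 0<b b≤q^γ N with N ℕ./ q in N/q≡M
    ... | zero      = *-nonNeg (⁻¹-nonNeg 0<b) (weight-nonNeg N)
    ... | M@(suc _) = ≤-trans (*≤⇒≤/ 0<b (≤-trans (begin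
      fromℕ M ^ʳ γ * b                 ≤⟨ *-monoʳ-≤ _ (weight-nonNeg M) b≤q^γ ⟩
      fromℕ M ^ʳ γ * fromℕ q ^ʳ γ      ≤⟨ ^ʳ-*-≤ (1≤fromℕ M) (1≤fromℕ q) ⟩
      (fromℕ M * fromℕ q) ^ʳ γ         ≤⟨ ^ʳ-monoˡ-≤ 1≤Mq (≤-trans (≤-reflexive (sym (fromℕ-* M q))) (fromℕ-mono Mq≤N)) (<⇒≤ 0<γ) ⟩
      fromℕ N ^ʳ γ                     ∎) (positive N N≢0))) (≤-reflexive (*-comm _ _))
      where
      open ≤-Reasoning
      Mq≤N : M ℕ.* q ℕ.≤ N
      Mq≤N = ≡.subst (λ k → k ℕ.* q ℕ.≤ N) N/q≡M (ℕ.m/n*n≤m N q)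
      1≤Mq = ≤-trans (1≤fromℕ (M ℕ.* q) {{ℕ.m*n≢0 M q}}) (≤-reflexive (fromℕ-* M q))
      N≢0 : NonZero N
      N≢0 = ℕ.>-nonZero (ℕ.<-≤-trans (ℕ.>-nonZero⁻¹ (M ℕ.* q) {{ℕ.m*n≢0 M q}}) Mq≤N)
      positive : ∀ N → NonZero N → fromℕ N ^ʳ γ ≤ weight N
      positive (suc _) _ = ≤-refl

-- Assembly for the weight N^γ with γ = max(α, β).

module Theorem {ℓ} (R : CompleteOrderedField ℓ) where
  open Reals R hiding (zero)
  open Complexes R
  open ArithmeticFunctions R
  open OrderedFieldProperties R
  open RealPowers R
  open Modulus R
  open Weight R
  open IntegerSolver commutativeRing
  open MaxOp (NaturalMax.maxOperator (DecTotalOrder.totalOrder decTotalOrder)) using (x≤x⊔y; x≤y⊔x)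
  open Normed.IsNorm ∣∣-isNorm using (∣∣-cong; ∣0∣≈0)
  private
    module ℂ! = CommutativeRing commutativeRing-ℂ
    module ∑ℂ = FiniteSums commutativeRing-ℂ
    module ∑ℝ = FiniteSums commutativeRing
  open EulerFactors commutativeRing-ℂ using (IsCompletelyMultiplicative)

  -- Raising the exponent from α to γ requires a nonnegative constant, so a nonpositive `C` is first
  -- replaced by 0.
  ≪-pointwise : ∀ {f α γ} (0<γ : 0# < γ) → α ≤ γ → S[ f ]≪x^ α → ∃ λ C → 0# ≤ C × ∀ N → ∣ S f N ∣ ≤ C * weight 0<γ N
  ≪-pointwise {f} {α} {γ} 0<γ α≤γ (C , S≤) with ≤-total 0# C
  ... | inj₁ 0≤C = C , 0≤C , bound
    where
    bound : ∀ N → ∣ S f N ∣ ≤ C * weight 0<γ N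
    bound zero      = ≤-trans (≤-reflexive ∣0∣≈0) (≤-reflexive (sym (zeroʳ C)))
    bound N@(suc _) = ≤-trans (S≤ (fromℕ N) N (1≤fromℕ N) (≤-refl , fromℕ-<suc N)) (*-monoʳ-≤ C 0≤C (^ʳ-monoʳ-≤ (1≤fromℕ N) α≤γ))
  ... | inj₂ C≤0 = 0# , ≤-refl , bound
    where
    open ≤-Reasoning
    bound : ∀ N → ∣ S f N ∣ ≤ 0# * weight 0<γ N
    bound zero      = ≤-trans (≤-reflexive ∣0∣≈0) (≤-reflexive (sym (zeroʳ 0#)))
    bound N@(suc _) = begin
      ∣ S f N ∣               ≤⟨ S≤ (fromℕ N) N (1≤fromℕ N) (≤-refl , fromℕ-<suc N) ⟩
      C * fromℕ N ^ʳ α        ≤⟨ *-monoˡ-≤ _ (<⇒≤ (^ʳ-pos α (1≤fromℕ N))) C≤0 ⟩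
      0# * fromℕ N ^ʳ α       ≈⟨ trans (zeroˡ _) (sym (zeroˡ _)) ⟩
      0# * fromℕ N ^ʳ γ       ∎

  -- The constant is the supremum of the quotients ∣ S g N ∣ / N ^ʳ γ, so it is enough to refute that they are unbounded.
  pointwise-≪ : ∀ {g γ} (0<γ : 0# < γ) → ¬ ¬ (∃ λ E → 0# ≤ E × ∀ N → ∣ S g N ∣ ≤ E * weight 0<γ N) → S[ g ]≪x^ γ
  pointwise-≪ {g} {γ} 0<γ bounded = C , bound
    where
    open ≤-Reasoning
    quotient : ℕ → ℝ
    quotient n = ∣ S g (suc n) ∣ / fromℕ (suc n) ^ʳ γ
    Quotients = λ y → ∃ λ n → y ≈ quotient n
    0<weight : ∀ n → 0# < fromℕ (suc n) ^ʳ γ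
    0<weight n = ^ʳ-pos γ (1≤fromℕ (suc n))
    C = ⋁ Quotients
    sup : IsSupremum Quotients C
    sup = ⋁-isSupremum-¬¬ (λ empty → empty (quotient 0 , 0 , refl)) λ unbounded → bounded λ (E , _ , S≤E) →
      unbounded (E , λ y (n , y≈) → ≤-trans (≤-reflexive y≈) (≤*⇒/≤ (0<weight n) (S≤E (suc n))))
    0≤C : 0# ≤ C
    0≤C = ≤-trans (*-nonNeg (∣∣-nonNeg (S g 1)) (⁻¹-nonNeg (0<weight 0))) (proj₁ sup (quotient 0) (0 , refl))
    bound : ∀ x N → 1# ≤ x → IsFloor x N → ∣ S g N ∣ ≤ C * x ^ʳ γ
    bound x zero    1≤x (_ , x<1)   = contradiction (≤-trans (≤-reflexive (+-identityʳ 1#)) 1≤x) (<⇒≱ x<1)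
    bound x (suc n) 1≤x (N≤x , _) = begin
      ∣ S g (suc n) ∣            ≤⟨ /≤⇒≤* (0<weight n) (proj₁ sup (quotient n) (n , refl)) ⟩
      C * fromℕ (suc n) ^ʳ γ     ≤⟨ *-monoʳ-≤ C 0≤C (^ʳ-monoˡ-≤ (1≤fromℕ (suc n)) N≤x (<⇒≤ 0<γ)) ⟩
      C * x ^ʳ γ                 ∎

  module _ {d} {f g : ArithmeticFunction} {α β : ℝ} (f∈𝒮 : 𝒮 d f) (g∈𝒮 : 𝒮 d g) (0<β : 0# < β)
           (finite : FiniteDistance β d f g) (S[f]≪ : S[ f ]≪x^ α) where
    private
      γ = α ⊔ β
      β≤γ = x≤y⊔x α β
      0<γ = <-≤-trans 0<β β≤γ
      v = weight 0<γ
      F = proj₁ f∈𝒮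
      G = proj₁ g∈𝒮
      f≈ = proj₂ (proj₂ f∈𝒮)
      g≈ = proj₂ (proj₂ g∈𝒮)

      multiplicative : ∀ {h} → CompletelyMultiplicative h → IsCompletelyMultiplicative h
      multiplicative h-cm = record { CompletelyMultiplicative h-cm }

      -- Since every prime is at least 2 and β ≤ γ, the reciprocal of 2^β bounds the contraction of
      -- the weight by V_p for all primes at once.
      2^β = fromℕ 2 ^ʳ β
      0<2^β : 0# < 2^β
      0<2^β = ^ʳ-pos β (1≤fromℕ 2)
      w = 2^β ⁻¹
      0≤w = ⁻¹-nonNeg 0<2^β

      1<2 : 1# < fromℕ 2
      1<2 = 1≤fromℕ 2 , λ 1≈2 → proj₂ (fromℕ-<suc 1) (trans (+-identityʳ 1#) 1≈2)

      0<1-w : 0# < 1# - w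
      0<1-w = x≤y⇒0≤y-x (⁻¹-≤1 (<⇒≤ 1<2^β)) , λ 0≈1-w → proj₂ 1<2^β (begin
        1#              ≈⟨ ⁻¹-inverseʳ 2^β (>⇒≉ 0<2^β) ⟨
        2^β * w         ≈⟨ solve 2 (λ t w → t :* w := t :- t :* (con (+ 1) :- w)) refl 2^β w ⟩
        2^β - 2^β * (1# - w)  ≈⟨ +-congˡ (-‿cong (*-congˡ 0≈1-w)) ⟨
        2^β - 2^β * 0#  ≈⟨ solve 1 (λ t → t :- t :* con (+ 0) := t) refl 2^β ⟩
        2^β             ∎)
        where
        open import Relation.Binary.Reasoning.Setoid setoid
        1<2^β = 1<^ʳ 1<2 0<β

      -- The sum of the geometric series of ratio `w`, for which `1# + ρ * w ≤ ρ` is an equality.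
      ρ = (1# - w) ⁻¹
      1+ρw≤ρ : 1# + ρ * w ≤ ρ
      1+ρw≤ρ = ≤-reflexive (trans (+-congʳ (sym (⁻¹-inverseˡ (1# - w) (>⇒≉ 0<1-w))))
        (solve 2 (λ r w → r :* (con (+ 1) :- w) :+ r :* w := r) refl ρ w))
      1≤ρ : 1# ≤ ρ
      1≤ρ = ≤-trans (x≤x+y (*-nonNeg (⁻¹-nonNeg 0<1-w) 0≤w)) 1+ρw≤ρ

      v-contract : ∀ p .{{_ : NonZero p}} → Prime p → ∀ N → v (N ℕ./ p) ≤ w * v N
      v-contract p pp = weight-/ 0<γ p 0<2^β (≤-trans
        (^ʳ-monoˡ-≤ (1≤fromℕ 2) (fromℕ-mono (ℕ.nonTrivial⇒n>1 p {{prime⇒nonTrivial pp}})) (<⇒≤ 0<β))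
        (^ʳ-monoʳ-≤ (1≤fromℕ p) β≤γ))

      ω : ℕ → ℕ → ℝ
      ω p j = (fromℕ p ^ʳ (fromℕ j * β)) ⁻¹

      1≤prime : ∀ {p} → Prime p → 1# ≤ fromℕ p
      1≤prime {p} pp = 1≤fromℕ p {{prime⇒nonZero pp}}

      ω-nonNeg : ∀ {p} → Prime p → ∀ j → 0# ≤ ω p j
      ω-nonNeg pp j = ⁻¹-nonNeg (^ʳ-pos _ (1≤prime pp))

      ω-anti : ∀ {p} → Prime p → ∀ j → ω p (suc j) ≤ ω p j
      ω-anti pp j = ⁻¹-anti-≤ (^ʳ-pos _ (1≤prime pp)) (^ʳ-monoʳ-≤ (1≤prime pp) (*-monoˡ-≤ β (<⇒≤ 0<β) (fromℕ-mono (ℕ.n≤1+n j))))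

      v-orbit : ∀ p .{{_ : NonZero p}} → Prime p → ∀ j .{{_ : NonZero j}} N → v (ℕ._/_ N (p ℕ.^ j) {{ℕ.m^n≢0 p j}}) ≤ ω p j * v N
      v-orbit p pp j = weight-/ 0<γ (p ℕ.^ j) {{ℕ.m^n≢0 p j}} (^ʳ-pos _ 1≤p) (begin
        fromℕ p ^ʳ (fromℕ j * β)     ≤⟨ ^ʳ-^-≤ j 1≤p ⟩
        (fromℕ p ^ j) ^ʳ β           ≤⟨ ^ʳ-monoˡ-≤ 1≤p^j (≤-reflexive (sym (fromℕ-^ p j))) (<⇒≤ 0<β) ⟩
        fromℕ (p ℕ.^ j) ^ʳ β         ≤⟨ ^ʳ-monoʳ-≤ (1≤fromℕ (p ℕ.^ j) {{ℕ.m^n≢0 p j}}) β≤γ ⟩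
        fromℕ (p ℕ.^ j) ^ʳ γ         ∎)
        where
        open ≤-Reasoning
        1≤p = 1≤prime pp
        1≤p^j = 1≤x^n j 1≤p

      module C = Comparison R commutativeRing-ℂ ∣∣-isNorm

      F-multiplicative : ∀ i → IsCompletelyMultiplicative (F i)
      F-multiplicative i = multiplicative (proj₁ (proj₁ (proj₂ f∈𝒮) i))

      G-multiplicative : ∀ i → IsCompletelyMultiplicative (G i)
      G-multiplicative i = multiplicative (proj₁ (proj₁ (proj₂ g∈𝒮) i))

      F-unit : ∀ i → UnitBounded (F i)
      F-unit i = proj₂ (proj₁ (proj₂ f∈𝒮) i)

      G-unit : ∀ i → UnitBounded (G i)
      G-unit i = proj₂ (proj₁ (proj₂ g∈𝒮) i)

      f̃ = foldr _⋆_ ε F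
      g̃ = foldr _⋆_ ε G

      distanceTerm≈ : ∀ p → C.distanceTerm ω F G p ≈ (if ⌊ prime? p ⌋ then primeTerm β d f g p else 0#)
      distanceTerm≈ p with prime? p
      ... | no  _  = refl
      ... | yes pp = ∑ℝ.∑₁-cong d (λ j → ∣ f̃ (p ℕ.^ j) ℂ!.- g̃ (p ℕ.^ j) ∣ * ω p j) (λ j → ∣ f (p ℕ.^ j) ℂ!.- g (p ℕ.^ j) ∣ * ω p j) λ j _ →
        let instance p^j≢0 = ℕ.m^n≢0 p j {{prime⇒nonZero pp}}
        in *-congʳ (∣∣-cong (ℂ!.sym (ℂ!.+-cong (f≈ (p ℕ.^ j)) (ℂ!.-‿cong (g≈ (p ℕ.^ j))))))

      f-bounded = ≪-pointwise {f} 0<γ (x≤x⊔y α β) S[f]≪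

      S-cong : ∀ {a b} → (∀ n .{{_ : NonZero n}} → a n ℂ!.≈ b n) → ∀ N → ∣ S a N ∣ ≈ ∣ S b N ∣
      S-cong {a} {b} a≈b N = ∣∣-cong (∑ℂ.∑₁-cong N a b λ n _ → a≈b n)

    summatory≪ : S[ g ]≪x^ (α ⊔ β)
    summatory≪ = pointwise-≪ {g} 0<γ λ unbounded →
      C.summatory-bounded v (weight-nonNeg 0<γ) w ρ 1≤ρ 1+ρw≤ρ v-contract ω ω-nonNeg ω-anti v-orbit F G
        F-multiplicative G-multiplicative F-unit G-unit (proj₁ (proj₂ f-bounded))
        (λ N → ≤-trans (≤-reflexive (sym (S-cong {f} {f̃} f≈ N))) (proj₂ (proj₂ f-bounded) N))
        {proj₁ finite}
        (λ N → proj₁ (proj₂ finite) (∑₁ N (C.distanceTerm ω F G)) (N , ∑ℝ.∑₁-cong N (C.distanceTerm ω F G) _ λ p _ → distanceTerm≈ p))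
        λ (E , 0≤E , S≤E) → unbounded (E , 0≤E , λ N → ≤-trans (≤-reflexive (S-cong {g} {g̃} g≈ N)) (S≤E N))

theorem4 : ∀ {ℓ} (R : CompleteOrderedField ℓ) →
           let open Reals R
               open ArithmeticFunctions R
           in (d : ℕ) .{{_ : NonZero d}} (f g : ArithmeticFunction) (α β : ℝ) →
              𝒮 d f → 𝒮 d g →
              0# < β → FiniteDistance β d f g →
              S[ f ]≪x^ α →
              S[ g ]≪x^ (α ⊔ β)
theorem4 R d f g α β = Theorem.summatory≪ R
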